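{- Let $e\ge 3$ be an odd integer with $e\equiv 3 \pmod 4$, let $q=2^e$, and let $\mathcal{C}^3_\varepsilon:=\mathcal{C}(\mathcal{V}^3_\varepsilon)$ be the projective code over $\mathbb{F}_{q^2}$ generated by the point set $\mathcal{V}^3_\varepsilon\subset\mathrm{PG}(3,q^2)$ (defined in the context, with $r=3$). Then the weights of the non-zero codewords of $\mathcal{C}^3_\varepsilon$ belong to the set $$\{q^5,\ q^5-q^3+3q^2,\ q^5-q^3+2q^2,\ q^5-q^3+3q^2+q-2,\ q^5-q^3+2q^2+q-2\}.$$
   Context: Let $e\ge 3$ be odd, $q=2^e$, $r\ge 2$. Points of $\mathrm{PG}(r,q^2)$ (projective space of projective dimension $r$ over $\mathbb{F}_{q^2}$) have homogeneous coordinates $(X_0,\dots,X_r)$; $\Pi_\infty$ is the hyperplane $X_0=0$, and affine coordinates on the complement $\mathrm{AG}(r,q^2)$ are $x_i=X_i/X_0$. For an exponent involving $\sigma$, $\sigma$ stands for $2^{(e+1)/2}$, i.e. $x^{\sigma}=x^{2^{(e+1)/2}}$ and $x^{\sigma+2}=x^{2^{(e+1)/2}+2}$. Fix $\varepsilon\in\mathbb{F}_{q^2}\setminus\mathbb{F}_q$ such that $\varepsilon^2+\varepsilon+\delta=0$ for some $\delta\in\mathbb{F}_q\setminus\{1\}$ with absolute trace $\mathrm{Tr}_{q/2}(\delta)=\sum_{i=0}^{e-1}\delta^{2^i}=1$. Put $$\Gamma_{\varepsilon}(x)=[x+(x^q+x)\varepsilon]^{\sigma+2}+(x^q+x)^{\sigma}+(x^{2q}+x^2)\varepsilon+x^{q+1}+x^2.$$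 $\mathcal{V}^r_\varepsilon$ is the projective hypersurface of $\mathrm{PG}(r,q^2)$ with affine equation $x_r^q+x_r=\Gamma_{\varepsilon}(x_1)+\dots+\Gamma_{\varepsilon}(x_{r-1})$, i.e. the zero locus of the homogenization (with respect to $X_0$) of the corresponding polynomial; it is identified with its set of $\mathbb{F}_{q^2}$-rational points. For a set $\Omega$ of $N$ points of $\mathrm{PG}(r,q^2)$, $\mathcal{C}(\Omega)$ is the linear code of length $N$ over $\mathbb{F}_{q^2}$ spanned by the rows of an $(r+1)\times N$ matrix whose columns are coordinate vectors of the points of $\Omega$ (one representative per point); it is unique up to monomial equivalence. The weight of a codeword is its Hamming weight. -}

module Defs where

open import Level as Level using (_⊔_)
open import Algebra.Bundles using (CommutativeRing)
open import Algebra.Apartness.Bundles using (HeytingField)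
import Algebra.Properties.CommutativeMonoid.Sum as MonoidSum
import Algebra.Properties.Semiring.Exp as SemiringExp
open import Data.Fin.Base using (Fin; toℕ; fromℕ; inject₁)
open import Data.List.Base as List using (List; []; _∷_; [_])
open import Data.List.Extrema.Nat using (max)
open import Data.Nat.Base as ℕ using (ℕ; zero; suc)
open import Data.Nat.DivMod using (_/_)
import Data.Nat.Properties as ℕ using (_≟_)
open import Data.Product.Base using (∃; _×_; _,_; proj₁; proj₂)
open import Data.Vec.Base as Vec using (Vec)
import Data.Vec.Properties as Vec using (≡-dec)
open import Data.Vec.Functional as Vector using (Vector)
open import Function.Base using (_∘_)
open import Function.Bundles using (Inverse)
open import Function.Properties.Inverse using (Inverse⇒Injection)
open import Relation.Binary.Definitions using (Decidable)
open import Relation.Binary.PropositionalEquality as ≡ using (_≡_)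
open import Relation.Nullary.Decidable using (via-injection; ¬?)
open import Relation.Nullary.Negation using (¬_)
import Data.Fin.Properties as Fin using (_≟_)

-- Finiteness makes both _≈_ and invertibility decidable, hence _#_ is
-- equivalent to _≉_ and the Heyting field is a field in the classical sense.

record FiniteField c ℓ₁ ℓ₂ (order : ℕ) : Set (Level.suc (c ⊔ ℓ₁ ⊔ ℓ₂)) where
  field
    heytingField : HeytingField c ℓ₁ ℓ₂

  commutativeRing : CommutativeRing c ℓ₁
  commutativeRing = record
    { isCommutativeRing = HeytingField.isCommutativeRing heytingField }

  open CommutativeRing commutativeRing public

  field
    enumeration : Inverse setoid (≡.setoid (Fin order))

  infix 4 _≟_
  _≟_ : Decidable _≈_
  _≟_ = via-injection (Inverse⇒Injection enumeration) Fin._≟_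

  open SemiringExp semiring public using (_^_)
  open MonoidSum +-commutativeMonoid public using (sum)
  open MonoidSum *-commutativeMonoid public using () renaming (sum to product)

module Polynomials {c ℓ₁ ℓ₂ order} (F : FiniteField c ℓ₁ ℓ₂ order) where
  open FiniteField F

  -- A polynomial in n variables is a list of terms a · x^m, written (a , m).
  -- Exponent vectors may be repeated and coefficients may vanish, so the
  -- coefficient of a monomial is the sum over all its occurrences.

  Poly : ℕ → Set c
  Poly n = List (Carrier × Vec ℕ n)

  module _ {n : ℕ} where
    infixl 6 _+ₚ_ _-ₚ_
    infixl 7 _*ₚ_
    infixr 8 _^ₚ_

    con : Carrier → Poly n
    con a = [ a , Vec.replicate n 0 ]

    var : Fin n → Poly n
    var i = [ 1# , (Vec.replicate n 0 Vec.[ i ]≔ 1) ]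

    _+ₚ_ _-ₚ_ _*ₚ_ : Poly n → Poly n → Poly n
    p +ₚ p′ = p List.++ p′
    p -ₚ p′ = p +ₚ List.map (λ (a , m) → - a , m) p′
    p *ₚ p′ = List.cartesianProductWith
      (λ (a , m) (b , k) → a * b , Vec.zipWith ℕ._+_ m k) p p′

    _^ₚ_ : Poly n → ℕ → Poly n
    p ^ₚ zero  = con 1#
    p ^ₚ suc k = p *ₚ (p ^ₚ k)

    sumₚ : ∀ {k} → Vector (Poly n) k → Poly n
    sumₚ = Vector.foldr _+ₚ_ []

    coeff : Poly n → Vec ℕ n → Carrier
    coeff p m = List.foldr _+_ 0#
      (List.map proj₁ (List.filter (λ (_ , k) → Vec.≡-dec ℕ._≟_ k m) p))

    -- Total degree, with the convention deg 0 = 0.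
    deg : Poly n → ℕ
    deg p = max 0
      (List.map (Vec.sum ∘ proj₂)
        (List.filter (λ (_ , m) → ¬? (coeff p m ≟ 0#)) p))

    eval : Poly n → Vector Carrier n → Carrier
    eval p x = List.foldr _+_ 0#
      (List.map (λ (a , m) → a * product (λ i → x i ^ Vec.lookup m i)) p)

  -- The homogenizing variable is put in position zero.  Terms of degree
  -- exceeding deg p have coefficients that cancel, so the truncation of _∸_
  -- is harmless for them.
  homogenize : ∀ {n} → Poly n → Poly (suc n)
  homogenize p = List.map (λ (a , m) → a , (deg p ℕ.∸ Vec.sum m) Vec.∷ m) p

module Projective {c ℓ₁ ℓ₂ order} (F : FiniteField c ℓ₁ ℓ₂ order) where
  open FiniteField F

  -- Points of PG(r , F) are represented by their coordinate vectors, that is,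
  -- by nonzero vectors indexed by Fin (suc r), up to _∼_.

  IsNonZero : ∀ {n} → Vector Carrier n → Set ℓ₁
  IsNonZero x = ∃ λ i → x i ≉ 0#

  infix 4 _∼_
  _∼_ : ∀ {n} → Vector Carrier n → Vector Carrier n → Set (c ⊔ ℓ₁)
  x ∼ y = ∃ λ t → t ≉ 0# × (∀ i → y i ≈ t * x i)

  -- Ω is given by the set of all coordinate vectors of its points.  The matrix
  -- G has one column for each point of Ω.
  record IsPointMatrix {ℓ r N} (Ω : Vector Carrier (suc r) → Set ℓ)
                       (G : Vector (Vector Carrier N) (suc r))
                       : Set (c ⊔ ℓ₁ ⊔ ℓ) where
    column : Fin N → Vector Carrier (suc r)
    column j i = G i j
    field
      nonZero  : ∀ j → IsNonZero (column j)
      sound    : ∀ j → Ω (column j)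
      complete : ∀ x → IsNonZero x → Ω x → ∃ λ j → x ∼ column j
      distinct : ∀ j k → column j ∼ column k → j ≡ k

  RowSpan : ∀ {k N} → Vector (Vector Carrier N) k → Vector Carrier N → Set (c ⊔ ℓ₁)
  RowSpan {k} G w =
    ∃ λ (a : Vector Carrier k) → ∀ j → w j ≈ sum (λ i → a i * G i j)

  weight : ∀ {N} → Vector Carrier N → ℕ
  weight w = Vec.count (λ x → ¬? (x ≟ 0#)) (Vec.tabulate w)

module Hypersurface {c ℓ₁ ℓ₂} (e : ℕ)
                    (F : FiniteField c ℓ₁ ℓ₂ ((2 ℕ.^ e) ℕ.^ 2)) where
  open FiniteField F
  open Polynomials F
  open Projective F

  q : ℕ
  q = 2 ℕ.^ e

  σ : ℕ
  σ = 2 ℕ.^ ((e ℕ.+ 1) / 2)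

  -- The subfield of order q.
  𝔽q : Carrier → Set ℓ₁
  𝔽q x = x ^ q ≈ x

  Tr : Carrier → Carrier
  Tr x = sum {e} (λ i → x ^ (2 ℕ.^ toℕ i))

  record Admissible (ε δ : Carrier) : Set ℓ₁ where
    field
      ε∉𝔽q : ¬ 𝔽q ε
      δ∈𝔽q : 𝔽q δ
      δ≉1  : δ ≉ 1#
      Trδ≈1 : Tr δ ≈ 1#
      ε²+ε+δ≈0 : ε ^ 2 + ε + δ ≈ 0#

  module _ (ε : Carrier) where

    Γ : ∀ {n} → Poly n → Poly n
    Γ x = (x +ₚ (x ^ₚ q +ₚ x) *ₚ con ε) ^ₚ (σ ℕ.+ 2)
       +ₚ (x ^ₚ q +ₚ x) ^ₚ σ
       +ₚ (x ^ₚ (2 ℕ.* q) +ₚ x ^ₚ 2) *ₚ con ε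
       +ₚ x ^ₚ (q ℕ.+ 1)
       +ₚ x ^ₚ 2

    -- The affine coordinates x₁ , … , xᵣ are the variables 0 , … , r - 1.
    affinePoly : ∀ r → .⦃ ℕ.NonZero r ⦄ → Poly r
    affinePoly (suc m) =
      (var (fromℕ m) ^ₚ q +ₚ var (fromℕ m)) -ₚ sumₚ (λ i → Γ (var (inject₁ i)))

    𝒱 : ∀ r → .⦃ ℕ.NonZero r ⦄ → Vector Carrier (suc r) → Set ℓ₁
    𝒱 r x = eval (homogenize (affinePoly r)) x ≈ 0#

{-# OPTIONS --safe #-}
module Submission where

-- Write x = a + b ε with a, b ∈ 𝔽q; then Γ(x) = f(a , b) with
-- f(a , b) = a^(σ+2) + b^σ + a b, the equation of the Tits ovoid.  The Suzuki
-- group acts: translations absorb the linear terms of f(a , b) + im(c x), and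
-- the torus permutes the nonzero values of f, so x ↦ Γ(x) + im(c x) takes one
-- value of 𝔽q once and every other value q + 1 times.  A plane not through
-- P = (0 , 0 , 0 , 1) meets the affine part in the fibre of a sum of two such
-- maps, hence in q³ - q or q³ + q² - q points; other affine planes meet it in
-- q³ points.  At infinity X₁^(σ+2) = X₂^(σ+2) amounts to X₁³ = X₂³ because
-- e ≡ 3 (mod 4), so the hypersurface consists of three lines through P there.
-- Weights are differences from the total number q⁵ + 3 q² + 1 of points.

open import Defs
open import Level as Level using (Level; _⊔_)
open import Algebra.Apartness.Bundles using (HeytingField)
open import Algebra.Bundles using (RawRing)
import Algebra.Properties.CommutativeMonoid.Sum as MonoidSum
import Algebra.Properties.CommutativeSemigroup as CommutativeSemigroup
import Algebra.Properties.CommutativeSemiring.Exp as Exp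
import Algebra.Properties.Ring as RingProperties
import Algebra.Properties.Semiring.Mult as Mult
import Algebra.Solver.Ring as RingSolver
open import Algebra.Solver.Ring.AlmostCommutativeRing using (fromCommutativeRing; _-Raw-AlmostCommutative⟶_)
open import Data.Bool.Base using (Bool; true; false; _xor_; _∧_; if_then_else_)
open import Data.Fin.Base as Fin using (Fin)
open import Data.Fin.Patterns using (0F; 1F; 2F; 3F)
import Data.Fin.Permutation as Perm
import Data.Fin.Properties as Fin
open import Data.List.Base as List using (List; []; _∷_)
open import Data.List.Extrema.Nat using (max≈v⁺)
open import Data.List.Membership.Propositional using (_∈_)
open import Data.List.Membership.Propositional.Properties using (∈-map⁺; ∈-filter⁺)
import Data.List.Properties as List
open import Data.List.Relation.Unary.All as All using (All; []; _∷_)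
import Data.List.Relation.Unary.All.Properties as All
open import Data.List.Relation.Unary.Any using (here; there)
open import Data.Maybe.Base using (Maybe; just; nothing)
open import Data.Nat.Base as ℕ using (ℕ; zero; suc)
open import Data.Nat.Divisibility using (_∣_)
open import Data.Nat.DivMod using (_/_; _%_; m≡m%n+[m/n]*n; m*n/n≡m)
import Data.Nat.ListAction as ℕ using (sum)
import Data.Nat.Properties as ℕ
open import Data.Nat.Tactic.RingSolver using (solve-∀)
open import Data.Product.Base using (∃; _×_; _,_; proj₁; proj₂)
open import Data.Product.Relation.Binary.Pointwise.NonDependent using (Pointwise; ×-decidable)
open import Data.Sum.Base using (_⊎_; inj₁; inj₂; [_,_]′)
open import Data.Unit.Base using (⊤; tt)
open import Data.Vec.Base as Vec using (Vec)
open import Data.Vec.Functional as Vector using (Vector)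
import Data.Vec.Properties as Vec
open import Function.Base using (_∘_; id)
open import Function.Bundles using (Inverse)
open import Relation.Binary.Core using (Rel)
open import Relation.Binary.Definitions using (tri<; tri≈; tri>) renaming (Decidable to Decidable₂)
open import Relation.Binary.PropositionalEquality as ≡ using (_≡_; _≢_; cong; cong₂)
open import Relation.Nullary.Decidable using (Dec; yes; no; does; ¬?; _×-dec_; decidable-stable)
open import Relation.Nullary.Negation using (¬_; contradiction)
open import Relation.Unary using (Decidable)

-- Two facts about exponents carry the counts. On `𝔽q` the exponent `σ` is a square root of
-- Frobenius, since σ² = 2q. Translations and torus act on `f` for this reason, and `f` vanishes
-- only at the origin: if f(1 , b) = 0, applying `σ` to b^σ + b = 1 and adding gives b² = b, which
-- is absurd. The q - 1 nonzero values therefore share the remaining q² - 1 arguments equally,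
-- whence the fibre size q + 1. At infinity q² = 4s⁴ with s = σ/2: from y^(s+1) = 1 it follows that
-- y^(s²) = y and so y = y^(q²) = y⁴. The converse needs 3 to divide s + 1, that is, `s` to be an
-- odd power of 2, which is what the congruence on `e` provides.
--
-- Two features of the definitions shape the rest. `homogenize` depends on `deg`, which discards
-- cancelling terms, so the degree (σ + 2) q has to be certified by a surviving coefficient, here
-- ε^(σ+2). And `IsPointMatrix` admits any representative of a point, so whatever is counted among
-- the columns must be invariant under scaling.

module Counting where

  -- Counting in finite setoids.

  private variable
    a b p r : Level
    A B : Set a

  indicator : {P : Set p} → Dec P → ℕ
  indicator P? = if does P? then 1 else 0

  indicator-yes : {P : Set p} (P? : Dec P) → P → indicator P? ≡ 1
  indicator-yes (yes _) _ = ≡.refl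
  indicator-yes (no ¬p) p = contradiction p ¬p

  indicator-no : {P : Set p} (P? : Dec P) → ¬ P → indicator P? ≡ 0
  indicator-no (yes p) ¬p = contradiction p ¬p
  indicator-no (no _)  _  = ≡.refl

  indicator-cong : {P : Set p} {Q : Set r} (P? : Dec P) (Q? : Dec Q) →
                   (P → Q) → (Q → P) → indicator P? ≡ indicator Q?
  indicator-cong P? (yes q) _ g = indicator-yes P? (g q)
  indicator-cong P? (no ¬q) f _ = indicator-no P? (¬q ∘ f)

  indicator-× : {P : Set p} {Q : Set r} (P? : Dec P) (Q? : Dec Q) →
                indicator (P? ×-dec Q?) ≡ indicator P? ℕ.* indicator Q?
  indicator-× (yes _) (yes _) = ≡.refl
  indicator-× (yes _) (no _)  = ≡.refl
  indicator-× (no _)  _       = ≡.refl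

  ∑ : List A → (A → ℕ) → ℕ
  ∑ xs f = ℕ.sum (List.map f xs)

  ∑-cong : ∀ (xs : List A) {f g : A → ℕ} → (∀ x → f x ≡ g x) → ∑ xs f ≡ ∑ xs g
  ∑-cong []       f≗g = ≡.refl
  ∑-cong (x ∷ xs) f≗g = cong₂ ℕ._+_ (f≗g x) (∑-cong xs f≗g)

  ∑-zero : ∀ (xs : List A) → ∑ xs (λ _ → 0) ≡ 0
  ∑-zero []       = ≡.refl
  ∑-zero (_ ∷ xs) = ∑-zero xs

  ∑-distrib-+ : ∀ (xs : List A) (f g : A → ℕ) → ∑ xs (λ x → f x ℕ.+ g x) ≡ ∑ xs f ℕ.+ ∑ xs g
  ∑-distrib-+ []       f g = ≡.refl
  ∑-distrib-+ (x ∷ xs) f g = ≡.trans (cong (f x ℕ.+ g x ℕ.+_) (∑-distrib-+ xs f g))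
    (CommutativeSemigroup.interchange ℕ.+-commutativeSemigroup (f x) (g x) (∑ xs f) (∑ xs g))

  ∑-distrib-* : ∀ (xs : List A) k (f : A → ℕ) → ∑ xs (λ x → k ℕ.* f x) ≡ k ℕ.* ∑ xs f
  ∑-distrib-* []       k f = ≡.sym (ℕ.*-zeroʳ k)
  ∑-distrib-* (x ∷ xs) k f = ≡.trans (cong (k ℕ.* f x ℕ.+_) (∑-distrib-* xs k f))
    (≡.sym (ℕ.*-distribˡ-+ k (f x) (∑ xs f)))

  ∑-swap : ∀ (xs : List A) (ys : List B) (f : A → B → ℕ) →
           ∑ xs (λ x → ∑ ys (f x)) ≡ ∑ ys (λ y → ∑ xs (λ x → f x y))
  ∑-swap []       ys f = ≡.sym (∑-zero ys)
  ∑-swap (x ∷ xs) ys f = ≡.trans (cong (∑ ys (f x) ℕ.+_) (∑-swap xs ys f))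
    (≡.sym (∑-distrib-+ ys (f x) (λ y → ∑ xs (λ x → f x y))))

  ∑-++ : ∀ (xs ys : List A) (f : A → ℕ) → ∑ (xs List.++ ys) f ≡ ∑ xs f ℕ.+ ∑ ys f
  ∑-++ []       ys f = ≡.refl
  ∑-++ (x ∷ xs) ys f = ≡.trans (cong (f x ℕ.+_) (∑-++ xs ys f)) (≡.sym (ℕ.+-assoc (f x) _ _))

  ∑-map : ∀ (h : A → B) (xs : List A) (f : B → ℕ) → ∑ (List.map h xs) f ≡ ∑ xs (f ∘ h)
  ∑-map h xs f = cong ℕ.sum (≡.sym (List.map-∘ xs))

  ∑-cartesianProduct : ∀ (xs : List A) (ys : List B) (f : A × B → ℕ) →
    ∑ (List.cartesianProduct xs ys) f ≡ ∑ xs (λ x → ∑ ys (λ y → f (x , y)))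
  ∑-cartesianProduct []       ys f = ≡.refl
  ∑-cartesianProduct (x ∷ xs) ys f = ≡.trans (∑-++ (List.map (x ,_) ys) _ f)
    (cong₂ ℕ._+_ (∑-map (x ,_) ys f) (∑-cartesianProduct xs ys f))

  -- Field elements form a setoid, so an enumeration is exact only up to `_≋_`. Phrasing `once` as a
  -- count lets products and `count-unique` use it by plain arithmetic.
  record Finite {a} (A : Set a) ℓ : Set (a ⊔ Level.suc ℓ) where
    infix 4 _≋_ _≋?_
    field
      _≋_      : Rel A ℓ
      _≋?_     : Decidable₂ _≋_
      elements : List A
      once     : ∀ x → ∑ elements (λ y → indicator (y ≋? x)) ≡ 1

  open Finite using (elements)

  module _ {A : Set a} {ℓ} (X : Finite A ℓ) where
    private variable P R Q : A → Set p
    open Finite X using (_≋_; _≋?_; once)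

    count : Decidable P → ℕ
    count P? = ∑ (elements X) (indicator ∘ P?)

    size : ℕ
    size = List.length (elements X)

    count-all : (P? : Decidable P) → (∀ x → P x) → count P? ≡ size
    count-all P? all = go (elements X)
      where
      go : ∀ xs → ∑ xs (indicator ∘ P?) ≡ List.length xs
      go []       = ≡.refl
      go (x ∷ xs) = cong₂ ℕ._+_ (indicator-yes (P? x) (all x)) (go xs)

    count-cong : (P? : Decidable P) (Q? : Decidable Q) →
                 (∀ {x} → P x → Q x) → (∀ {x} → Q x → P x) → count P? ≡ count Q?
    count-cong P? Q? f g = ∑-cong (elements X) λ x → indicator-cong (P? x) (Q? x) f g

    count-none : (P? : Decidable P) → (∀ x → ¬ P x) → count P? ≡ 0
    count-none P? none = ≡.trans (∑-cong (elements X) λ x → indicator-no (P? x) (none x))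
                                 (∑-zero (elements X))

    count-unique : (P? : Decidable P) (x₀ : A) →
                   (∀ {x} → P x → x ≋ x₀) → (∀ {x} → x ≋ x₀ → P x) → count P? ≡ 1
    count-unique P? x₀ f g = ≡.trans (count-cong P? (_≋? x₀) f g) (once x₀)

    count-split : (P? : Decidable P) (R? : Decidable R) →
      count P? ≡ count (λ x → P? x ×-dec R? x) ℕ.+ count (λ x → P? x ×-dec ¬? (R? x))
    count-split P? R? = ≡.trans (∑-cong (elements X) (λ x → lemma (P? x) (R? x)))
                                (∑-distrib-+ (elements X) _ _)
      where
      lemma : ∀ {P : Set p} {R : Set r} (P? : Dec P) (R? : Dec R) →
        indicator P? ≡ indicator (P? ×-dec R?) ℕ.+ indicator (P? ×-dec ¬? R?)
      lemma (yes _) (yes _) = ≡.refl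
      lemma (yes _) (no _)  = ≡.refl
      lemma (no _)  _       = ≡.refl

  module _ {A : Set a} {B : Set b} {ℓ ℓ′} (X : Finite A ℓ) (Y : Finite B ℓ′) where
    private
      variable
        P : A → Set p
        Q : B → Set p
        R : A → B → Set r
      module X = Finite X
      module Y = Finite Y

    ×-finite : Finite (A × B) (ℓ ⊔ ℓ′)
    ×-finite = record
      { _≋_      = Pointwise X._≋_ Y._≋_
      ; _≋?_     = ×-decidable X._≋?_ Y._≋?_
      ; elements = List.cartesianProduct (elements X) (elements Y)
      ; once     = λ (x , y) → ≡.trans
          (∑-cartesianProduct (elements X) (elements Y) _)
          (≡.trans (∑-cong (elements X) λ x′ → ≡.trans
              (∑-cong (elements Y) λ y′ → indicator-× (x′ X.≋? x) (y′ Y.≋? y))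
              (≡.trans (∑-distrib-* (elements Y) (indicator (x′ X.≋? x)) _)
              (≡.trans (cong (indicator (x′ X.≋? x) ℕ.*_) (Y.once y)) (ℕ.*-identityʳ _))))
            (X.once x))
      }

    -- Off `P` the fibres are empty, so a constant fibre size is needed only on `P`.
    ∑-fibres : ∀ (P? : Decidable P) (R? : ∀ x y → Dec (R x y)) k →
      (∀ {x y} → R x y → P x) → (∀ {x} → P x → count Y (R? x) ≡ k) →
      ∑ (elements X) (λ x → count Y (R? x)) ≡ k ℕ.* count X P?
    ∑-fibres {P = P} P? R? k R⇒P fibre = ≡.trans (∑-cong (elements X) (λ x → lemma x (P? x)))
                                         (∑-distrib-* (elements X) k _)
      where
      lemma : ∀ x (Px? : Dec (P x)) → count Y (R? x) ≡ k ℕ.* indicator Px?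
      lemma x (yes p) = ≡.trans (fibre p) (≡.sym (ℕ.*-identityʳ k))
      lemma x (no ¬p) = ≡.trans (count-none Y (R? x) (λ y → ¬p ∘ R⇒P)) (≡.sym (ℕ.*-zeroʳ k))

    count-fibres : ∀ (P? : Decidable P) (R? : ∀ x y → Dec (R x y)) k →
      (∀ {x y} → R x y → P x) → (∀ {x} → P x → count Y (R? x) ≡ k) →
      count ×-finite (λ (x , y) → R? x y) ≡ k ℕ.* count X P?
    count-fibres P? R? k R⇒P fibre = ≡.trans (∑-cartesianProduct (elements X) (elements Y) _)
                                       (∑-fibres P? R? k R⇒P fibre)

  count-fibresʳ : ∀ {A : Set a} {B : Set b} {ℓ ℓ′} (X : Finite A ℓ) (Y : Finite B ℓ′)
    {Q : B → Set p} {R : A → B → Set r} (Q? : Decidable Q) (R? : ∀ x y → Dec (R x y)) k →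
    (∀ {x y} → R x y → Q y) → (∀ {y} → Q y → count X (λ x → R? x y) ≡ k) →
    count (×-finite X Y) (λ (x , y) → R? x y) ≡ k ℕ.* count Y Q?
  count-fibresʳ X Y Q? R? k R⇒Q fibre = ≡.trans (∑-cartesianProduct (elements X) (elements Y) _)
    (≡.trans (∑-swap (elements X) (elements Y) (λ x y → indicator (R? x y)))
      (∑-fibres Y X Q? (λ y x → R? x y) k R⇒Q fibre))

  module _ {A : Set a} {B : Set b} {ℓ ℓ′} (X : Finite A ℓ) (Y : Finite B ℓ′) where
    private
      variable
        P : A → Set p
        Q : B → Set p
        R : A → B → Set r
      module X = Finite X
      module Y = Finite Y

    double-count : ∀ (P? : Decidable P) (Q? : Decidable Q)
      (R? : ∀ x y → Dec (R x y)) k l →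
      (∀ {x y} → R x y → P x) → (∀ {x} → P x → count Y (R? x) ≡ k) →
      (∀ {x y} → R x y → Q y) → (∀ {y} → Q y → count X (λ x → R? x y) ≡ l) →
      k ℕ.* count X P? ≡ l ℕ.* count Y Q?
    double-count P? Q? R? k l R⇒P fibreˡ R⇒Q fibreʳ = ≡.trans
      (≡.sym (∑-fibres X Y P? R? k R⇒P fibreˡ))
      (≡.trans (∑-swap (elements X) (elements Y) (λ x y → indicator (R? x y)))
        (∑-fibres Y X Q? (λ y x → R? x y) l R⇒Q fibreʳ))

    -- Double counting of the graph of `f` on `P`, with both fibre sizes 1. As `_≋_` comes without
    -- laws, the first premise on `f` packages the invariance of `P` and of the graph.
    count-bijection : (P? : Decidable P) (Q? : Decidable Q) (f : A → B) →
      (∀ {x x′ y} → P x → y Y.≋ f x → x′ X.≋ x → P x′ × y Y.≋ f x′) →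
      (∀ {x y} → P x → y Y.≋ f x → Q y) →
      (∀ {x x′ y} → P x → P x′ → y Y.≋ f x → y Y.≋ f x′ → x X.≋ x′) →
      (∀ {y} → Q y → ∃ λ x → P x × y Y.≋ f x) →
      count X P? ≡ count Y Q?
    count-bijection P? Q? f resp sound inj surj = ≡.trans (≡.sym (ℕ.*-identityˡ _)) (≡.trans
      (double-count P? Q? (λ x y → P? x ×-dec (y Y.≋? f x)) 1 1 proj₁
        (λ {x} Px → count-unique Y (λ y → P? x ×-dec (y Y.≋? f x)) (f x) proj₂ (Px ,_))
        (λ (Px , y≋fx) → sound Px y≋fx)
        (λ {y} Qy → let x , Px , y≋fx = surj Qy in
          count-unique X (λ x → P? x ×-dec (y Y.≋? f x)) x
            (λ (Px′ , y≋fx′) → inj Px′ Px y≋fx′ y≋fx)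
            (λ x′≋x → resp Px y≋fx x′≋x)))
      (ℕ.*-identityˡ _))

  ∑-tabulate : ∀ {n} (g : Fin n → A) (f : A → ℕ) →
               ∑ (List.tabulate g) f ≡ ∑ (List.allFin n) (f ∘ g)
  ∑-tabulate g f = cong ℕ.sum (≡.trans (List.map-tabulate g f) (≡.sym (List.map-tabulate id (f ∘ g))))

  Fin-finite : ∀ n → Finite (Fin n) _
  Fin-finite n = record
    { _≋_ = _≡_ ; _≋?_ = Fin._≟_ ; elements = List.allFin n ; once = once }
    where
    once : ∀ {n} (i : Fin n) → ∑ (List.allFin n) (λ j → indicator (j Fin.≟ i)) ≡ 1
    once {suc n} Fin.zero = cong suc (≡.trans (∑-tabulate {n = n} Fin.suc _) (∑-zero (List.allFin n)))
    once {suc n} (Fin.suc i) = ≡.trans (∑-tabulate {n = n} Fin.suc _)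
      (≡.trans (∑-cong (List.allFin n) λ j →
          indicator-cong (Fin.suc j Fin.≟ Fin.suc i) (j Fin.≟ i) Fin.suc-injective (cong Fin.suc))
        (once i))

  -- Connects the `Vec.count` in the definition of `weight` with `count`.
  Vec-count-tabulate : ∀ {P : A → Set p} {n} (P? : Decidable P) (f : Fin n → A) →
    Vec.count P? (Vec.tabulate f) ≡ count (Fin-finite n) (P? ∘ f)
  Vec-count-tabulate {n = zero}  P? f = ≡.refl
  Vec-count-tabulate {n = suc n} P? f with ih ← ≡.trans (Vec-count-tabulate P? (f ∘ Fin.suc)) (≡.sym (∑-tabulate {n = n} Fin.suc _)) | does (P? (f Fin.zero))
  ... | true  = cong suc ih
  ... | false = ih

open Counting

-- Inverses, characteristic and Fermat's theorem in a finite field.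

module FiniteFieldProperties {c ℓ₁ ℓ₂ order} (F : FiniteField c ℓ₁ ℓ₂ order) where
  open FiniteField F
  open HeytingField heytingField using (_#_; #⇒invertible; invertible⇒#; tight; #-irrefl)
  open Inverse enumeration using (to; from; to-cong; strictlyInverseˡ; strictlyInverseʳ)
  open Exp commutativeSemiring public using (^-congˡ; ^-congʳ; ^-homo-*; ^-assocʳ; ^-distrib-*)
  open Mult semiring using () renaming (_×_ to _ₙ×_)
  private
    module S = MonoidSum +-commutativeMonoid
    module P = MonoidSum *-commutativeMonoid
  open import Relation.Binary.Reasoning.Setoid setoid

  finite : Finite Carrier ℓ₁
  finite = record
    { _≋_ = _≈_ ; _≋?_ = _≟_
    ; elements = List.map from (List.allFin order)
    ; once = λ x → ≡.trans (∑-map from (List.allFin order) _)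
        (≡.trans (∑-cong (List.allFin order) λ i →
            indicator-cong (from i ≟ x) (i Fin.≟ to x)
              (λ eq → ≡.trans (≡.sym (strictlyInverseˡ i)) (to-cong eq))
              (λ eq → trans (reflexive (cong from eq)) (strictlyInverseʳ x)))
          (Finite.once (Fin-finite order) (to x)))
    }

  size-finite : size finite ≡ order
  size-finite = ≡.trans (List.length-map from (List.allFin order)) (List.length-tabulate {n = order} id)

  -- Were they equal, `0#` would have an inverse and so be apart from itself.
  1≉0 : 1# ≉ 0#
  1≉0 1≈0 = #-irrefl {0#} refl (invertible⇒#
    (0# , trans (zeroˡ _) (sym 1≈0) , trans (zeroʳ _) (sym 1≈0)))

  -- Tightness only gives ¬ ¬ (x # 0#); the inverse is found by searching the field.
  inverse : ∀ x → x ≉ 0# → ∃ λ y → x * y ≈ 1#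
  inverse x x≉0 with Fin.any? {n = order} (λ i → x * from i ≟ 1#)
  ... | yes (i , eq) = from i , eq
  ... | no none = contradiction (proj₁ (tight x 0#) λ x#0 →
        let y , _ , [x-0]y≈1 = #⇒invertible x#0 in
        none (to y , (begin
          x * from (to y) ≈⟨ *-cong (sym x-0≈x) (strictlyInverseʳ y) ⟩
          (x - 0#) * y    ≈⟨ [x-0]y≈1 ⟩
          1#              ∎))) x≉0
    where
    x-0≈x : x - 0# ≈ x
    x-0≈x = trans (+-congˡ (RingProperties.-0#≈0# ring)) (+-identityʳ x)

  infix 9 _⁻¹
  abstract
    -- 0# ⁻¹ is 0#.
    _⁻¹ : Carrier → Carrier
    x ⁻¹ with x ≟ 0#
    ... | yes _ = 0#
    ... | no x≉0 = proj₁ (inverse x x≉0)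

    ⁻¹-inverseʳ : ∀ {x} → x ≉ 0# → x * x ⁻¹ ≈ 1#
    ⁻¹-inverseʳ {x} x≉0 with x ≟ 0#
    ... | yes x≈0 = contradiction x≈0 x≉0
    ... | no x≉0′ = proj₂ (inverse x x≉0′)

  ⁻¹-inverseˡ : ∀ {x} → x ≉ 0# → x ⁻¹ * x ≈ 1#
  ⁻¹-inverseˡ x≉0 = trans (*-comm _ _) (⁻¹-inverseʳ x≉0)

  *-cancelˡ : ∀ {x y z} → x ≉ 0# → x * y ≈ x * z → y ≈ z
  *-cancelˡ {x} {y} {z} x≉0 xy≈xz = begin
    y              ≈⟨ *-identityˡ y ⟨
    1# * y         ≈⟨ *-congʳ (⁻¹-inverseˡ x≉0) ⟨
    x ⁻¹ * x * y   ≈⟨ *-assoc _ _ _ ⟩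
    x ⁻¹ * (x * y) ≈⟨ *-congˡ xy≈xz ⟩
    x ⁻¹ * (x * z) ≈⟨ *-assoc _ _ _ ⟨
    x ⁻¹ * x * z   ≈⟨ *-congʳ (⁻¹-inverseˡ x≉0) ⟩
    1# * z         ≈⟨ *-identityˡ z ⟩
    z              ∎

  x*y≈0⇒y≈0 : ∀ {x y} → x ≉ 0# → x * y ≈ 0# → y ≈ 0#
  x*y≈0⇒y≈0 x≉0 xy≈0 = *-cancelˡ x≉0 (trans xy≈0 (sym (zeroʳ _)))

  *-≉0 : ∀ {x y} → x ≉ 0# → y ≉ 0# → x * y ≉ 0#
  *-≉0 x≉0 y≉0 xy≈0 = y≉0 (x*y≈0⇒y≈0 x≉0 xy≈0)

  ^-≉0 : ∀ {x} n → x ≉ 0# → x ^ n ≉ 0#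
  ^-≉0 zero    x≉0 = 1≉0
  ^-≉0 (suc n) x≉0 = *-≉0 x≉0 (^-≉0 n x≉0)

  ^-≈0 : ∀ {x} n → x ^ n ≈ 0# → x ≈ 0#
  ^-≈0 {x} n x^n≈0 with x ≟ 0#
  ... | yes x≈0 = x≈0
  ... | no x≉0  = contradiction x^n≈0 (^-≉0 n x≉0)

  ⁻¹-≉0 : ∀ {x} → x ≉ 0# → x ⁻¹ ≉ 0#
  ⁻¹-≉0 x≉0 x⁻¹≈0 = 1≉0 (trans (sym (⁻¹-inverseʳ x≉0)) (trans (*-congˡ x⁻¹≈0) (zeroʳ _)))

  1^n≈1 : ∀ n → 1# ^ n ≈ 1#
  1^n≈1 zero    = refl
  1^n≈1 (suc n) = trans (*-identityˡ _) (1^n≈1 n)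

  0^1+n≈0 : ∀ {n} → 0 ℕ.< n → 0# ^ n ≈ 0#
  0^1+n≈0 (ℕ.s≤s _) = zeroˡ _

  private
    reindexing : (f g : Carrier → Carrier) → (∀ {x y} → x ≈ y → f x ≈ f y) → (∀ {x y} → x ≈ y → g x ≈ g y) →
      (∀ x → f (g x) ≈ x) → (∀ x → g (f x) ≈ x) → Perm.Permutation order order
    reindexing f g f-cong g-cong fg gf = Perm.permutation (to ∘ f ∘ from) (to ∘ g ∘ from)
        (λ i → ≡.trans (to-cong (trans (f-cong (strictlyInverseʳ _)) (fg _))) (strictlyInverseˡ i))
        (λ i → ≡.trans (to-cong (trans (g-cong (strictlyInverseʳ _)) (gf _))) (strictlyInverseˡ i))

  -- Translation by `1#` permutes the field, so the sum of all elements equals itself plus `order`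
  -- copies of `1#`.
  order×1≈0 : order ₙ× 1# ≈ 0#
  order×1≈0 = begin
    order ₙ× 1#                       ≈⟨ S.sum-replicate order ⟨
    S.sum (Vector.replicate order 1#) ≈⟨ +-cancelˡ ⟩
    0#                                ∎
    where
    Σ = S.sum from
    translate = reindexing (_+ 1#) (_- 1#) +-congʳ +-congʳ
      (λ x → trans (+-assoc _ _ _) (trans (+-congˡ (-‿inverseˡ 1#)) (+-identityʳ x)))
      (λ x → trans (+-assoc _ _ _) (trans (+-congˡ (-‿inverseʳ 1#)) (+-identityʳ x)))
    Σ≈Σ+n : Σ ≈ Σ + S.sum (Vector.replicate order 1#)
    Σ≈Σ+n = begin
      Σ                                ≈⟨ S.sum-permute from translate ⟩
      S.sum {order} (λ i → from (to (from i + 1#))) ≈⟨ S.sum-cong-≋ {order} (λ i → strictlyInverseʳ _) ⟩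
      S.sum {order} (λ i → from i + 1#) ≈⟨ S.∑-distrib-+ {order} from (λ _ → 1#) ⟩
      Σ + S.sum (Vector.replicate order 1#) ∎
    +-cancelˡ : S.sum (Vector.replicate order 1#) ≈ 0#
    +-cancelˡ = RingProperties.+-cancelˡ ring Σ _ _ (trans (sym Σ≈Σ+n) (sym (+-identityʳ Σ)))

  private
    product-single : ∀ {n} (t : Vector Carrier n) i → (∀ j → j ≢ i → t j ≈ 1#) → P.sum t ≈ t i
    product-single {suc n} t i others = begin
      P.sum t                         ≈⟨ P.sum-remove {i = i} t ⟩
      t i * P.sum (Vector.removeAt t i) ≈⟨ *-congˡ (P.sum-cong-≋ (λ j → others (Fin.punchIn i j) (Fin.punchInᵢ≢i i j))) ⟩
      t i * P.sum (Vector.replicate n 1#) ≈⟨ *-congˡ (P.sum-replicate-zero n) ⟩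
      t i * 1#                        ≈⟨ *-identityʳ _ ⟩
      t i                             ∎
    product-≉0 : ∀ {n} (t : Vector Carrier n) → (∀ i → t i ≉ 0#) → P.sum t ≉ 0#
    product-≉0 {zero}  t _ = 1≉0
    product-≉0 {suc n} t t≉0 = *-≉0 (t≉0 Fin.zero) (product-≉0 (t ∘ Fin.suc) (t≉0 ∘ Fin.suc))

  -- Multiplication by x permutes the nonzero elements.  In the products over
  -- all elements the factor 0# is replaced by 1#, and the factor x missing at
  -- 0# is supplied separately.
  fermat : ∀ x → x ^ order ≈ x
  fermat x with x ≟ 0#
  ... | yes x≈0 = trans (^-congˡ order x≈0) (trans (0^1+n≈0 (positive (to 0#))) (sym x≈0))
    where
    positive : ∀ {n} → Fin n → 0 ℕ.< n
    positive Fin.zero    = ℕ.s≤s ℕ.z≤n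
    positive (Fin.suc _) = ℕ.s≤s ℕ.z≤n
  ... | no x≉0 = begin
      x ^ order                ≈⟨ P.sum-replicate order ⟨
      P.sum {order} (λ _ → x)  ≈⟨ P.sum-cong-≋ {order} (λ i → split (from i)) ⟩
      P.sum {order} (λ i → atNonzero (from i) * atZero (from i)) ≈⟨ P.∑-distrib-+ {order} (atNonzero ∘ from) (atZero ∘ from) ⟩
      P.sum {order} (atNonzero ∘ from) * P.sum {order} (atZero ∘ from) ≈⟨ *-cong nonzero-product zero-product ⟩
      1# * x ≈⟨ *-identityˡ x ⟩
      x ∎
    where
    atNonzero atZero unit : Carrier → Carrier
    atNonzero y with y ≟ 0#
    ... | yes _ = 1#
    ... | no _  = x
    atZero y with y ≟ 0#
    ... | yes _ = x
    ... | no _  = 1#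
    unit y with y ≟ 0#
    ... | yes _ = 1#
    ... | no _  = y

    split : ∀ y → x ≈ atNonzero y * atZero y
    split y with y ≟ 0#
    ... | yes _ = sym (*-identityˡ x)
    ... | no _  = sym (*-identityʳ x)

    unit-≉0 : ∀ y → unit y ≉ 0#
    unit-≉0 y with y ≟ 0#
    ... | yes _  = 1≉0
    ... | no y≉0 = y≉0

    unit-* : ∀ y → unit (from (to (x * y))) ≈ atNonzero y * unit y
    unit-* y with from (to (x * y)) ≟ 0# | y ≟ 0#
    ... | yes _   | yes _   = sym (*-identityˡ 1#)
    ... | yes xy≈0 | no y≉0 = contradiction (trans (sym (strictlyInverseʳ _)) xy≈0) (*-≉0 x≉0 y≉0)
    ... | no xy≉0 | yes y≈0 = contradiction (trans (strictlyInverseʳ _) (trans (*-congˡ y≈0) (zeroʳ x))) xy≉0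
    ... | no _    | no _    = strictlyInverseʳ _

    scale = reindexing (x *_) (x ⁻¹ *_) *-congˡ *-congˡ
      (λ y → trans (sym (*-assoc _ _ _)) (trans (*-congʳ (⁻¹-inverseʳ x≉0)) (*-identityˡ y)))
      (λ y → trans (sym (*-assoc _ _ _)) (trans (*-congʳ (⁻¹-inverseˡ x≉0)) (*-identityˡ y)))

    Π = P.sum {order} (unit ∘ from)

    nonzero-product : P.sum {order} (atNonzero ∘ from) ≈ 1#
    nonzero-product = *-cancelˡ (product-≉0 (unit ∘ from) (unit-≉0 ∘ from)) (begin
      Π * P.sum {order} (atNonzero ∘ from) ≈⟨ *-comm _ _ ⟩
      P.sum {order} (atNonzero ∘ from) * Π ≈⟨ P.∑-distrib-+ {order} (atNonzero ∘ from) (unit ∘ from) ⟨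
      P.sum {order} (λ i → atNonzero (from i) * unit (from i)) ≈⟨ P.sum-cong-≋ {order} (λ i → unit-* (from i)) ⟨
      P.sum {order} (λ i → unit (from (to (x * from i)))) ≈⟨ P.sum-permute (unit ∘ from) scale ⟨
      Π ≈⟨ *-identityʳ Π ⟨
      Π * 1# ∎)

    zero-product : P.sum {order} (atZero ∘ from) ≈ x
    zero-product = trans (product-single (atZero ∘ from) (to 0#) others) (at0 _ (strictlyInverseʳ 0#))
      where
      at0 : ∀ y → y ≈ 0# → atZero y ≈ x
      at0 y y≈0 with y ≟ 0#
      ... | yes _  = refl
      ... | no y≉0 = contradiction y≈0 y≉0
      others : ∀ i → i ≢ to 0# → atZero (from i) ≈ 1#
      others i i≢ with from i ≟ 0#
      ... | yes eq = contradiction (≡.trans (≡.sym (strictlyInverseˡ i)) (to-cong eq)) i≢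
      ... | no _   = refl

-- Values and degrees of homogenized polynomials.

module PolynomialEvaluation {c ℓ₁ ℓ₂ order} (F : FiniteField c ℓ₁ ℓ₂ order) where
  open FiniteField F
  open FiniteFieldProperties F
  open Polynomials F
  open import Relation.Binary.Reasoning.Setoid setoid
  private
    module *-CS = CommutativeSemigroup *-commutativeSemigroup
    module +-CS = CommutativeSemigroup +-commutativeSemigroup

  monomial : ∀ {n} → Vector Carrier n → Vec ℕ n → Carrier
  monomial x m = product (λ i → x i ^ Vec.lookup m i)

  monomial-+ : ∀ {n} (x : Vector Carrier n) m k →
    monomial x (Vec.zipWith ℕ._+_ m k) ≈ monomial x m * monomial x k
  monomial-+ x Vec.[]      Vec.[]      = sym (*-identityˡ 1#)
  monomial-+ x (a Vec.∷ m) (b Vec.∷ k) = trans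
    (*-cong (^-homo-* (x Fin.zero) a b) (monomial-+ (x ∘ Fin.suc) m k)) (*-CS.interchange _ _ _ _)

  monomial-zero : ∀ {n} (x : Vector Carrier n) → monomial x (Vec.replicate n 0) ≈ 1#
  monomial-zero {zero}  x = refl
  monomial-zero {suc n} x = trans (*-identityˡ _) (monomial-zero (x ∘ Fin.suc))

  monomial-var : ∀ {n} (x : Vector Carrier n) i → monomial x (Vec.replicate n 0 Vec.[ i ]≔ 1) ≈ x i
  monomial-var {suc n} x Fin.zero    = trans (*-cong (*-identityʳ _) (monomial-zero (x ∘ Fin.suc))) (*-identityʳ _)
  monomial-var {suc n} x (Fin.suc i) = trans (*-identityˡ _) (monomial-var (x ∘ Fin.suc) i)

  monomial-cong : ∀ {n} {x y : Vector Carrier n} → (∀ i → x i ≈ y i) → ∀ m → monomial x m ≈ monomial y m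
  monomial-cong x≈y Vec.[]      = refl
  monomial-cong x≈y (a Vec.∷ m) = *-cong (^-congˡ a (x≈y Fin.zero)) (monomial-cong (x≈y ∘ Fin.suc) m)

  monomial-scale : ∀ {n} t (x : Vector Carrier n) m → monomial (λ i → t * x i) m ≈ t ^ Vec.sum m * monomial x m
  monomial-scale t x Vec.[]      = sym (*-identityˡ 1#)
  monomial-scale t x (a Vec.∷ m) = begin
    (t * x₀) ^ a * monomial (λ i → t * x (Fin.suc i)) m       ≈⟨ *-cong (^-distrib-* t x₀ a) (monomial-scale t (x ∘ Fin.suc) m) ⟩
    t ^ a * x₀ ^ a * (t ^ Vec.sum m * monomial (x ∘ Fin.suc) m) ≈⟨ *-CS.interchange _ _ _ _ ⟩
    t ^ a * t ^ Vec.sum m * (x₀ ^ a * monomial (x ∘ Fin.suc) m) ≈⟨ *-congʳ (^-homo-* t a (Vec.sum m)) ⟨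
    t ^ (a ℕ.+ Vec.sum m) * monomial x (a Vec.∷ m)            ∎
    where x₀ = x Fin.zero

  sum-zipWith-+ : ∀ {n} (m k : Vec ℕ n) → Vec.sum (Vec.zipWith ℕ._+_ m k) ≡ Vec.sum m ℕ.+ Vec.sum k
  sum-zipWith-+ Vec.[]      Vec.[]      = ≡.refl
  sum-zipWith-+ (a Vec.∷ m) (b Vec.∷ k) = ≡.trans (cong (a ℕ.+ b ℕ.+_) (sum-zipWith-+ m k))
    (CommutativeSemigroup.interchange ℕ.+-commutativeSemigroup a b (Vec.sum m) (Vec.sum k))

  sum-replicate-0 : ∀ n → Vec.sum (Vec.replicate n 0) ≡ 0
  sum-replicate-0 zero    = ≡.refl
  sum-replicate-0 (suc n) = sum-replicate-0 n

  sum-var : ∀ {n} (i : Fin n) → Vec.sum (Vec.replicate n 0 Vec.[ i ]≔ 1) ≡ 1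
  sum-var {suc n} Fin.zero    = cong suc (sum-replicate-0 n)
  sum-var {suc n} (Fin.suc i) = sum-var i

  -- Extends a choice of values on monomials linearly to term lists. With the choice
  -- `homogeneous d x` it is the value at `x` of the homogenization in degree `d`, for any bound `d`
  -- and not only for `deg p`.
  linear : ∀ {n} → (Vec ℕ n → Carrier) → Poly n → Carrier
  linear φ p = List.foldr _+_ 0# (List.map (λ (a , m) → a * φ m) p)

  module _ {n : ℕ} where
    -- Concerns all listed terms, even those that cancel, and can therefore be followed through the
    -- operations on lists, unlike `deg`.
    Bounded : ℕ → Poly n → Set c
    Bounded d = All (λ (_ , m) → Vec.sum m ℕ.≤ d)

    linear-cong : ∀ {d φ ψ} {p : Poly n} → Bounded d p → (∀ m → Vec.sum m ℕ.≤ d → φ m ≈ ψ m) → linear φ p ≈ linear ψ p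
    linear-cong {p = []}          []           φ≈ψ = refl
    linear-cong {p = (a , m) ∷ p} (m≤d ∷ p≤d) φ≈ψ = +-cong (*-congˡ (φ≈ψ m m≤d)) (linear-cong p≤d φ≈ψ)

    linear-++ : ∀ φ (p p′ : Poly n) → linear φ (p List.++ p′) ≈ linear φ p + linear φ p′
    linear-++ φ []            p′ = sym (+-identityˡ _)
    linear-++ φ ((a , m) ∷ p) p′ = trans (+-congˡ (linear-++ φ p p′)) (sym (+-assoc _ _ _))

    linear-neg : ∀ φ (p : Poly n) → linear φ (List.map (λ (a , m) → - a , m) p) ≈ - linear φ p
    linear-neg φ []            = sym (RingProperties.-0#≈0# ring)
    linear-neg φ ((a , m) ∷ p) = trans (+-cong (sym (RingProperties.-‿distribˡ-* ring a (φ m))) (linear-neg φ p))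
                                       (RingProperties.-‿+-comm ring _ _)

    linear-scale : ∀ t φ (p : Poly n) → linear (λ m → t * φ m) p ≈ t * linear φ p
    linear-scale t φ []            = sym (zeroʳ t)
    linear-scale t φ ((a , m) ∷ p) = trans (+-cong (*-CS.x∙yz≈y∙xz a t (φ m)) (linear-scale t φ p)) (sym (distribˡ t _ _))

    -- Multiplicativity is demanded only below the degree bounds, because the exponent
    -- `d ∸ Vec.sum m` of the homogenizing variable is additive only where nothing is truncated.
    linear-*ₚ : ∀ {d d′ φ ψ χ} {p p′ : Poly n} → Bounded d p → Bounded d′ p′ →
      (∀ m k → Vec.sum m ℕ.≤ d → Vec.sum k ℕ.≤ d′ → φ (Vec.zipWith ℕ._+_ m k) ≈ ψ m * χ k) →
      linear φ (p *ₚ p′) ≈ linear ψ p * linear χ p′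
    linear-*ₚ {p = []} _ _ _ = sym (zeroˡ _)
    linear-*ₚ {d′ = d′} {φ = φ} {ψ} {χ} {p = (a , m) ∷ p} {p′} (m≤d ∷ p≤d) p′≤d′ φ≈ψχ = begin
      linear φ (List.map term p′ List.++ (p *ₚ p′)) ≈⟨ linear-++ φ (List.map term p′) (p *ₚ p′) ⟩
      linear φ (List.map term p′) + linear φ (p *ₚ p′) ≈⟨ +-cong (row p′≤d′) (linear-*ₚ p≤d p′≤d′ φ≈ψχ) ⟩
      a * ψ m * linear χ p′ + linear ψ p * linear χ p′ ≈⟨ distribʳ _ _ _ ⟨
      (a * ψ m + linear ψ p) * linear χ p′ ∎
      where
      term : Carrier × Vec ℕ n → Carrier × Vec ℕ n
      term (b , k) = a * b , Vec.zipWith ℕ._+_ m k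
      row : ∀ {p′} → Bounded d′ p′ → linear φ (List.map term p′) ≈ a * ψ m * linear χ p′
      row []                                     = sym (zeroʳ _)
      row {p′ = (b , k) ∷ p′} (k≤d′ ∷ p′≤d′) = begin
        a * b * φ (Vec.zipWith ℕ._+_ m k) + linear φ (List.map term p′)
          ≈⟨ +-cong (*-congˡ (φ≈ψχ m k m≤d k≤d′)) (row p′≤d′) ⟩
        a * b * (ψ m * χ k) + a * ψ m * linear χ p′  ≈⟨ +-congʳ (*-CS.interchange a b (ψ m) (χ k)) ⟩
        a * ψ m * (b * χ k) + a * ψ m * linear χ p′  ≈⟨ distribˡ _ _ _ ⟨
        a * ψ m * (b * χ k + linear χ p′)            ∎

    homogeneous : ℕ → Vector Carrier (suc n) → Vec ℕ n → Carrier
    homogeneous d x m = x Fin.zero ^ (d ℕ.∸ Vec.sum m) * monomial (x ∘ Fin.suc) m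

    eval-homogenize : ∀ (p : Poly n) x → eval (homogenize p) x ≈ linear (homogeneous (deg p) x) p
    eval-homogenize p x = reflexive (cong (List.foldr _+_ 0#) (≡.sym (List.map-∘ p)))

    -- p, homogenized in degree d, takes the value v at x.
    record Represents (x : Vector Carrier (suc n)) (d : ℕ) (p : Poly n) (v : Carrier) : Set (c ⊔ ℓ₁) where
      constructor _,_
      field
        bounded : Bounded d p
        value   : linear (homogeneous d x) p ≈ v

  module _ {n : ℕ} {x : Vector Carrier (suc n)} where
    represents-con : ∀ a → Represents x 0 (con a) a
    represents-con a = ℕ.≤-reflexive (sum-replicate-0 n) ∷ [] , (begin
      a * (x Fin.zero ^ (0 ℕ.∸ Vec.sum (Vec.replicate n 0)) * monomial (x ∘ Fin.suc) (Vec.replicate n 0)) + 0#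
        ≈⟨ +-identityʳ _ ⟩
      a * (x Fin.zero ^ (0 ℕ.∸ Vec.sum (Vec.replicate n 0)) * monomial (x ∘ Fin.suc) (Vec.replicate n 0))
        ≈⟨ *-congˡ (*-cong (^-congʳ _ (ℕ.0∸n≡0 (Vec.sum (Vec.replicate n 0)))) (monomial-zero (x ∘ Fin.suc))) ⟩
      a * (1# * 1#)   ≈⟨ *-congˡ (*-identityˡ 1#) ⟩
      a * 1#          ≈⟨ *-identityʳ a ⟩
      a               ∎)

    represents-var : ∀ i → Represents x 1 (var i) (x (Fin.suc i))
    represents-var i = ℕ.≤-reflexive (sum-var i) ∷ [] , (begin
      1# * homogeneous 1 x m + 0#  ≈⟨ trans (+-identityʳ _) (*-identityˡ _) ⟩
      homogeneous 1 x m            ≈⟨ *-cong (^-congʳ _ (cong (1 ℕ.∸_) (sum-var i))) (monomial-var (x ∘ Fin.suc) i) ⟩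
      1# * x (Fin.suc i)           ≈⟨ *-identityˡ _ ⟩
      x (Fin.suc i)                ∎)
      where m = Vec.replicate n 0 Vec.[ i ]≔ 1

    represents-+ : ∀ {d p p′ v v′} → Represents x d p v → Represents x d p′ v′ → Represents x d (p +ₚ p′) (v + v′)
    represents-+ {p = p} {p′} (p≤d , eq) (p′≤d , eq′) =
      All.++⁺ p≤d p′≤d , trans (linear-++ _ p p′) (+-cong eq eq′)

    represents-- : ∀ {d p p′ v v′} → Represents x d p v → Represents x d p′ v′ → Represents x d (p -ₚ p′) (v - v′)
    represents-- {p′ = p′} r (p′≤d , eq′) =
      represents-+ r (All.map⁺ p′≤d , trans (linear-neg _ p′) (-‿cong eq′))

    represents-* : ∀ {d d′ p p′ v v′} → Represents x d p v → Represents x d′ p′ v′ → Represents x (d ℕ.+ d′) (p *ₚ p′) (v * v′)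
    represents-* {d} {d′} {p} {p′} (p≤d , eq) (p′≤d′ , eq′) =
      bounded p≤d , trans (linear-*ₚ {p = p} {p′} p≤d p′≤d′ multiplicative) (*-cong eq eq′)
      where
      bounded : ∀ {p} → Bounded d p → Bounded (d ℕ.+ d′) (p *ₚ p′)
      bounded []                                  = []
      bounded {p = (a , m) ∷ p} (m≤d ∷ p≤d) = All.++⁺
        (All.map⁺ (All.map (λ {(_ , k)} k≤d′ →
          ≡.subst (ℕ._≤ d ℕ.+ d′) (≡.sym (sum-zipWith-+ m k)) (ℕ.+-mono-≤ m≤d k≤d′)) p′≤d′))
        (bounded p≤d)
      ∸-+ : ∀ {a b} → a ℕ.≤ d → b ℕ.≤ d′ → (d ℕ.+ d′) ℕ.∸ (a ℕ.+ b) ≡ (d ℕ.∸ a) ℕ.+ (d′ ℕ.∸ b)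
      ∸-+ {a} {b} a≤d b≤d′ = ≡.trans (≡.sym (ℕ.∸-+-assoc (d ℕ.+ d′) a b))
        (≡.trans (cong (ℕ._∸ b) (ℕ.+-∸-comm d′ a≤d)) (ℕ.+-∸-assoc (d ℕ.∸ a) b≤d′))
      multiplicative : ∀ m k → Vec.sum m ℕ.≤ d → Vec.sum k ℕ.≤ d′ →
        homogeneous (d ℕ.+ d′) x (Vec.zipWith ℕ._+_ m k) ≈ homogeneous d x m * homogeneous d′ x k
      multiplicative m k m≤d k≤d′ = trans (*-cong
          (trans (^-congʳ _ (≡.trans (cong (d ℕ.+ d′ ℕ.∸_) (sum-zipWith-+ m k)) (∸-+ m≤d k≤d′)))
            (^-homo-* (x Fin.zero) (d ℕ.∸ Vec.sum m) (d′ ℕ.∸ Vec.sum k)))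
          (monomial-+ (x ∘ Fin.suc) m k))
        (*-CS.interchange _ _ _ _)

    represents-^ : ∀ {d p v} k → Represents x d p v → Represents x (k ℕ.* d) (p ^ₚ k) (v ^ k)
    represents-^ zero    r = represents-con 1#
    represents-^ (suc k) r = represents-* r (represents-^ k r)

    -- A power of the homogenizing variable lets a summand of degree `d` join a sum homogenized in
    -- degree `d′`.
    lift : ℕ → ℕ → Carrier → Carrier
    lift d d′ v = x Fin.zero ^ (d′ ℕ.∸ d) * v

    represents-lift : ∀ {d d′ p v} → d ℕ.≤ d′ → Represents x d p v → Represents x d′ p (lift d d′ v)
    represents-lift {d} {d′} {p} {v} d≤d′ (p≤d , eq) = All.map (λ m≤d → ℕ.≤-trans m≤d d≤d′) p≤d , (begin
      linear (homogeneous d′ x) p                                ≈⟨ linear-cong p≤d raise ⟩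
      linear (λ m → x Fin.zero ^ (d′ ℕ.∸ d) * homogeneous d x m) p ≈⟨ linear-scale _ (homogeneous d x) p ⟩
      x Fin.zero ^ (d′ ℕ.∸ d) * linear (homogeneous d x) p       ≈⟨ *-congˡ eq ⟩
      lift d d′ v ∎)
      where
      raise : ∀ m → Vec.sum m ℕ.≤ d → homogeneous d′ x m ≈ x Fin.zero ^ (d′ ℕ.∸ d) * homogeneous d x m
      raise m m≤d = trans (*-congʳ (trans
          (^-congʳ _ (≡.trans (cong (ℕ._∸ Vec.sum m) (≡.sym (ℕ.m∸n+n≡m d≤d′))) (ℕ.+-∸-assoc (d′ ℕ.∸ d) m≤d)))
          (^-homo-* (x Fin.zero) (d′ ℕ.∸ d) (d ℕ.∸ Vec.sum m))))
        (*-assoc _ _ _)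

  homogeneous-scale : ∀ {n} {d} {p : Poly n} {t} x y → Bounded d p → (∀ i → y i ≈ t * x i) →
    linear (homogeneous d y) p ≈ t ^ d * linear (homogeneous d x) p
  homogeneous-scale {d = d} {p} {t} x y p≤d y≈tx = trans (linear-cong p≤d scale) (linear-scale (t ^ d) _ p)
    where
    scale : ∀ m → Vec.sum m ℕ.≤ d → homogeneous d y m ≈ t ^ d * homogeneous d x m
    scale m m≤d = begin
      y Fin.zero ^ k * monomial (y ∘ Fin.suc) m ≈⟨ *-cong (^-congˡ k (y≈tx Fin.zero)) (monomial-cong (y≈tx ∘ Fin.suc) m) ⟩
      (t * x Fin.zero) ^ k * monomial (λ i → t * x (Fin.suc i)) m
        ≈⟨ *-cong (^-distrib-* t (x Fin.zero) k) (monomial-scale t (x ∘ Fin.suc) m) ⟩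
      t ^ k * x Fin.zero ^ k * (t ^ Vec.sum m * monomial (x ∘ Fin.suc) m) ≈⟨ *-CS.interchange _ _ _ _ ⟩
      t ^ k * t ^ Vec.sum m * homogeneous d x m ≈⟨ *-congʳ (^-homo-* t k (Vec.sum m)) ⟨
      t ^ (k ℕ.+ Vec.sum m) * homogeneous d x m ≈⟨ *-congʳ (^-congʳ t (ℕ.m∸n+n≡m m≤d)) ⟩
      t ^ d * homogeneous d x m ∎
      where k = d ℕ.∸ Vec.sum m

  -- The coefficient of x₀^d in a polynomial of degree at most d is the value
  -- of the homogenization at (0, 1, 0, …, 0).
  top : ∀ {n} → Vector Carrier (suc (suc n))
  top = 0# Vector.∷ 1# Vector.∷ (λ _ → 0#)

  module _ {n : ℕ} (d : ℕ) where
    lead : Vec ℕ (suc n)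
    lead = d Vec.∷ Vec.replicate n 0

    homogeneous-lead : homogeneous d top lead ≈ 1#
    homogeneous-lead = trans (*-cong
        (^-congʳ 0# (≡.trans (cong (d ℕ.∸_) (≡.trans (cong (d ℕ.+_) (sum-replicate-0 n)) (ℕ.+-identityʳ d))) (ℕ.n∸n≡0 d)))
        (trans (*-cong (1^n≈1 d) (monomial-zero {n} (λ _ → 0#))) (*-identityˡ 1#)))
      (*-identityˡ 1#)

    monomial-0 : ∀ {n} (m : Vec ℕ n) → m ≢ Vec.replicate n 0 → monomial (λ _ → 0#) m ≈ 0#
    monomial-0 Vec.[]          m≢0 = contradiction ≡.refl m≢0
    monomial-0 (zero Vec.∷ m)  m≢0 = trans (*-congˡ (monomial-0 m (m≢0 ∘ cong (0 Vec.∷_)))) (zeroʳ _)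
    monomial-0 (suc a Vec.∷ m) m≢0 = trans (*-congʳ (zeroˡ _)) (zeroˡ _)

    homogeneous-nonlead : ∀ m → Vec.sum m ℕ.≤ d → m ≢ lead → homogeneous d top m ≈ 0#
    homogeneous-nonlead (a Vec.∷ m) a+m≤d m≢lead = by-cases (Vec.≡-dec ℕ._≟_ m (Vec.replicate n 0))
      where
      by-cases : Dec (m ≡ Vec.replicate n 0) → homogeneous d top (a Vec.∷ m) ≈ 0#
      by-cases (no m≢0) = trans (*-congˡ (trans (*-congˡ (monomial-0 m m≢0)) (zeroʳ _))) (zeroʳ _)
      -- A power of the first variable below the `d`-th keeps a positive power of the homogenizing
      -- variable, which vanishes at `top`.
      by-cases (yes ≡.refl) = trans (*-congʳ (0^1+n≈0 (ℕ.m<n⇒0<n∸m (ℕ.≤∧≢⇒< a+m≤d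
        λ eq → m≢lead (cong (Vec._∷ m) (≡.trans (≡.sym (≡.trans (cong (a ℕ.+_) (sum-replicate-0 n)) (ℕ.+-identityʳ a))) eq)))))) (zeroˡ _)

    coeff-lead : ∀ {p : Poly (suc n)} → Bounded d p → coeff p lead ≈ linear (homogeneous d top) p
    coeff-lead [] = refl
    coeff-lead {p = (a , m) ∷ p} (m≤d ∷ p≤d) with Vec.≡-dec ℕ._≟_ m lead | coeff-lead {p = p} p≤d
    ... | yes ≡.refl | ih = +-cong (sym (trans (*-congˡ homogeneous-lead) (*-identityʳ a))) ih
    ... | no m≢lead  | ih = trans (sym (+-identityˡ _)) (+-cong
            (sym (trans (*-congˡ (homogeneous-nonlead m m≤d m≢lead)) (zeroʳ a))) ih)

  coeff≉0⇒∈ : ∀ {n} (p : Poly n) m → coeff p m ≉ 0# → ∃ λ a → (a , m) ∈ p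
  coeff≉0⇒∈ []            m ≉0 = contradiction refl ≉0
  coeff≉0⇒∈ ((a , k) ∷ p) m ≉0 with Vec.≡-dec ℕ._≟_ k m
  ... | yes ≡.refl = a , here ≡.refl
  ... | no _       = let b , b∈p = coeff≉0⇒∈ p m ≉0 in b , there b∈p

  -- The bound on the listed terms gives one inequality. For the other, some monomial of degree `d`
  -- must survive cancellation, and a nonzero value at `top` detects the pure power of the first
  -- variable.
  deg-lead : ∀ {n} d {p : Poly (suc n)} {v} → Represents top d p v → v ≉ 0# → deg p ≡ d
  deg-lead {n} d {p} {v} (p≤d , eq) v≉0 = max≈v⁺
    (≡.subst (_∈ degrees) (≡.trans (cong (d ℕ.+_) (sum-replicate-0 n)) (ℕ.+-identityʳ d))
      (∈-map⁺ (Vec.sum ∘ proj₂) (∈-filter⁺ present? (proj₂ (coeff≉0⇒∈ p (lead d) coeff≉0)) coeff≉0)))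
    (All.map⁺ (All.filter⁺ present? p≤d)) ℕ.z≤n
    where
    present? : ∀ (t : Carrier × Vec ℕ (suc n)) → Dec (coeff p (proj₂ t) ≉ 0#)
    present? (_ , m) = ¬? (coeff p m ≟ 0#)
    degrees : List ℕ
    degrees = List.map (Vec.sum ∘ proj₂) (List.filter present? p)
    coeff≉0 : coeff p (lead d) ≉ 0#
    coeff≉0 coeff≈0 = v≉0 (trans (sym eq) (trans (sym (coeff-lead d p≤d)) coeff≈0))

-- Scaling of coordinate vectors.

module ProjectiveProperties {c ℓ₁ ℓ₂ order} (F : FiniteField c ℓ₁ ℓ₂ order) where
  open FiniteField F
  open FiniteFieldProperties F
  open Projective F
  open import Relation.Binary.Reasoning.Setoid setoid

  ∼-sym : ∀ {n} {X Y : Vector Carrier n} → X ∼ Y → Y ∼ X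
  ∼-sym {X = X} {Y} (t , t≉0 , Y≈tX) = t ⁻¹ , ⁻¹-≉0 t≉0 , λ i → begin
    X i                ≈⟨ *-identityˡ _ ⟨
    1# * X i           ≈⟨ *-congʳ (⁻¹-inverseˡ t≉0) ⟨
    t ⁻¹ * t * X i     ≈⟨ *-assoc _ _ _ ⟩
    t ⁻¹ * (t * X i)   ≈⟨ *-congˡ (Y≈tX i) ⟨
    t ⁻¹ * Y i         ∎

  ∼-trans : ∀ {n} {X Y Z : Vector Carrier n} → X ∼ Y → Y ∼ Z → X ∼ Z
  ∼-trans (t , t≉0 , Y≈tX) (u , u≉0 , Z≈uY) =
    u * t , *-≉0 u≉0 t≉0 , λ i → trans (Z≈uY i) (trans (*-congˡ (Y≈tX i)) (sym (*-assoc _ _ _)))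

  ≈*⁻¹⇒ : ∀ {x y z} → x ≉ 0# → y ≈ z * x ⁻¹ → z ≈ x * y
  ≈*⁻¹⇒ {x} {y} {z} x≉0 y≈ = begin
    z               ≈⟨ *-identityʳ z ⟨
    z * 1#          ≈⟨ *-congˡ (⁻¹-inverseˡ x≉0) ⟨
    z * (x ⁻¹ * x)  ≈⟨ *-assoc _ _ _ ⟨
    z * x ⁻¹ * x    ≈⟨ *-congʳ y≈ ⟨
    y * x           ≈⟨ *-comm _ _ ⟩
    x * y           ∎

  ⇒≈*⁻¹ : ∀ {x y z} → x ≉ 0# → z ≈ x * y → y ≈ z * x ⁻¹
  ⇒≈*⁻¹ {x} {y} {z} x≉0 z≈ = *-cancelˡ x≉0 (trans (sym z≈) (≈*⁻¹⇒ x≉0 refl))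

-- Solving for the weight in the natural numbers.

module WeightArithmetic where
  -- Here `W` is a weight, `A` the number of affine zeros, and 3 + 0 counts the zeros at infinity
  -- off the vertex and at it; `Q₃`, `Q₂` and `r` stand for q³, q² and q⁵ - q³. Writing q⁵ as
  -- `Q₃ + r` keeps subtraction away from the ring solver, and the final `∸ 2` is reached by
  -- computing W + 2.
  nonvertical-tangent : ∀ W A r Q₃ Q₂ q → W ℕ.+ (A ℕ.+ (3 ℕ.+ 0)) ≡ Q₃ ℕ.+ r ℕ.+ (3 ℕ.* Q₂ ℕ.+ 1) →
    A ℕ.+ q ≡ Q₃ ℕ.+ Q₂ → W ≡ r ℕ.+ 2 ℕ.* Q₂ ℕ.+ q ℕ.∸ 2
  nonvertical-tangent W A r Q₃ Q₂ q eq A+q≡ = ≡.trans (≡.sym (ℕ.m+n∸n≡m W 2)) (cong (ℕ._∸ 2)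
    (ℕ.+-cancelʳ-≡ (Q₃ ℕ.+ Q₂ ℕ.+ 1) (W ℕ.+ 2) (r ℕ.+ 2 ℕ.* Q₂ ℕ.+ q) (≡.trans
      (cong (λ k → W ℕ.+ 2 ℕ.+ (k ℕ.+ 1)) (≡.sym A+q≡))
      (≡.trans (lhs W A q) (≡.trans (cong (ℕ._+ q) eq) (rhs r Q₃ Q₂ q))))))
    where
    lhs : ∀ W A q → W ℕ.+ 2 ℕ.+ (A ℕ.+ q ℕ.+ 1) ≡ W ℕ.+ (A ℕ.+ (3 ℕ.+ 0)) ℕ.+ q
    lhs = solve-∀
    rhs : ∀ r Q₃ Q₂ q → Q₃ ℕ.+ r ℕ.+ (3 ℕ.* Q₂ ℕ.+ 1) ℕ.+ q ≡ r ℕ.+ 2 ℕ.* Q₂ ℕ.+ q ℕ.+ (Q₃ ℕ.+ Q₂ ℕ.+ 1)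
    rhs = solve-∀

  nonvertical-secant : ∀ W A r Q₃ Q₂ q → W ℕ.+ (A ℕ.+ (3 ℕ.+ 0)) ≡ Q₃ ℕ.+ r ℕ.+ (3 ℕ.* Q₂ ℕ.+ 1) →
    A ℕ.+ q ≡ Q₃ → W ≡ r ℕ.+ 3 ℕ.* Q₂ ℕ.+ q ℕ.∸ 2
  nonvertical-secant W A r Q₃ Q₂ q eq A+q≡ = ≡.trans (≡.sym (ℕ.m+n∸n≡m W 2)) (cong (ℕ._∸ 2)
    (ℕ.+-cancelʳ-≡ (Q₃ ℕ.+ 1) (W ℕ.+ 2) (r ℕ.+ 3 ℕ.* Q₂ ℕ.+ q) (≡.trans
      (cong (λ k → W ℕ.+ 2 ℕ.+ (k ℕ.+ 1)) (≡.sym A+q≡))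
      (≡.trans (lhs W A q) (≡.trans (cong (ℕ._+ q) eq) (rhs r Q₃ Q₂ q))))))
    where
    lhs : ∀ W A q → W ℕ.+ 2 ℕ.+ (A ℕ.+ q ℕ.+ 1) ≡ W ℕ.+ (A ℕ.+ (3 ℕ.+ 0)) ℕ.+ q
    lhs = solve-∀
    rhs : ∀ r Q₃ Q₂ q → Q₃ ℕ.+ r ℕ.+ (3 ℕ.* Q₂ ℕ.+ 1) ℕ.+ q ≡ r ℕ.+ 3 ℕ.* Q₂ ℕ.+ q ℕ.+ (Q₃ ℕ.+ 1)
    rhs = solve-∀

  vertical-0 : ∀ W r Q₃ Q₂ → W ℕ.+ (Q₃ ℕ.+ (0 ℕ.+ 1)) ≡ Q₃ ℕ.+ r ℕ.+ (3 ℕ.* Q₂ ℕ.+ 1) → W ≡ r ℕ.+ 3 ℕ.* Q₂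
  vertical-0 W r Q₃ Q₂ eq = ℕ.+-cancelʳ-≡ (Q₃ ℕ.+ (0 ℕ.+ 1)) W (r ℕ.+ 3 ℕ.* Q₂) (≡.trans eq (lemma r Q₃ Q₂))
    where
    lemma : ∀ r Q₃ Q₂ → Q₃ ℕ.+ r ℕ.+ (3 ℕ.* Q₂ ℕ.+ 1) ≡ r ℕ.+ 3 ℕ.* Q₂ ℕ.+ (Q₃ ℕ.+ (0 ℕ.+ 1))
    lemma = solve-∀

  vertical-1 : ∀ W r Q₃ Q₂ → W ℕ.+ (Q₃ ℕ.+ (Q₂ ℕ.+ 1)) ≡ Q₃ ℕ.+ r ℕ.+ (3 ℕ.* Q₂ ℕ.+ 1) → W ≡ r ℕ.+ 2 ℕ.* Q₂
  vertical-1 W r Q₃ Q₂ eq = ℕ.+-cancelʳ-≡ (Q₃ ℕ.+ (Q₂ ℕ.+ 1)) W (r ℕ.+ 2 ℕ.* Q₂) (≡.trans eq (lemma r Q₃ Q₂))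
    where
    lemma : ∀ r Q₃ Q₂ → Q₃ ℕ.+ r ℕ.+ (3 ℕ.* Q₂ ℕ.+ 1) ≡ r ℕ.+ 2 ℕ.* Q₂ ℕ.+ (Q₃ ℕ.+ (Q₂ ℕ.+ 1))
    lemma = solve-∀

-- Arithmetic in characteristic two.

module CharacteristicTwo {c ℓ₁ ℓ₂} (e : ℕ) (F : FiniteField c ℓ₁ ℓ₂ ((2 ℕ.^ e) ℕ.^ 2)) where
  open FiniteField F
  open FiniteFieldProperties F
  open Mult semiring using (×1-homo-*; ×-homo-1) renaming (_×_ to _ₙ×_)
  open import Relation.Binary.Reasoning.Setoid setoid

  private
    ₙ×1-homo-^ : ∀ m n → (m ℕ.^ n) ₙ× 1# ≈ (m ₙ× 1#) ^ n
    ₙ×1-homo-^ m zero    = ×-homo-1 1#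
    ₙ×1-homo-^ m (suc n) = trans (×1-homo-* m (m ℕ.^ n)) (*-congˡ (ₙ×1-homo-^ m n))

  -- The order of the field is a power of 2 and annihilates `1#`, and a field has no nonzero
  -- nilpotents.
  1+1≈0 : 1# + 1# ≈ 0#
  1+1≈0 = trans (+-congˡ (sym (+-identityʳ 1#))) (^-≈0 e (^-≈0 2 (begin
    ((2 ₙ× 1#) ^ e) ^ 2         ≈⟨ ^-congˡ 2 (ₙ×1-homo-^ 2 e) ⟨
    ((2 ℕ.^ e) ₙ× 1#) ^ 2       ≈⟨ ₙ×1-homo-^ (2 ℕ.^ e) 2 ⟨
    ((2 ℕ.^ e) ℕ.^ 2) ₙ× 1#     ≈⟨ order×1≈0 ⟩
    0#                          ∎)))

  x+x≈0 : ∀ x → x + x ≈ 0#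
  x+x≈0 x = begin
    x + x             ≈⟨ +-cong (*-identityʳ x) (*-identityʳ x) ⟨
    x * 1# + x * 1#   ≈⟨ distribˡ x 1# 1# ⟨
    x * (1# + 1#)     ≈⟨ *-congˡ 1+1≈0 ⟩
    x * 0#            ≈⟨ zeroʳ x ⟩
    0#                ∎

  -x≈x : ∀ x → - x ≈ x
  -x≈x x = sym (RingProperties.+-cancelʳ ring x x (- x) (trans (x+x≈0 x) (sym (-‿inverseˡ x))))

  private
    -- With `Bool` as coefficient ring the solver reduces modulo 2 and so proves identities in which
    -- doubled terms cancel.
    𝔽₂ : RawRing _ _
    𝔽₂ = record { Carrier = Bool ; _≈_ = _≡_ ; _+_ = _xor_ ; _*_ = _∧_ ; -_ = id ; 0# = false ; 1# = true }

    ⟦_⟧ : Bool → Carrier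
    ⟦ b ⟧ = if b then 1# else 0#

    morphism : 𝔽₂ -Raw-AlmostCommutative⟶ fromCommutativeRing commutativeRing
    morphism = record
      { ⟦_⟧    = ⟦_⟧
      ; +-homo = λ { false y → sym (+-identityˡ ⟦ y ⟧)
                   ; true false → sym (+-identityʳ 1#)
                   ; true true → sym 1+1≈0 }
      ; *-homo = λ { false y → sym (zeroˡ ⟦ y ⟧) ; true y → sym (*-identityˡ ⟦ y ⟧) }
      ; -‿homo = λ b → sym (-x≈x ⟦ b ⟧)
      ; 0-homo = refl
      ; 1-homo = refl
      }

    _coeff≟_ : ∀ b b′ → Maybe (⟦ b ⟧ ≈ ⟦ b′ ⟧)
    false coeff≟ false = just refl
    true  coeff≟ true  = just refl
    _     coeff≟ _     = nothing

  module Solver = RingSolver 𝔽₂ (fromCommutativeRing commutativeRing) morphism _coeff≟_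
  open Solver using (solve; _:=_; _:+_; _:*_; _:^_; con)

  x+y≈0⇒x≈y : ∀ {x y} → x + y ≈ 0# → x ≈ y
  x+y≈0⇒x≈y {x} {y} x+y≈0 = trans (solve 2 (λ x y → x := (x :+ y) :+ y) refl x y)
                              (trans (+-congʳ x+y≈0) (+-identityˡ y))

  x≈y⇒x+y≈0 : ∀ {x y} → x ≈ y → x + y ≈ 0#
  x≈y⇒x+y≈0 {x} {y} x≈y = trans (+-congʳ x≈y) (x+x≈0 y)

  x+y≈z⇒x≈y+z : ∀ {x y z} → x + y ≈ z → x ≈ y + z
  x+y≈z⇒x≈y+z {x} {y} {z} eq = trans (solve 2 (λ x y → x := y :+ (x :+ y)) refl x y) (+-congˡ eq)

  +-cancelˡ : ∀ {x y z} → x + y ≈ x + z → y ≈ z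
  +-cancelˡ {x} {y} {z} = RingProperties.+-cancelˡ ring x y z

  ^2-+ : ∀ x y → (x + y) ^ 2 ≈ x ^ 2 + y ^ 2
  ^2-+ = solve 2 (λ x y → (x :+ y) :^ 2 := x :^ 2 :+ y :^ 2) refl

  ^2-* : ∀ x n → x ^ (2 ℕ.* n) ≈ (x ^ 2) ^ n
  ^2-* x n = sym (^-assocʳ x 2 n)

  frobenius : ∀ k x y → (x + y) ^ (2 ℕ.^ k) ≈ x ^ (2 ℕ.^ k) + y ^ (2 ℕ.^ k)
  frobenius zero    x y = trans (*-identityʳ _) (+-cong (sym (*-identityʳ x)) (sym (*-identityʳ y)))
  frobenius (suc k) x y = begin
    (x + y) ^ (2 ℕ.* m)           ≈⟨ ^2-* (x + y) m ⟩
    ((x + y) ^ 2) ^ m             ≈⟨ ^-congˡ m (^2-+ x y) ⟩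
    (x ^ 2 + y ^ 2) ^ m           ≈⟨ frobenius k (x ^ 2) (y ^ 2) ⟩
    (x ^ 2) ^ m + (y ^ 2) ^ m     ≈⟨ +-cong (^2-* x m) (^2-* y m) ⟨
    x ^ (2 ℕ.* m) + y ^ (2 ℕ.* m) ∎
    where m = 2 ℕ.^ k

  -- The map is additive, and only zero has a vanishing power.
  frobenius-injective : ∀ k {x y} → x ^ (2 ℕ.^ k) ≈ y ^ (2 ℕ.^ k) → x ≈ y
  frobenius-injective k {x} {y} eq =
    x+y≈0⇒x≈y (^-≈0 (2 ℕ.^ k) (trans (frobenius k x y) (x≈y⇒x+y≈0 eq)))

  ^-comm : ∀ x m n → (x ^ m) ^ n ≈ (x ^ n) ^ m
  ^-comm x m n = begin
    (x ^ m) ^ n   ≈⟨ ^-assocʳ x m n ⟩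
    x ^ (m ℕ.* n) ≡⟨ cong (x ^_) (ℕ.*-comm m n) ⟩
    x ^ (n ℕ.* m) ≈⟨ ^-assocʳ x n m ⟨
    (x ^ n) ^ m   ∎

-- The exponents and the hypersurface when e = 4m + 3.

module TitsHypersurface {c ℓ₁ ℓ₂} (e : ℕ) (e%4≡3 : e % 4 ≡ 3)
                        (F : FiniteField c ℓ₁ ℓ₂ ((2 ℕ.^ e) ℕ.^ 2))
                        (ε δ : FiniteField.Carrier F)
                        (admissible : Hypersurface.Admissible e F ε δ) where
  open FiniteField F
  open Hypersurface e F
  open FiniteFieldProperties F
  open CharacteristicTwo e F
  open PolynomialEvaluation F
  open ProjectiveProperties F
  open WeightArithmetic
  open Polynomials F using (Poly; eval; homogenize; deg)
  open Projective F
  open Admissible admissible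
  open Solver using (solve; _:=_; _:+_; _:*_; _:^_; con)
  open import Relation.Binary.Reasoning.Setoid setoid

  -- With e = 4m + 3 the binary exponent of `σ` is 2m + 2, so `s` is σ/2 and equals twice a power of
  -- 4.
  m s : ℕ
  m = e / 4
  s = 2 ℕ.^ (1 ℕ.+ 2 ℕ.* m)

  e≡ : e ≡ 3 ℕ.+ m ℕ.* 4
  e≡ = ≡.trans (m≡m%n+[m/n]*n e 4) (cong (ℕ._+ m ℕ.* 4) e%4≡3)

  σ≡2s : σ ≡ 2 ℕ.* s
  σ≡2s = cong (2 ℕ.^_) (≡.trans (cong (_/ 2) (≡.trans (cong (ℕ._+ 1) e≡) (lemma m)))
                                 (m*n/n≡m (2 ℕ.+ 2 ℕ.* m) 2))
    where
    lemma : ∀ m → 3 ℕ.+ m ℕ.* 4 ℕ.+ 1 ≡ (2 ℕ.+ 2 ℕ.* m) ℕ.* 2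
    lemma = solve-∀

  s*σ≡q : s ℕ.* σ ≡ q
  s*σ≡q = ≡.trans (cong (s ℕ.*_) σ≡2s) (≡.trans
    (≡.sym (ℕ.^-distribˡ-+-* 2 (1 ℕ.+ 2 ℕ.* m) (2 ℕ.+ 2 ℕ.* m)))
    (cong (2 ℕ.^_) (≡.trans (lemma m) (≡.sym e≡))))
    where
    lemma : ∀ m → 1 ℕ.+ 2 ℕ.* m ℕ.+ (2 ℕ.+ 2 ℕ.* m) ≡ 3 ℕ.+ m ℕ.* 4
    lemma = solve-∀

  σ*σ≡q*2 : σ ℕ.* σ ≡ q ℕ.* 2
  σ*σ≡q*2 = ≡.trans (cong (ℕ._* σ) σ≡2s) (≡.trans (ℕ.*-assoc 2 s σ)
            (≡.trans (cong (2 ℕ.*_) s*σ≡q) (ℕ.*-comm 2 q)))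

  q>0 : 0 ℕ.< q
  q>0 = ℕ.m^n>0 2 e

  σ>0 : 0 ℕ.< σ
  σ>0 = ℕ.m^n>0 2 ((e ℕ.+ 1) / 2)

  -- The subfield 𝔽q

  ^q-+ : ∀ x y → (x + y) ^ q ≈ x ^ q + y ^ q
  ^q-+ = frobenius e

  ^σ-+ : ∀ x y → (x + y) ^ σ ≈ x ^ σ + y ^ σ
  ^σ-+ = frobenius ((e ℕ.+ 1) / 2)

  ^q^q : ∀ x → (x ^ q) ^ q ≈ x
  ^q^q x = begin
    (x ^ q) ^ q   ≈⟨ ^-assocʳ x q q ⟩
    x ^ (q ℕ.* q) ≡⟨ cong (λ n → x ^ (q ℕ.* n)) (ℕ.*-identityʳ q) ⟨
    x ^ (q ℕ.^ 2) ≈⟨ fermat x ⟩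
    x             ∎

  ^-[1+] : ∀ x n → x ^ (n ℕ.+ 1) ≈ x ^ n * x
  ^-[1+] x n = trans (^-homo-* x n 1) (*-congˡ (*-identityʳ x))

  𝔽q-resp : ∀ {x y} → x ≈ y → 𝔽q x → 𝔽q y
  𝔽q-resp x≈y x∈ = trans (^-congˡ q (sym x≈y)) (trans x∈ x≈y)

  𝔽q? : Decidable 𝔽q
  𝔽q? x = x ^ q ≟ x

  𝔽q-0 : 𝔽q 0#
  𝔽q-0 = 0^1+n≈0 q>0

  𝔽q-+ : ∀ {x y} → 𝔽q x → 𝔽q y → 𝔽q (x + y)
  𝔽q-+ {x} {y} x∈ y∈ = trans (^q-+ x y) (+-cong x∈ y∈)

  𝔽q-* : ∀ {x y} → 𝔽q x → 𝔽q y → 𝔽q (x * y)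
  𝔽q-* {x} {y} x∈ y∈ = trans (^-distrib-* x y q) (*-cong x∈ y∈)

  𝔽q-^ : ∀ {x} n → 𝔽q x → 𝔽q (x ^ n)
  𝔽q-^ {x} n x∈ = trans (^-comm x n q) (^-congˡ n x∈)

  𝔽q-⁻¹ : ∀ {x} → x ≉ 0# → 𝔽q x → 𝔽q (x ⁻¹)
  𝔽q-⁻¹ {x} x≉0 x∈ = *-cancelˡ x≉0 (begin
    x * x ⁻¹ ^ q     ≈⟨ *-congʳ x∈ ⟨
    x ^ q * x ⁻¹ ^ q ≈⟨ ^-distrib-* x (x ⁻¹) q ⟨
    (x * x ⁻¹) ^ q   ≈⟨ ^-congˡ q (⁻¹-inverseʳ x≉0) ⟩
    1# ^ q           ≈⟨ 1^n≈1 q ⟩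
    1#               ≈⟨ ⁻¹-inverseʳ x≉0 ⟨
    x * x ⁻¹         ∎)

  -- On `𝔽q` the map x ↦ x^σ is the Tits endomorphism, a square root of x ↦ x²: the integer σ² is
  -- 2q, and raising to the power q is the identity there.
  ^σ^σ : ∀ {x} → 𝔽q x → (x ^ σ) ^ σ ≈ x ^ 2
  ^σ^σ {x} x∈ = begin
    (x ^ σ) ^ σ   ≈⟨ ^-assocʳ x σ σ ⟩
    x ^ (σ ℕ.* σ) ≡⟨ cong (x ^_) σ*σ≡q*2 ⟩
    x ^ (q ℕ.* 2) ≈⟨ ^-assocʳ x q 2 ⟨
    (x ^ q) ^ 2   ≈⟨ ^-congˡ 2 x∈ ⟩
    x ^ 2         ∎

  -- Coordinates with respect to the basis 1, ε of the field over 𝔽q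

  -- Since δ lies in `𝔽q`, ε^q is again a root of X² + X + δ. The roots are ε and ε + 1, and the
  -- first is excluded because ε is not in `𝔽q`.
  ε^q≈ε+1 : ε ^ q ≈ ε + 1#
  ε^q≈ε+1 = x+y≈0⇒x≈y (trans (sym (+-assoc _ _ _))
    (x*y≈0⇒y≈0 (λ eq → ε∉𝔽q (x+y≈0⇒x≈y eq)) (begin
    (η + ε) * (η + ε + 1#)        ≈⟨ solve 3 (λ η ε δ → (η :+ ε) :* (η :+ ε :+ con true) := (η :^ 2 :+ η :+ δ) :+ (ε :^ 2 :+ ε :+ δ)) refl η ε δ ⟩
    (η ^ 2 + η + δ) + (ε ^ 2 + ε + δ) ≈⟨ +-cong conjugate ε²+ε+δ≈0 ⟩
    0# + 0#                       ≈⟨ +-identityʳ 0# ⟩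
    0#                            ∎)))
    where
    η = ε ^ q
    conjugate : η ^ 2 + η + δ ≈ 0#
    conjugate = begin
      η ^ 2 + η + δ             ≈⟨ +-cong (+-congʳ (^-comm ε q 2)) (sym δ∈𝔽q) ⟩
      (ε ^ 2) ^ q + ε ^ q + δ ^ q ≈⟨ +-congʳ (^q-+ (ε ^ 2) ε) ⟨
      (ε ^ 2 + ε) ^ q + δ ^ q   ≈⟨ ^q-+ (ε ^ 2 + ε) δ ⟨
      (ε ^ 2 + ε + δ) ^ q       ≈⟨ ^-congˡ q ε²+ε+δ≈0 ⟩
      0# ^ q                    ≈⟨ 𝔽q-0 ⟩
      0#                        ∎

  -- For x = a + b ε with a, b in `𝔽q`, the relation ε^q = ε + 1 gives x^q + x = b; adding b ε to x
  -- then leaves a.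
  im re : Carrier → Carrier
  im x = x ^ q + x
  re x = x + im x * ε

  mk : Carrier → Carrier → Carrier
  mk a b = a + b * ε

  im-cong : ∀ {x y} → x ≈ y → im x ≈ im y
  im-cong x≈y = +-cong (^-congˡ q x≈y) x≈y

  re-cong : ∀ {x y} → x ≈ y → re x ≈ re y
  re-cong x≈y = +-cong x≈y (*-congʳ (im-cong x≈y))

  mk-cong : ∀ {a a′ b b′} → a ≈ a′ → b ≈ b′ → mk a b ≈ mk a′ b′
  mk-cong a≈a′ b≈b′ = +-cong a≈a′ (*-congʳ b≈b′)

  im∈𝔽q : ∀ x → 𝔽q (im x)
  im∈𝔽q x = trans (^q-+ (x ^ q) x) (trans (+-congʳ (^q^q x)) (+-comm _ _))

  re∈𝔽q : ∀ x → 𝔽q (re x)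
  re∈𝔽q x = begin
    (x + im x * ε) ^ q              ≈⟨ ^q-+ x (im x * ε) ⟩
    x ^ q + (im x * ε) ^ q          ≈⟨ +-congˡ (trans (^-distrib-* (im x) ε q) (*-cong (im∈𝔽q x) ε^q≈ε+1)) ⟩
    x ^ q + (x ^ q + x) * (ε + 1#)  ≈⟨ solve 3 (λ X x ε → X :+ (X :+ x) :* (ε :+ con true) := x :+ (X :+ x) :* ε) refl (x ^ q) x ε ⟩
    x + (x ^ q + x) * ε             ∎

  mk-re-im : ∀ x → mk (re x) (im x) ≈ x
  mk-re-im x = solve 2 (λ x y → x :+ y :+ y := x) refl x (im x * ε)

  im-+ : ∀ x y → im (x + y) ≈ im x + im y
  im-+ x y = trans (+-congʳ (^q-+ x y))
    (solve 4 (λ X Y x y → (X :+ Y) :+ (x :+ y) := (X :+ x) :+ (Y :+ y)) refl (x ^ q) (y ^ q) x y)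

  im-𝔽q : ∀ {x} → 𝔽q x → im x ≈ 0#
  im-𝔽q = x≈y⇒x+y≈0

  im-*ˡ : ∀ {a} x → 𝔽q a → im (a * x) ≈ a * im x
  im-*ˡ {a} x a∈ = trans (+-congʳ (trans (^-distrib-* a x q) (*-congʳ a∈))) (sym (distribˡ a (x ^ q) x))

  im-mk : ∀ {a b} → 𝔽q a → 𝔽q b → im (mk a b) ≈ b
  im-mk {a} {b} a∈ b∈ = begin
    im (a + b * ε)         ≈⟨ im-+ a (b * ε) ⟩
    im a + im (b * ε)      ≈⟨ +-cong (im-𝔽q a∈) (im-*ˡ ε b∈) ⟩
    0# + b * (ε ^ q + ε)   ≈⟨ +-congˡ (*-congˡ (+-congʳ ε^q≈ε+1)) ⟩
    0# + b * (ε + 1# + ε)  ≈⟨ solve 2 (λ b ε → con false :+ b :* (ε :+ con true :+ ε) := b) refl b ε ⟩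
    b                      ∎

  re-mk : ∀ {a b} → 𝔽q a → 𝔽q b → re (mk a b) ≈ a
  re-mk {a} {b} a∈ b∈ = trans (+-congˡ (*-congʳ (im-mk a∈ b∈)))
    (solve 2 (λ a y → a :+ y :+ y := a) refl a (b * ε))

  -- The form f of the Tits ovoid z = f(x , y)

  f : Carrier → Carrier → Carrier
  f a b = a ^ (σ ℕ.+ 2) + b ^ σ + a * b

  f-cong : ∀ {a a′ b b′} → a ≈ a′ → b ≈ b′ → f a b ≈ f a′ b′
  f-cong a≈ b≈ = +-cong (+-cong (^-congˡ (σ ℕ.+ 2) a≈) (^-congˡ σ b≈)) (*-cong a≈ b≈)

  f∈𝔽q : ∀ {a b} → 𝔽q a → 𝔽q b → 𝔽q (f a b)
  f∈𝔽q a∈ b∈ = 𝔽q-+ (𝔽q-+ (𝔽q-^ (σ ℕ.+ 2) a∈) (𝔽q-^ σ b∈)) (𝔽q-* a∈ b∈)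

  -- The stabilizer of the point at infinity in the Suzuki group contains
  -- (a , b) ↦ (a + t , b + u + t^σ a).
  f-translate : ∀ {t} a b u → 𝔽q t →
    f (a + t) (b + (u + t ^ σ * a)) ≈ f a b + f t u + ((u + t ^ σ * t) * a + t * b)
  f-translate {t} a b u t∈ = begin
    f (a + t) (b + (u + t ^ σ * a))
      ≈⟨ +-congʳ (+-cong (trans (^-homo-* (a + t) σ 2) (*-congʳ (^σ-+ a t))) b-part) ⟩
    (A + T) * (a + t) ^ 2 + (B + (U + t ^ 2 * A)) + (a + t) * (b + (u + T * a))
      ≈⟨ solve 8 (λ a b u t A B U T →
           (A :+ T) :* (a :+ t) :^ 2 :+ (B :+ (U :+ t :^ 2 :* A)) :+ (a :+ t) :* (b :+ (u :+ T :* a)) :=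
           (A :* a :^ 2 :+ B :+ a :* b) :+ (T :* t :^ 2 :+ U :+ t :* u) :+ ((u :+ T :* t) :* a :+ t :* b))
         refl a b u t A B U T ⟩
    (A * a ^ 2 + B + a * b) + (T * t ^ 2 + U + t * u) + ((u + T * t) * a + t * b)
      ≈⟨ +-congʳ (+-cong (+-congʳ (+-congʳ (^-homo-* a σ 2))) (+-congʳ (+-congʳ (^-homo-* t σ 2)))) ⟨
    f a b + f t u + ((u + T * t) * a + t * b) ∎
    where
    A = a ^ σ
    B = b ^ σ
    U = u ^ σ
    T = t ^ σ
    -- The term t^σ a contributes t² a^σ here and t^σ a² in the product of the coordinates. These
    -- are the two mixed terms of (a + t)^(σ+2), so they cancel and only a linear remainder is left.
    b-part : (b + (u + T * a)) ^ σ ≈ B + (U + t ^ 2 * A)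
    b-part = begin
      (b + (u + T * a)) ^ σ      ≈⟨ trans (^σ-+ b _) (+-congˡ (^σ-+ u _)) ⟩
      B + (U + (T * a) ^ σ)      ≈⟨ +-congˡ (+-congˡ (trans (^-distrib-* T a σ) (*-congʳ (^σ^σ t∈)))) ⟩
      B + (U + t ^ 2 * A)        ∎

  -- Weighted homogeneity with weights 1 and σ + 1: the terms a^(σ+2) and a b visibly scale by
  -- t^(σ+2), and for b^σ this holds because (t^(σ+1))^σ = t^(2+σ) on `𝔽q`.
  f-scale : ∀ {t} a b → 𝔽q t → f (t * a) (t ^ σ * t * b) ≈ t ^ (σ ℕ.+ 2) * f a b
  f-scale {t} a b t∈ = begin
    f (t * a) (t ^ σ * t * b)
      ≈⟨ +-congʳ (+-cong (trans (^-homo-* (t * a) σ 2) (*-congʳ (^-distrib-* t a σ))) b-part) ⟩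
    T * A * (t * a) ^ 2 + t ^ 2 * T * B + t * a * (T * t * b)
      ≈⟨ solve 6 (λ a b t A B T →
           T :* A :* (t :* a) :^ 2 :+ t :^ 2 :* T :* B :+ t :* a :* (T :* t :* b) :=
           T :* t :^ 2 :* (A :* a :^ 2 :+ B :+ a :* b)) refl a b t A B T ⟩
    T * t ^ 2 * (A * a ^ 2 + B + a * b)
      ≈⟨ *-cong (^-homo-* t σ 2) (+-congʳ (+-congʳ (^-homo-* a σ 2))) ⟨
    t ^ (σ ℕ.+ 2) * f a b ∎
    where
    A = a ^ σ
    B = b ^ σ
    T = t ^ σ
    b-part : (T * t * b) ^ σ ≈ t ^ 2 * T * B
    b-part = trans (^-distrib-* (T * t) b σ) (*-congʳ (trans (^-distrib-* T t σ) (*-congʳ (^σ^σ t∈))))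

  -- A zero would satisfy b^σ + b = 1. Its image under `σ` is b² + b^σ = 1, so the sum gives b² = b.
  -- But then b is 0 or 1 and b^σ + b = 0.
  f-1-≉0 : ∀ {b} → 𝔽q b → f 1# b ≉ 0#
  f-1-≉0 {b} b∈ f≈0 = 1≉0 (trans (sym b^σ+b≈1) (x≈y⇒x+y≈0 (b^σ≈b (b ≟ 0#))))
    where
    b^σ+b≈1 : b ^ σ + b ≈ 1#
    b^σ+b≈1 = x+y≈0⇒x≈y (begin
      b ^ σ + b + 1#                    ≈⟨ solve 2 (λ B b → B :+ b :+ con true := con true :+ B :+ con true :* b) refl (b ^ σ) b ⟩
      1# + b ^ σ + 1# * b               ≈⟨ +-congʳ (+-congʳ (1^n≈1 (σ ℕ.+ 2))) ⟨
      f 1# b                            ≈⟨ f≈0 ⟩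
      0#                                ∎)
    b²+b^σ≈1 : b ^ 2 + b ^ σ ≈ 1#
    b²+b^σ≈1 = begin
      b ^ 2 + b ^ σ         ≈⟨ +-congʳ (^σ^σ b∈) ⟨
      (b ^ σ) ^ σ + b ^ σ   ≈⟨ ^σ-+ (b ^ σ) b ⟨
      (b ^ σ + b) ^ σ       ≈⟨ ^-congˡ σ b^σ+b≈1 ⟩
      1# ^ σ                ≈⟨ 1^n≈1 σ ⟩
      1#                    ∎
    b²≈b : b ^ 2 ≈ b
    b²≈b = x+y≈0⇒x≈y (begin
      b ^ 2 + b                        ≈⟨ solve 3 (λ b² B b → b² :+ b := (b² :+ B) :+ (B :+ b)) refl (b ^ 2) (b ^ σ) b ⟩
      (b ^ 2 + b ^ σ) + (b ^ σ + b)    ≈⟨ +-cong b²+b^σ≈1 b^σ+b≈1 ⟩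
      1# + 1#                          ≈⟨ 1+1≈0 ⟩
      0#                               ∎)
    b^σ≈b : Dec (b ≈ 0#) → b ^ σ ≈ b
    b^σ≈b (yes b≈0) = trans (^-congˡ σ b≈0) (trans (0^1+n≈0 σ>0) (sym b≈0))
    b^σ≈b (no b≉0)  = trans (^-congˡ σ b≈1) (trans (1^n≈1 σ) (sym b≈1))
      where
      b≈1 : b ≈ 1#
      b≈1 = *-cancelˡ b≉0 (trans (*-congˡ (sym (*-identityʳ b))) (trans b²≈b (sym (*-identityʳ b))))

  -- For nonzero `a`, scaling by `a ⁻¹` would produce a zero with first coordinate 1, against
  -- `f-1-≉0`.
  f≈0⇒a≈0 : ∀ {a b} → 𝔽q a → 𝔽q b → f a b ≈ 0# → a ≈ 0#
  f≈0⇒a≈0 {a} {b} a∈ b∈ f≈0 with a ≟ 0#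
  ... | yes a≈0 = a≈0
  ... | no a≉0 = contradiction
    (begin
      f 1# (t ^ σ * t * b)      ≈⟨ f-cong (⁻¹-inverseˡ a≉0) refl ⟨
      f (t * a) (t ^ σ * t * b) ≈⟨ f-scale a b t∈ ⟩
      t ^ (σ ℕ.+ 2) * f a b     ≈⟨ *-congˡ f≈0 ⟩
      t ^ (σ ℕ.+ 2) * 0#        ≈⟨ zeroʳ _ ⟩
      0#                        ∎)
    (f-1-≉0 (𝔽q-* (𝔽q-* (𝔽q-^ σ t∈) t∈) b∈))
    where
    t = a ⁻¹
    t∈ = 𝔽q-⁻¹ a≉0 a∈

  f≈0⇒b≈0 : ∀ {a b} → 𝔽q a → 𝔽q b → f a b ≈ 0# → b ≈ 0#
  f≈0⇒b≈0 {a} {b} a∈ b∈ f≈0 = ^-≈0 σ (begin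
    b ^ σ                          ≈⟨ solve 2 (λ B b → B := B :+ con false :* b) refl (b ^ σ) b ⟩
    b ^ σ + 0# * b                 ≈⟨ +-congʳ (+-identityˡ _) ⟨
    0# + b ^ σ + 0# * b            ≈⟨ +-cong (+-congʳ (trans (^-congˡ (σ ℕ.+ 2) a≈0) (0^1+n≈0 (ℕ.≤-trans σ>0 (ℕ.m≤m+n σ 2))))) (*-congʳ a≈0) ⟨
    f a b                          ≈⟨ f≈0 ⟩
    0#                             ∎)
    where a≈0 = f≈0⇒a≈0 a∈ b∈ f≈0

  f-0-0 : f 0# 0# ≈ 0#
  f-0-0 = begin
    f 0# 0#            ≈⟨ +-cong (+-cong (0^1+n≈0 (ℕ.≤-trans σ>0 (ℕ.m≤m+n σ 2))) (0^1+n≈0 σ>0)) (zeroˡ 0#) ⟩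
    0# + 0# + 0#       ≈⟨ solve 0 (con false :+ con false :+ con false := con false) refl ⟩
    0#                 ∎

  -- The preimage is t^(1-σ/2), since σ² = 2 on 𝔽q; here s = σ/2.
  ^[σ+2]-surjective : ∀ {t} → 𝔽q t → t ≉ 0# → ∃ λ u → 𝔽q u × u ≉ 0# × u ^ (σ ℕ.+ 2) ≈ t
  ^[σ+2]-surjective {t} t∈ t≉0 =
    u , 𝔽q-* t∈ (𝔽q-⁻¹ t^s≉0 (𝔽q-^ s t∈)) , *-≉0 t≉0 (⁻¹-≉0 t^s≉0) ,
    *-cancelˡ (^-≉0 (σ ℕ.+ 2) t^s≉0) (begin
      (t ^ s) ^ (σ ℕ.+ 2) * u ^ (σ ℕ.+ 2) ≈⟨ ^-distrib-* (t ^ s) u (σ ℕ.+ 2) ⟨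
      (t ^ s * u) ^ (σ ℕ.+ 2)            ≈⟨ ^-congˡ (σ ℕ.+ 2) t^s*u≈t ⟩
      t ^ (σ ℕ.+ 2)                      ≈⟨ ^-homo-* t σ 2 ⟩
      t ^ σ * t ^ 2                      ≈⟨ solve 2 (λ T t → T :* t :^ 2 := t :* T :* t) refl (t ^ σ) t ⟩
      t * t ^ σ * t                      ≈⟨ *-congʳ (*-cong t^[sσ] t^[2s]) ⟨
      (t ^ s) ^ σ * (t ^ s) ^ 2 * t      ≈⟨ *-congʳ (^-homo-* (t ^ s) σ 2) ⟨
      (t ^ s) ^ (σ ℕ.+ 2) * t            ∎)
    where
    u = t * (t ^ s) ⁻¹
    t^s≉0 = ^-≉0 s t≉0
    t^s*u≈t : t ^ s * u ≈ t
    t^s*u≈t = trans (solve 3 (λ x y z → x :* (y :* z) := y :* (x :* z)) refl (t ^ s) t ((t ^ s) ⁻¹))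
              (trans (*-congˡ (⁻¹-inverseʳ t^s≉0)) (*-identityʳ t))
    t^[sσ] : (t ^ s) ^ σ ≈ t
    t^[sσ] = trans (^-assocʳ t s σ) (trans (^-congʳ t s*σ≡q) t∈)
    t^[2s] : (t ^ s) ^ 2 ≈ t ^ σ
    t^[2s] = trans (^-assocʳ t s 2) (^-congʳ t (≡.trans (ℕ.*-comm s 2) (≡.sym σ≡2s)))

  γ : Carrier → Carrier
  γ x = (x + (x ^ q + x) * ε) ^ (σ ℕ.+ 2) + (x ^ q + x) ^ σ + (x ^ (2 ℕ.* q) + x ^ 2) * ε + x ^ (q ℕ.+ 1) + x ^ 2

  -- The last three terms of `γ` are (x^q + x)² ε + x (x^q + x), that is, the product of `re x` and
  -- `im x`.
  γ≈f : ∀ x → γ x ≈ f (re x) (im x)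
  γ≈f x = begin
    re x ^ (σ ℕ.+ 2) + im x ^ σ + (x ^ (2 ℕ.* q) + x ^ 2) * ε + x ^ (q ℕ.+ 1) + x ^ 2
      ≈⟨ +-congʳ (+-cong (+-congˡ (*-congʳ (+-congʳ (trans (^-congʳ x (ℕ.*-comm 2 q)) (sym (^-assocʳ x q 2)))))) (^-[1+] x q)) ⟩
    re x ^ (σ ℕ.+ 2) + im x ^ σ + (X ^ 2 + x ^ 2) * ε + X * x + x ^ 2
      ≈⟨ solve 5 (λ P Q X x ε → P :+ Q :+ (X :^ 2 :+ x :^ 2) :* ε :+ X :* x :+ x :^ 2 :=
           P :+ Q :+ (x :+ (X :+ x) :* ε) :* (X :+ x)) refl (re x ^ (σ ℕ.+ 2)) (im x ^ σ) X x ε ⟩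
    f (re x) (im x) ∎
    where X = x ^ q

  γ∈𝔽q : ∀ x → 𝔽q (γ x)
  γ∈𝔽q x = 𝔽q-resp (sym (γ≈f x)) (f∈𝔽q (re∈𝔽q x) (im∈𝔽q x))

  γ-cong : ∀ {x y} → x ≈ y → γ x ≈ γ y
  γ-cong {x} {y} x≈y = trans (γ≈f x) (trans (f-cong (re-cong x≈y) (im-cong x≈y)) (sym (γ≈f y)))

  γ-mk : ∀ {a b} → 𝔽q a → 𝔽q b → γ (mk a b) ≈ f a b
  γ-mk {a} {b} a∈ b∈ = trans (γ≈f (mk a b)) (f-cong (re-mk a∈ b∈) (im-mk a∈ b∈))

  -- Fibres of γ

  count-↔ : ∀ {p p′} {P : Carrier → Set p} {Q : Carrier → Set p′} (P? : Decidable P) (Q? : Decidable Q)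
    (φ ψ : Carrier → Carrier) →
    (∀ {x y} → x ≈ y → φ x ≈ φ y) → (∀ {x y} → x ≈ y → ψ x ≈ ψ y) →
    (∀ x → ψ (φ x) ≈ x) → (∀ y → φ (ψ y) ≈ y) →
    (∀ {x y} → x ≈ y → P x → P y) → (∀ {x y} → x ≈ y → Q x → Q y) →
    (∀ {x} → P x → Q (φ x)) → (∀ {x} → Q (φ x) → P x) →
    count finite P? ≡ count finite Q?
  count-↔ P? Q? φ ψ φ-cong ψ-cong ψφ φψ P-resp Q-resp P⇒Q Q⇒P = count-bijection finite finite P? Q? φ
    (λ Px y≈φx x′≈x → P-resp (sym x′≈x) Px , trans y≈φx (φ-cong (sym x′≈x)))
    (λ Px y≈φx → Q-resp (sym y≈φx) (P⇒Q Px))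
    (λ _ _ y≈φx y≈φx′ → trans (sym (ψφ _)) (trans (ψ-cong (trans (sym y≈φx) y≈φx′)) (ψφ _)))
    (λ {y} Qy → ψ y , Q⇒P (Q-resp (sym (φψ y)) Qy) , sym (φψ y))

  count-γ≈0 : count finite (λ x → γ x ≟ 0#) ≡ 1
  count-γ≈0 = count-unique finite (λ x → γ x ≟ 0#) 0#
    (λ {x} γx≈0 → let f≈0 = trans (sym (γ≈f x)) γx≈0 in trans (sym (mk-re-im x)) (trans
      (mk-cong (f≈0⇒a≈0 (re∈𝔽q x) (im∈𝔽q x) f≈0) (f≈0⇒b≈0 (re∈𝔽q x) (im∈𝔽q x) f≈0))
      (trans (+-identityˡ _) (zeroˡ ε))))
    (λ {x} x≈0 → trans (γ-cong (trans x≈0 (sym (trans (+-identityˡ _) (zeroˡ ε)))))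
      (trans (γ-mk 𝔽q-0 𝔽q-0) f-0-0))

  count-γ-scale : ∀ {u t} → 𝔽q u → u ≉ 0# →
    count finite (λ x → γ x ≟ t) ≡ count finite (λ x → γ x ≟ u ^ (σ ℕ.+ 2) * t)
  count-γ-scale {u} {t} u∈ u≉0 = count-↔ (λ x → γ x ≟ t) (λ x → γ x ≟ u ^ (σ ℕ.+ 2) * t)
    (scaling u (u ^ σ * u)) (scaling (u ⁻¹) ((u ^ σ * u) ⁻¹)) (scaling-cong _ _) (scaling-cong _ _)
    (λ x → unscale x u∈ v∈ (⁻¹-inverseˡ u≉0) (⁻¹-inverseˡ v≉0))
    (λ x → unscale x (𝔽q-⁻¹ u≉0 u∈) (𝔽q-⁻¹ v≉0 v∈) (⁻¹-inverseʳ u≉0) (⁻¹-inverseʳ v≉0))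
    (λ x≈y γx≈ → trans (γ-cong (sym x≈y)) γx≈)
    (λ x≈y γx≈ → trans (γ-cong (sym x≈y)) γx≈)
    (λ {x} γx≈t → trans (γ-scaling x) (*-congˡ γx≈t))
    (λ {x} eq → *-cancelˡ (^-≉0 (σ ℕ.+ 2) u≉0) (trans (sym (γ-scaling x)) eq))
    where
    v∈ = 𝔽q-* (𝔽q-^ σ u∈) u∈
    v≉0 = *-≉0 (^-≉0 σ u≉0) u≉0
    scaling : Carrier → Carrier → Carrier → Carrier
    scaling a b x = mk (a * re x) (b * im x)
    scaling-cong : ∀ a b {x y} → x ≈ y → scaling a b x ≈ scaling a b y
    scaling-cong a b x≈y = mk-cong (*-congˡ (re-cong x≈y)) (*-congˡ (im-cong x≈y))
    unscale : ∀ {a a′ b b′} x → 𝔽q a → 𝔽q b → a′ * a ≈ 1# → b′ * b ≈ 1# → scaling a′ b′ (scaling a b x) ≈ x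
    unscale {a} {a′} {b} {b′} x a∈ b∈ a′a≈1 b′b≈1 = trans
      (mk-cong (trans (*-congˡ (re-mk ax∈ bx∈)) (cancel a′a≈1)) (trans (*-congˡ (im-mk ax∈ bx∈)) (cancel b′b≈1)))
      (mk-re-im x)
      where
      ax∈ = 𝔽q-* a∈ (re∈𝔽q x)
      bx∈ = 𝔽q-* b∈ (im∈𝔽q x)
      cancel : ∀ {a a′ y} → a′ * a ≈ 1# → a′ * (a * y) ≈ y
      cancel eq = trans (sym (*-assoc _ _ _)) (trans (*-congʳ eq) (*-identityˡ _))
    γ-scaling : ∀ x → γ (scaling u (u ^ σ * u) x) ≈ u ^ (σ ℕ.+ 2) * γ x
    γ-scaling x = trans (γ-mk (𝔽q-* u∈ (re∈𝔽q x)) (𝔽q-* v∈ (im∈𝔽q x)))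
      (trans (f-scale (re x) (im x) u∈) (*-congˡ (sym (γ≈f x))))

  -- Every nonzero element of `𝔽q` is a (σ + 2)-th power there, so the torus is transitive on the
  -- nonzero values.
  count-γ-𝔽q* : ∀ {t} → 𝔽q t → t ≉ 0# → count finite (λ x → γ x ≟ t) ≡ count finite (λ x → γ x ≟ 1#)
  count-γ-𝔽q* {t} t∈ t≉0 = let u , u∈ , u≉0 , u^≈t = ^[σ+2]-surjective t∈ t≉0
                               t≈ = trans (sym u^≈t) (sym (*-identityʳ _)) in
    ≡.trans (count-cong finite (λ x → γ x ≟ t) (λ x → γ x ≟ u ^ (σ ℕ.+ 2) * 1#)
              (λ eq → trans eq t≈) (λ eq → trans eq (sym t≈)))
            (≡.sym (count-γ-scale u∈ u≉0))

  count-all-elements : count finite (λ _ → yes tt) ≡ q ℕ.* q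
  count-all-elements = ≡.trans (count-all finite (λ _ → yes tt) _)
    (≡.trans size-finite (cong (q ℕ.*_) (ℕ.*-identityʳ q)))

  -- The coordinates `re` and `im` identify the field with the pairs over `𝔽q`, so the count sought
  -- has square q².
  count-𝔽q : count finite 𝔽q? ≡ q
  count-𝔽q = square-injective (≡.trans
    (≡.sym (count-fibres finite finite 𝔽q? (λ a b → 𝔽q? a ×-dec 𝔽q? b) (count finite 𝔽q?) proj₁
      λ {a} a∈ → count-cong finite (λ b → 𝔽q? a ×-dec 𝔽q? b) 𝔽q? proj₂ (a∈ ,_)))
    (≡.trans (≡.sym (count-bijection finite (×-finite finite finite)
      (λ _ → yes tt) (λ (a , b) → 𝔽q? a ×-dec 𝔽q? b) (λ x → re x , im x)
      (λ _ (a≈ , b≈) x′≈x → tt , trans a≈ (re-cong (sym x′≈x)) , trans b≈ (im-cong (sym x′≈x)))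
      (λ {x} _ (a≈ , b≈) → 𝔽q-resp (sym a≈) (re∈𝔽q x) , 𝔽q-resp (sym b≈) (im∈𝔽q x))
      (λ {x} {x′} _ _ (a≈ , b≈) (a≈′ , b≈′) → trans (sym (mk-re-im x)) (trans
        (mk-cong (trans (sym a≈) a≈′) (trans (sym b≈) b≈′)) (mk-re-im x′)))
      (λ {(a , b)} (a∈ , b∈) → mk a b , tt , sym (re-mk a∈ b∈) , sym (im-mk a∈ b∈))))
    count-all-elements))
    where
    square-injective : ∀ {m n} → m ℕ.* m ≡ n ℕ.* n → m ≡ n
    square-injective {m} {n} eq with ℕ.<-cmp m n
    ... | tri< m<n _ _ = contradiction eq (ℕ.<⇒≢ (ℕ.*-mono-< m<n m<n))
    ... | tri≈ _ m≡n _ = m≡n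
    ... | tri> _ _ n<m = contradiction (≡.sym eq) (ℕ.<⇒≢ (ℕ.*-mono-< n<m n<m))

  1<q : 1 ℕ.< q
  1<q = ℕ.^-monoʳ-< 2 (ℕ.s≤s (ℕ.s≤s ℕ.z≤n)) (≡.subst (0 ℕ.<_) (≡.sym e≡) (ℕ.s≤s ℕ.z≤n))

  𝔽q*? : Decidable (λ t → 𝔽q t × t ≉ 0#)
  𝔽q*? t = 𝔽q? t ×-dec ¬? (t ≟ 0#)

  count-𝔽q* : suc (count finite 𝔽q*?) ≡ q
  count-𝔽q* = ≡.trans (cong (ℕ._+ count finite 𝔽q*?) (≡.sym
      (count-unique finite (λ t → 𝔽q? t ×-dec (t ≟ 0#)) 0# proj₂ (λ t≈0 → 𝔽q-resp (sym t≈0) 𝔽q-0 , t≈0))))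
    (≡.trans (≡.sym (count-split finite 𝔽q? (_≟ 0#))) count-𝔽q)

  count-γ≉0 : count finite (λ x → ¬? (γ x ≟ 0#)) ≡ count finite (λ x → γ x ≟ 1#) ℕ.* count finite 𝔽q*?
  count-γ≉0 = ≡.trans (≡.sym (ℕ.*-identityˡ _)) (double-count finite finite γ≉0? 𝔽q*? R? 1 _
    (λ ((_ , t≉0) , γx≈t) γx≈0 → t≉0 (trans (sym γx≈t) γx≈0))
    (λ {x} γx≉0 → count-unique finite (R? x) (γ x) (sym ∘ proj₂)
      (λ t≈γx → (𝔽q-resp (sym t≈γx) (γ∈𝔽q x) , λ t≈0 → γx≉0 (trans (sym t≈γx) t≈0)) , sym t≈γx))
    proj₁
    (λ {t} t∈* → ≡.trans (count-cong finite (λ x → R? x t) (λ x → γ x ≟ t) proj₂ (t∈* ,_))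
      (count-γ-𝔽q* (proj₁ t∈*) (proj₂ t∈*))))
    where
    γ≉0? : Decidable (λ x → γ x ≉ 0#)
    γ≉0? x = ¬? (γ x ≟ 0#)
    R? : ∀ x t → Dec ((𝔽q t × t ≉ 0#) × γ x ≈ t)
    R? x t = 𝔽q*? t ×-dec (γ x ≟ t)

  -- All q - 1 nonzero values have fibres of one size k, and zero is taken once; hence q² = 1 + k (q
  -- - 1).
  count-γ≈1 : count finite (λ x → γ x ≟ 1#) ≡ suc q
  count-γ≈1 = arithmetic count-𝔽q* 1<q (≡.trans (≡.sym count-all-elements)
    (≡.trans (count-split finite (λ _ → yes tt) (λ x → γ x ≟ 0#)) (cong₂ ℕ._+_
      (≡.trans (count-cong finite (λ x → yes tt ×-dec (γ x ≟ 0#)) (λ x → γ x ≟ 0#) proj₂ (tt ,_)) count-γ≈0)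
      (≡.trans (count-cong finite (λ x → yes tt ×-dec ¬? (γ x ≟ 0#)) (λ x → ¬? (γ x ≟ 0#)) proj₂ (tt ,_)) count-γ≉0))))
    where
    square : ∀ n → suc n ℕ.* suc n ≡ 1 ℕ.+ (2 ℕ.+ n) ℕ.* n
    square = solve-∀
    arithmetic : ∀ {q n k} → suc n ≡ q → 1 ℕ.< q → q ℕ.* q ≡ 1 ℕ.+ k ℕ.* n → k ≡ suc q
    -- Cancelling q - 1 requires it to be nonzero.
    arithmetic {n = zero}      ≡.refl (ℕ.s≤s ())
    arithmetic {n = suc n} {k} ≡.refl _ eq = ℕ.*-cancelʳ-≡ k (3 ℕ.+ n) (suc n)
      (ℕ.suc-injective (≡.trans (≡.sym eq) (square (suc n))))

  count-γ≉0-fibre : ∀ {t} → 𝔽q t → t ≉ 0# → count finite (λ x → γ x ≟ t) ≡ suc q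
  count-γ≉0-fibre t∈ t≉0 = ≡.trans (count-γ-𝔽q* t∈ t≉0) count-γ≈1

  -- Fibres of γ plus a linear term.

  h : Carrier → Carrier → Carrier
  h c x = γ x + im (c * x)

  h-cong : ∀ c {x y} → x ≈ y → h c x ≈ h c y
  h-cong c x≈y = +-cong (γ-cong x≈y) (im-cong (*-congˡ x≈y))

  h∈𝔽q : ∀ c x → 𝔽q (h c x)
  h∈𝔽q c x = 𝔽q-+ (γ∈𝔽q x) (im∈𝔽q (c * x))

  -- Brings the functional x ↦ im (c x) into the shape of the linear remainder in `f-translate`.
  im-*-coordinates : ∀ c x → im (c * x) ≈ im c * re x + im (c * ε) * im x
  im-*-coordinates c x = begin
    im (c * x)                          ≈⟨ im-cong (*-congˡ (mk-re-im x)) ⟨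
    im (c * (re x + im x * ε))          ≈⟨ im-cong (solve 4 (λ c a b ε → c :* (a :+ b :* ε) := a :* c :+ b :* (c :* ε)) refl c (re x) (im x) ε) ⟩
    im (re x * c + im x * (c * ε))      ≈⟨ im-+ _ _ ⟩
    im (re x * c) + im (im x * (c * ε)) ≈⟨ +-cong (im-*ˡ c (re∈𝔽q x)) (im-*ˡ (c * ε) (im∈𝔽q x)) ⟩
    re x * im c + im x * im (c * ε)     ≈⟨ +-cong (*-comm _ _) (*-comm _ _) ⟩
    im c * re x + im (c * ε) * im x     ∎

  module Translate (c : Carrier) where
    -- Chosen so that the remainder (u + t^σ t) a + t b of `f-translate` becomes α a + β b = im (c
    -- x): this dictates t = β and, in characteristic two, u = α + β^σ β. The constant left over is
    -- `τ`.
    α β u τ : Carrier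
    α = im c
    β = im (c * ε)
    u = α + β ^ σ * β
    τ = f β u

    β∈ : 𝔽q β
    β∈ = im∈𝔽q (c * ε)
    u∈ : 𝔽q u
    u∈ = 𝔽q-+ (im∈𝔽q c) (𝔽q-* (𝔽q-^ σ β∈) β∈)
    τ∈𝔽q : 𝔽q τ
    τ∈𝔽q = f∈𝔽q β∈ u∈

    φ ψ : Carrier → Carrier
    φ x = mk (re x + β) (im x + (u + β ^ σ * re x))
    -- The shift of the second coordinate under `φ` depends on the original first coordinate, which
    -- is recovered as `re y + β`.
    ψ y = mk (re y + β) (im y + (u + β ^ σ * (re y + β)))

    φ-cong : ∀ {x y} → x ≈ y → φ x ≈ φ y
    φ-cong x≈y = mk-cong (+-congʳ (re-cong x≈y)) (+-cong (im-cong x≈y) (+-congˡ (*-congˡ (re-cong x≈y))))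

    ψ-cong : ∀ {x y} → x ≈ y → ψ x ≈ ψ y
    ψ-cong x≈y = mk-cong (+-congʳ (re-cong x≈y))
      (+-cong (im-cong x≈y) (+-congˡ (*-congˡ (+-congʳ (re-cong x≈y)))))

    φ₁∈ : ∀ x → 𝔽q (re x + β)
    φ₁∈ x = 𝔽q-+ (re∈𝔽q x) β∈
    φ₂∈ : ∀ x → 𝔽q (im x + (u + β ^ σ * re x))
    φ₂∈ x = 𝔽q-+ (im∈𝔽q x) (𝔽q-+ u∈ (𝔽q-* (𝔽q-^ σ β∈) (re∈𝔽q x)))
    ψ₂∈ : ∀ x → 𝔽q (im x + (u + β ^ σ * (re x + β)))
    ψ₂∈ x = 𝔽q-+ (im∈𝔽q x) (𝔽q-+ u∈ (𝔽q-* (𝔽q-^ σ β∈) (φ₁∈ x)))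

    x+y+y≈x : ∀ x y → x + y + y ≈ x
    x+y+y≈x = solve 2 (λ x y → x :+ y :+ y := x) refl

    ψφ : ∀ x → ψ (φ x) ≈ x
    ψφ x = trans (mk-cong
      (trans (+-congʳ re-φ) (x+y+y≈x _ _))
      (trans (+-cong (im-mk (φ₁∈ x) (φ₂∈ x)) (+-congˡ (*-congˡ (trans (+-congʳ re-φ) (x+y+y≈x _ _))))) (x+y+y≈x _ _)))
      (mk-re-im x)
      where re-φ = re-mk (φ₁∈ x) (φ₂∈ x)

    φψ : ∀ x → φ (ψ x) ≈ x
    φψ x = trans (mk-cong
      (trans (+-congʳ re-ψ) (x+y+y≈x _ _))
      (trans (+-cong (im-mk (φ₁∈ x) (ψ₂∈ x)) (+-congˡ (*-congˡ re-ψ))) (x+y+y≈x _ _)))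
      (mk-re-im x)
      where re-ψ = re-mk (φ₁∈ x) (ψ₂∈ x)

    γ-φ : ∀ x → γ (φ x) ≈ h c x + τ
    γ-φ x = begin
      γ (φ x)                                   ≈⟨ γ-mk (φ₁∈ x) (φ₂∈ x) ⟩
      f (re x + β) (im x + (u + β ^ σ * re x))  ≈⟨ f-translate (re x) (im x) u β∈ ⟩
      f (re x) (im x) + τ + ((u + β ^ σ * β) * re x + β * im x)
        ≈⟨ +-cong (+-congʳ (sym (γ≈f x))) (+-congʳ (*-congʳ (x+y+y≈x α (β ^ σ * β)))) ⟩
      γ x + τ + (α * re x + β * im x)           ≈⟨ +-congˡ (im-*-coordinates c x) ⟨
      γ x + τ + im (c * x)                      ≈⟨ solve 3 (λ g t i → g :+ t :+ i := g :+ i :+ t) refl (γ x) τ (im (c * x)) ⟩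
      h c x + τ                                 ∎

    count-h : ∀ t → count finite (λ x → h c x ≟ t) ≡ count finite (λ x → γ x ≟ t + τ)
    count-h t = count-↔ (λ x → h c x ≟ t) (λ x → γ x ≟ t + τ) φ ψ φ-cong ψ-cong ψφ φψ
      (λ x≈y hx≈t → trans (h-cong c (sym x≈y)) hx≈t)
      (λ x≈y γx≈t → trans (γ-cong (sym x≈y)) γx≈t)
      (λ {x} hx≈t → trans (γ-φ x) (+-congʳ hx≈t))
      (λ {x} eq → trans (sym (x+y+y≈x (h c x) τ)) (trans (+-congʳ (trans (sym (γ-φ x)) eq)) (x+y+y≈x t τ)))

    count-h-tangent : ∀ {t} → t ≈ τ → count finite (λ x → h c x ≟ t) ≡ 1
    count-h-tangent {t} t≈τ = ≡.trans (count-h t) (≡.trans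
      (count-cong finite (λ x → γ x ≟ t + τ) (λ x → γ x ≟ 0#)
        (λ eq → trans eq t+τ≈0) (λ eq → trans eq (sym t+τ≈0))) count-γ≈0)
      where t+τ≈0 = x≈y⇒x+y≈0 t≈τ

    count-h-secant : ∀ {t} → 𝔽q t → t ≉ τ → count finite (λ x → h c x ≟ t) ≡ suc q
    count-h-secant {t} t∈ t≉τ = ≡.trans (count-h t)
      (count-γ≉0-fibre (𝔽q-+ t∈ τ∈𝔽q) (t≉τ ∘ x+y≈0⇒x≈y))

  open Translate using (τ; τ∈𝔽q; count-h-tangent; count-h-secant)

  pairs : Finite (Carrier × Carrier) _
  pairs = ×-finite finite finite

  -- For fixed x the equation h c′ y = d + h c x has one solution if h c x = d + τ c′ and q + 1
  -- otherwise. The number of such exceptional x is 1 or q + 1, according as d + τ c′ equals `τ c`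
  -- or not. This gives 1 + (q + 1)(q² - 1) or (q + 1) + (q + 1)(q² - q - 1) pairs; the summand `q`
  -- in the statement avoids subtraction.
  count-h+h : ∀ c c′ {d} → 𝔽q d →
    count pairs (λ (x , y) → h c x + h c′ y ≟ d) ℕ.+ q ≡ q ℕ.^ 3 ⊎
    count pairs (λ (x , y) → h c x + h c′ y ≟ d) ℕ.+ q ≡ q ℕ.^ 3 ℕ.+ q ℕ.^ 2
  count-h+h c c′ {d} d∈ = by-cases (d + τ c′ ≟ τ c)
    where
    S? : Decidable (λ x → h c x ≈ d + τ c′)
    S? x = h c x ≟ d + τ c′
    ¬S? : Decidable (λ x → h c x ≉ d + τ c′)
    ¬S? x = ¬? (S? x)

    count-S+¬S : count finite S? ℕ.+ count finite ¬S? ≡ q ℕ.* q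
    count-S+¬S = ≡.trans (cong₂ ℕ._+_
        (count-cong finite S? (λ x → yes tt ×-dec S? x) (tt ,_) proj₂)
        (count-cong finite ¬S? (λ x → yes tt ×-dec ¬S? x) (tt ,_) proj₂))
      (≡.trans (≡.sym (count-split finite (λ _ → yes tt) S?)) count-all-elements)

    R? : Decidable (λ ((x , y) : Carrier × Carrier) → h c x + h c′ y ≈ d)
    R? (x , y) = h c x + h c′ y ≟ d

    fibre : ∀ x → count finite (λ y → R? (x , y)) ≡ count finite (λ y → h c′ y ≟ d + h c x)
    fibre x = count-cong finite (λ y → R? (x , y)) (λ y → h c′ y ≟ d + h c x)
      (λ eq → trans (x+y≈z⇒x≈y+z (trans (+-comm _ _) eq)) (+-comm _ _))
      (λ eq → trans (+-congˡ eq) (solve 2 (λ x d → x :+ (d :+ x) := d) refl (h c x) d))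

    tangent⇒ : ∀ {x} → h c x ≈ d + τ c′ → d + h c x ≈ τ c′
    tangent⇒ {x} eq = trans (+-congˡ eq) (solve 2 (λ d t → d :+ (d :+ t) := t) refl d (τ c′))

    ⇒tangent : ∀ {x} → d + h c x ≈ τ c′ → h c x ≈ d + τ c′
    ⇒tangent {x} eq = trans (solve 2 (λ d h → h := d :+ (d :+ h)) refl d (h c x)) (+-congˡ eq)

    total : count pairs R? ≡ 1 ℕ.* count finite S? ℕ.+ suc q ℕ.* count finite ¬S?
    total = ≡.trans (count-split pairs R? (S? ∘ proj₁)) (cong₂ ℕ._+_
      (count-fibres finite finite S? (λ x y → R? (x , y) ×-dec S? x) 1 proj₂
        (λ {x} Sx → ≡.trans (count-cong finite (λ y → R? (x , y) ×-dec S? x) (λ y → R? (x , y)) proj₁ (_, Sx))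
          (≡.trans (fibre x) (count-h-tangent c′ (tangent⇒ Sx)))))
      (count-fibres finite finite ¬S? (λ x y → R? (x , y) ×-dec ¬? (S? x)) (suc q) proj₂
        (λ {x} ¬Sx → ≡.trans (count-cong finite (λ y → R? (x , y) ×-dec ¬? (S? x)) (λ y → R? (x , y)) proj₁ (_, ¬Sx))
          (≡.trans (fibre x) (count-h-secant c′ (𝔽q-+ d∈ (h∈𝔽q c x)) (¬Sx ∘ ⇒tangent))))))

    secant-arithmetic : ∀ {k n q} → k ≡ 1 ℕ.* suc q ℕ.+ suc q ℕ.* n → suc q ℕ.+ n ≡ q ℕ.* q → k ℕ.+ q ≡ q ℕ.^ 3
    secant-arithmetic {n = n} {q} ≡.refl eq = ℕ.+-cancelʳ-≡ (q ℕ.* q) _ _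
      (≡.trans (lhs q n) (≡.trans (cong (suc q ℕ.*_) eq) (rhs q)))
      where
      lhs : ∀ q n → 1 ℕ.* suc q ℕ.+ suc q ℕ.* n ℕ.+ q ℕ.+ q ℕ.* q ≡ suc q ℕ.* (suc q ℕ.+ n)
      lhs = solve-∀
      rhs : ∀ q → suc q ℕ.* (q ℕ.* q) ≡ q ℕ.* (q ℕ.* (q ℕ.* 1)) ℕ.+ q ℕ.* q
      rhs = solve-∀

    tangent-arithmetic : ∀ {k n q} → k ≡ 1 ℕ.* 1 ℕ.+ suc q ℕ.* n → 1 ℕ.+ n ≡ q ℕ.* q → k ℕ.+ q ≡ q ℕ.^ 3 ℕ.+ q ℕ.^ 2
    tangent-arithmetic {n = n} {q} ≡.refl eq = ≡.trans (lhs q n) (≡.trans (cong (suc q ℕ.*_) eq) (rhs q))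
      where
      lhs : ∀ q n → 1 ℕ.* 1 ℕ.+ suc q ℕ.* n ℕ.+ q ≡ suc q ℕ.* (1 ℕ.+ n)
      lhs = solve-∀
      rhs : ∀ q → suc q ℕ.* (q ℕ.* q) ≡ q ℕ.* (q ℕ.* (q ℕ.* 1)) ℕ.+ q ℕ.* (q ℕ.* 1)
      rhs = solve-∀

    by-cases : Dec (d + τ c′ ≈ τ c) → _
    by-cases (yes eq) = inj₂ (tangent-arithmetic
      (≡.trans total (cong (λ k → 1 ℕ.* k ℕ.+ suc q ℕ.* count finite ¬S?) S≡1))
      (≡.trans (cong (ℕ._+ count finite ¬S?) (≡.sym S≡1)) count-S+¬S))
      where S≡1 = count-h-tangent c eq
    by-cases (no neq) = inj₁ (secant-arithmetic
      (≡.trans total (cong (λ k → 1 ℕ.* k ℕ.+ suc q ℕ.* count finite ¬S?) S≡))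
      (≡.trans (cong (ℕ._+ count finite ¬S?) (≡.sym S≡)) count-S+¬S))
      where S≡ = count-h-secant c (𝔽q-+ d∈ (τ∈𝔽q c′)) neq

  -- Plane sections of the affine part.

  form : Vector Carrier 4 → Vector Carrier 4 → Carrier
  form a X = sum (λ i → a i * X i)

  count-linear : ∀ {b} s → b ≉ 0# → count finite (λ y → s + b * y ≟ 0#) ≡ 1
  count-linear {b} s b≉0 = count-unique finite (λ y → s + b * y ≟ 0#) (b ⁻¹ * s)
    (λ eq → *-cancelˡ b≉0 (trans (sym (x+y≈0⇒x≈y eq)) (sym root)))
    (λ y≈ → x≈y⇒x+y≈0 (sym (trans (*-congˡ y≈) root)))
    where
    root : b * (b ⁻¹ * s) ≈ s
    root = trans (sym (*-assoc _ _ _)) (trans (*-congʳ (⁻¹-inverseʳ b≉0)) (*-identityˡ s))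

  count-pairs : count pairs (λ _ → yes tt) ≡ q ℕ.* q ℕ.* (q ℕ.* q)
  count-pairs = ≡.trans
    (count-fibres finite finite (λ _ → yes tt) (λ _ _ → yes tt) (q ℕ.* q) _ (λ _ → count-all-elements))
    (cong (q ℕ.* q ℕ.*_) count-all-elements)

  -- The fibre over `d` is the coset of `𝔽q` consisting of all a + d ε.
  count-im : ∀ {d} → 𝔽q d → count finite (λ z → im z ≟ d) ≡ q
  count-im {d} d∈ = ≡.trans (≡.sym (count-bijection finite finite 𝔽q? (λ z → im z ≟ d) (λ a → mk a d)
    (λ a∈ z≈ a′≈a → 𝔽q-resp (sym a′≈a) a∈ , trans z≈ (mk-cong (sym a′≈a) refl))
    (λ a∈ z≈ → trans (im-cong z≈) (im-mk a∈ d∈))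
    (λ a∈ a′∈ z≈ z≈′ → trans (sym (re-mk a∈ d∈)) (trans (re-cong (trans (sym z≈) z≈′)) (re-mk a′∈ d∈)))
    (λ {z} im≈d → re z , re∈𝔽q z , trans (sym (mk-re-im z)) (mk-cong refl im≈d))))
    count-𝔽q

  triples : Finite ((Carrier × Carrier) × Carrier) _
  triples = ×-finite pairs finite

  affine : (Carrier × Carrier) × Carrier → Vector Carrier 4
  affine ((x , y) , z) = 1# Vector.∷ x Vector.∷ y Vector.∷ z Vector.∷ Vector.[]

  IsAffinePoint : (Carrier × Carrier) × Carrier → Set ℓ₁
  IsAffinePoint ((x , y) , z) = im z ≈ γ x + γ y

  isAffinePoint? : Decidable IsAffinePoint
  isAffinePoint? ((x , y) , z) = im z ≟ γ x + γ y

  γ+γ∈𝔽q : ∀ x y → 𝔽q (γ x + γ y)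
  γ+γ∈𝔽q x y = 𝔽q-+ (γ∈𝔽q x) (γ∈𝔽q y)

  count-affine : count triples isAffinePoint? ≡ q ℕ.^ 5
  count-affine = ≡.trans
    (count-fibres pairs finite (λ _ → yes tt) (λ xy z → isAffinePoint? (xy , z)) q _
      (λ {(x , y)} _ → count-im (γ+γ∈𝔽q x y)))
    (≡.trans (cong (q ℕ.*_) count-pairs) (power q))
    where
    power : ∀ q → q ℕ.* (q ℕ.* q ℕ.* (q ℕ.* q)) ≡ q ℕ.* (q ℕ.* (q ℕ.* (q ℕ.* (q ℕ.* 1))))
    power = solve-∀

  module _ (a : Vector Carrier 4) where
    onAffinePlane? : Decidable (λ p → IsAffinePoint p × form a (affine p) ≈ 0#)
    onAffinePlane? p = isAffinePoint? p ×-dec (form a (affine p) ≟ 0#)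

    -- The plane is the graph of an affine function z₀ of x and y. Substituting it for z moves its
    -- linear part into the two summands `h` and leaves the constant im (C 0F) on the other side.
    count-affine-nonvertical : a 3F ≉ 0# →
      count triples onAffinePlane? ℕ.+ q ≡ q ℕ.^ 3 ⊎
      count triples onAffinePlane? ℕ.+ q ≡ q ℕ.^ 3 ℕ.+ q ℕ.^ 2
    count-affine-nonvertical a₃≉0 = ≡.subst (λ k → k ℕ.+ q ≡ q ℕ.^ 3 ⊎ k ℕ.+ q ≡ q ℕ.^ 3 ℕ.+ q ℕ.^ 2)
      (≡.sym (≡.trans (count-fibres pairs finite P? (λ xy z → onAffinePlane? (xy , z)) 1
          (λ {(x , y)} (im≈ , form≈0) → plane⇒P (trans (im-cong (sym (form⇒z x y form≈0))) im≈))
          (λ {(x , y)} P → count-unique finite (λ z → onAffinePlane? ((x , y) , z)) (z₀ x y)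
            (λ (_ , form≈0) → form⇒z x y form≈0)
            (λ z≈ → trans (im-cong z≈) (P⇒plane P) , z⇒form x y z≈)))
        (ℕ.*-identityˡ _)))
      (count-h+h (C 1F) (C 2F) (im∈𝔽q (C 0F)))
      where
      i = a 3F ⁻¹
      C : Vector Carrier 4
      C k = i * a k
      P? : Decidable (λ ((x , y) : Carrier × Carrier) → h (C 1F) x + h (C 2F) y ≈ im (C 0F))
      P? (x , y) = h (C 1F) x + h (C 2F) y ≟ im (C 0F)
      z₀ : Carrier → Carrier → Carrier
      z₀ x y = C 0F + (C 1F * x + C 2F * y)

      im-z₀ : ∀ x y → im (z₀ x y) ≈ im (C 0F) + (im (C 1F * x) + im (C 2F * y))
      im-z₀ x y = trans (im-+ _ _) (+-congˡ (im-+ _ _))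

      plane⇒P : ∀ {x y} → im (z₀ x y) ≈ γ x + γ y → h (C 1F) x + h (C 2F) y ≈ im (C 0F)
      plane⇒P {x} {y} eq = x+y≈0⇒x≈y (trans
        (solve 5 (λ g g′ i j k → g :+ i :+ (g′ :+ j) :+ k := (k :+ (i :+ j)) :+ (g :+ g′)) refl _ _ _ _ _)
        (x≈y⇒x+y≈0 (trans (sym (im-z₀ x y)) eq)))

      P⇒plane : ∀ {x y} → h (C 1F) x + h (C 2F) y ≈ im (C 0F) → im (z₀ x y) ≈ γ x + γ y
      P⇒plane {x} {y} eq = trans (im-z₀ x y) (x+y≈0⇒x≈y (trans
        (solve 5 (λ g g′ i j k → (k :+ (i :+ j)) :+ (g :+ g′) := g :+ i :+ (g′ :+ j) :+ k) refl _ _ _ _ _)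
        (x≈y⇒x+y≈0 eq)))

      form-affine : ∀ x y z → i * form a (affine ((x , y) , z)) ≈ z₀ x y + z
      form-affine x y z = trans
        (solve 8 (λ i a₀ a₁ a₂ a₃ x y z →
          i :* (a₀ :* con true :+ (a₁ :* x :+ (a₂ :* y :+ (a₃ :* z :+ con false)))) :=
          i :* a₀ :+ (i :* a₁ :* x :+ i :* a₂ :* y) :+ i :* a₃ :* z) refl i (a 0F) (a 1F) (a 2F) (a 3F) x y z)
        (+-congˡ (trans (*-congʳ (⁻¹-inverseˡ a₃≉0)) (*-identityˡ z)))

      form⇒z : ∀ x y {z} → form a (affine ((x , y) , z)) ≈ 0# → z ≈ z₀ x y
      form⇒z x y {z} form≈0 = sym (x+y≈0⇒x≈y (trans (sym (form-affine x y z))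
        (trans (*-congˡ form≈0) (zeroʳ i))))

      z⇒form : ∀ x y {z} → z ≈ z₀ x y → form a (affine ((x , y) , z)) ≈ 0#
      z⇒form x y {z} z≈z₀ = x*y≈0⇒y≈0 (⁻¹-≉0 a₃≉0)
        (trans (form-affine x y z) (x≈y⇒x+y≈0 (sym z≈z₀)))

    module _ (a₃≈0 : a 3F ≈ 0#) where
      -- The equation of the projection of the plane along the z-axis, not a field trace: the plane
      -- passes through the vertex and is a cylinder over these pairs.
      trace : Carrier → Carrier → Carrier
      trace x y = a 0F + (a 1F * x + a 2F * y)

      form-vertical : ∀ x y z → form a (affine ((x , y) , z)) ≈ trace x y
      form-vertical x y z = +-cong (*-identityʳ _) (+-congˡ (trans
        (+-congˡ (trans (+-identityʳ _) (trans (*-congʳ a₃≈0) (zeroˡ z)))) (+-identityʳ _)))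

      trace? : Decidable (λ ((x , y) : Carrier × Carrier) → trace x y ≈ 0#)
      trace? (x , y) = trace x y ≟ 0#

      count-trace : a 1F ≉ 0# ⊎ a 2F ≉ 0# → count pairs trace? ≡ q ℕ.* q
      count-trace (inj₁ a₁≉0) = ≡.trans
        (count-fibresʳ finite finite (λ _ → yes tt) (λ x y → trace? (x , y)) 1 _
          (λ {y} _ → ≡.trans (count-cong finite (λ x → trace? (x , y)) (λ x → (a 0F + a 2F * y) + a 1F * x ≟ 0#)
            (trans (sym (reorder _ y))) (trans (reorder _ y))) (count-linear _ a₁≉0)))
        (≡.trans (ℕ.*-identityˡ _) count-all-elements)
        where
        reorder : ∀ x y → trace x y ≈ (a 0F + a 2F * y) + a 1F * x
        reorder x y = solve 3 (λ a b c → a :+ (b :+ c) := (a :+ c) :+ b) refl (a 0F) (a 1F * x) (a 2F * y)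
      count-trace (inj₂ a₂≉0) = ≡.trans
        (count-fibres finite finite (λ _ → yes tt) (λ x y → trace? (x , y)) 1 _
          (λ {x} _ → ≡.trans (count-cong finite (λ y → trace? (x , y)) (λ y → (a 0F + a 1F * x) + a 2F * y ≟ 0#)
            (trans (+-assoc _ _ _)) (trans (sym (+-assoc _ _ _)))) (count-linear _ a₂≉0)))
        (≡.trans (ℕ.*-identityˡ _) count-all-elements)

      -- The projection is a line with q² points, and each vertical line over it carries q points of
      -- the hypersurface.
      count-affine-vertical : a 1F ≉ 0# ⊎ a 2F ≉ 0# → count triples onAffinePlane? ≡ q ℕ.^ 3
      count-affine-vertical a₁₂≉0 = ≡.trans
        (count-fibres pairs finite trace? (λ xy z → onAffinePlane? (xy , z)) q
          (λ {(x , y)} {z} (_ , form≈0) → trans (sym (form-vertical x y z)) form≈0)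
          (λ {(x , y)} trace≈0 → ≡.trans
            (count-cong finite (λ z → onAffinePlane? ((x , y) , z)) (λ z → isAffinePoint? ((x , y) , z))
              proj₁ (λ {z} im≈ → im≈ , trans (form-vertical x y z) trace≈0))
            (count-im (γ+γ∈𝔽q x y))))
        (≡.trans (cong (q ℕ.*_) (count-trace a₁₂≉0)) (power q))
        where
        power : ∀ q → q ℕ.* (q ℕ.* q) ≡ q ℕ.* (q ℕ.* (q ℕ.* 1))
        power = solve-∀

      count-affine-infinity : a 1F ≈ 0# → a 2F ≈ 0# → a 0F ≉ 0# → count triples onAffinePlane? ≡ 0
      count-affine-infinity a₁≈0 a₂≈0 a₀≉0 = count-none triples onAffinePlane? λ ((x , y) , z) (_ , form≈0) →
        a₀≉0 (begin
          a 0F                              ≈⟨ solve 3 (λ a x y → a := a :+ (con false :* x :+ con false :* y)) refl (a 0F) x y ⟩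
          a 0F + (0# * x + 0# * y)          ≈⟨ +-congˡ (+-cong (*-congʳ a₁≈0) (*-congʳ a₂≈0)) ⟨
          trace x y                         ≈⟨ form-vertical x y z ⟨
          form a (affine ((x , y) , z))     ≈⟨ form≈0 ⟩
          0#                                ∎)

  -- Points at infinity

  -- The exponents: σ + 2 = 2 (s + 1) and q² = 4 s⁴ with s an odd power of 2.

  y^[σ+2]≈[y^s*y]² : ∀ y → y ^ (σ ℕ.+ 2) ≈ (y ^ s * y) ^ 2
  y^[σ+2]≈[y^s*y]² y = begin
    y ^ (σ ℕ.+ 2)       ≈⟨ ^-homo-* y σ 2 ⟩
    y ^ σ * y ^ 2       ≈⟨ *-congʳ (trans (^-congʳ y (≡.trans σ≡2s (ℕ.*-comm 2 s))) (sym (^-assocʳ y s 2))) ⟩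
    (y ^ s) ^ 2 * y ^ 2 ≈⟨ ^-distrib-* (y ^ s) y 2 ⟨
    (y ^ s * y) ^ 2     ∎

  y^4≈y⇒y³≈1 : ∀ {y} → y ≉ 0# → y ^ 4 ≈ y → y ^ 3 ≈ 1#
  y^4≈y⇒y³≈1 y≉0 eq = *-cancelˡ y≉0 (trans eq (sym (*-identityʳ _)))

  -- Squaring is injective, so y^(s+1) = 1, and a further s-th power gives y^(s²) = y. As q = 2s²,
  -- two q-th powers amount to y ↦ y⁴, while they also fix y.
  y^[σ+2]≈1⇒y³≈1 : ∀ {y} → y ^ (σ ℕ.+ 2) ≈ 1# → y ^ 3 ≈ 1#
  y^[σ+2]≈1⇒y³≈1 {y} eq = y^4≈y⇒y³≈1 y≉0 (sym (begin
    y                                ≈⟨ ^q^q y ⟨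
    (y ^ q) ^ q                      ≈⟨ trans (^-congˡ q (^q≈ y)) (^q≈ _) ⟩
    (((((y ^ s) ^ s) ^ 2) ^ s) ^ s) ^ 2 ≈⟨ ^-congˡ 2 (^-congˡ s (^-congˡ s (^-congˡ 2 y^s^s≈y))) ⟩
    (((y ^ 2) ^ s) ^ s) ^ 2          ≈⟨ ^-congˡ 2 (trans (^-congˡ s (^-comm y 2 s)) (^-comm (y ^ s) 2 s)) ⟩
    (((y ^ s) ^ s) ^ 2) ^ 2          ≈⟨ ^-congˡ 2 (^-congˡ 2 y^s^s≈y) ⟩
    (y ^ 2) ^ 2                      ≈⟨ ^-assocʳ y 2 2 ⟩
    y ^ 4                            ∎))
    where
    y^s*y≈1 : y ^ s * y ≈ 1#
    y^s*y≈1 = frobenius-injective 1 (trans (sym (y^[σ+2]≈[y^s*y]² y)) (trans eq (sym (1^n≈1 2))))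
    y≉0 : y ≉ 0#
    y≉0 y≈0 = 1≉0 (trans (sym y^s*y≈1) (trans (*-congˡ y≈0) (zeroʳ _)))
    y^s^s≈y : (y ^ s) ^ s ≈ y
    y^s^s≈y = *-cancelˡ (^-≉0 s y≉0) (begin
      y ^ s * (y ^ s) ^ s ≈⟨ *-comm _ _ ⟩
      (y ^ s) ^ s * y ^ s ≈⟨ ^-distrib-* (y ^ s) y s ⟨
      (y ^ s * y) ^ s     ≈⟨ ^-congˡ s y^s*y≈1 ⟩
      1# ^ s              ≈⟨ 1^n≈1 s ⟩
      1#                  ≈⟨ y^s*y≈1 ⟨
      y ^ s * y           ∎)
    ^q≈ : ∀ x → x ^ q ≈ ((x ^ s) ^ s) ^ 2
    ^q≈ x = begin
      x ^ q                 ≡⟨ cong (x ^_) (≡.trans (≡.sym s*σ≡q) (cong (s ℕ.*_) (≡.trans σ≡2s (ℕ.*-comm 2 s)))) ⟩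
      x ^ (s ℕ.* (s ℕ.* 2)) ≈⟨ ^-assocʳ x s (s ℕ.* 2) ⟨
      (x ^ s) ^ (s ℕ.* 2)   ≈⟨ ^-assocʳ (x ^ s) s 2 ⟨
      ((x ^ s) ^ s) ^ 2     ∎

  -- Here y⁴ = y, so powers of 4 in the exponent disappear; `s` is twice such a power, whence y^s =
  -- y² and y^(s+1) = y³.
  y³≈1⇒y^[σ+2]≈1 : ∀ {y} → y ^ 3 ≈ 1# → y ^ (σ ℕ.+ 2) ≈ 1#
  y³≈1⇒y^[σ+2]≈1 {y} y³≈1 = begin
    y ^ (σ ℕ.+ 2)      ≈⟨ y^[σ+2]≈[y^s*y]² y ⟩
    (y ^ s * y) ^ 2    ≈⟨ ^-congˡ 2 (*-congʳ y^s≈y²) ⟩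
    (y ^ 2 * y) ^ 2    ≈⟨ ^-congˡ 2 (trans (*-comm _ _) y³≈1) ⟩
    1# ^ 2             ≈⟨ 1^n≈1 2 ⟩
    1#                 ∎
    where
    y^4^k≈y : ∀ k → y ^ (4 ℕ.^ k) ≈ y
    y^4^k≈y zero    = *-identityʳ y
    y^4^k≈y (suc k) = trans (sym (^-assocʳ y 4 (4 ℕ.^ k)))
      (trans (^-congˡ (4 ℕ.^ k) (trans (*-congˡ y³≈1) (*-identityʳ y))) (y^4^k≈y k))
    y^s≈y² : y ^ s ≈ y ^ 2
    y^s≈y² = begin
      y ^ (2 ℕ.* 2 ℕ.^ (2 ℕ.* m)) ≡⟨ cong (λ n → y ^ (2 ℕ.* n)) (≡.sym (ℕ.^-*-assoc 2 2 m)) ⟩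
      y ^ (2 ℕ.* 4 ℕ.^ m)         ≈⟨ ^-2* ⟩
      (y ^ (4 ℕ.^ m)) ^ 2         ≈⟨ ^-congˡ 2 (y^4^k≈y m) ⟩
      y ^ 2                       ∎
      where ^-2* = trans (sym (^-assocʳ y 2 (4 ℕ.^ m))) (^-comm y 2 (4 ℕ.^ m))

  -- ω² + ω telescopes to ε^q + ε = 1.
  partialTrace : ℕ → Carrier
  partialTrace zero    = 0#
  partialTrace (suc n) = partialTrace n + ε ^ (2 ℕ.^ n)

  partialTrace-telescopes : ∀ n → partialTrace n ^ 2 + partialTrace n ≈ ε ^ (2 ℕ.^ n) + ε
  partialTrace-telescopes zero = trans (solve 1 (λ x → con false :^ 2 :+ con false := x :+ x) refl ε)
                                       (+-congʳ (sym (*-identityʳ ε)))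
  partialTrace-telescopes (suc n) = begin
    (T + E) ^ 2 + (T + E)           ≈⟨ solve 2 (λ T E → (T :+ E) :^ 2 :+ (T :+ E) := (T :^ 2 :+ T) :+ (E :^ 2 :+ E)) refl T E ⟩
    (T ^ 2 + T) + (E ^ 2 + E)       ≈⟨ +-congʳ (partialTrace-telescopes n) ⟩
    (E + ε) + (E ^ 2 + E)           ≈⟨ solve 3 (λ E E² ε → (E :+ ε) :+ (E² :+ E) := E² :+ ε) refl E (E ^ 2) ε ⟩
    E ^ 2 + ε                       ≈⟨ +-congʳ (trans (^-assocʳ ε (2 ℕ.^ n) 2) (^-congʳ ε (ℕ.*-comm (2 ℕ.^ n) 2))) ⟩
    ε ^ (2 ℕ.* 2 ℕ.^ n) + ε         ∎
    where
    T = partialTrace n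
    E = ε ^ (2 ℕ.^ n)

  ω : Carrier
  ω = partialTrace e

  ω²+ω≈1 : ω ^ 2 + ω ≈ 1#
  ω²+ω≈1 = trans (partialTrace-telescopes e) (trans (+-congʳ ε^q≈ε+1)
    (solve 1 (λ x → x :+ con true :+ x := con true) refl ε))

  -- By ω² + ω = 1 the roots of y² + y + 1 are `ω` and `ω + 1#`. The cube roots of unity are thus
  -- exhibited explicitly from ε.
  cube : ∀ y → y ^ 3 + 1# ≈ (y + 1#) * ((y + ω) * (y + (ω + 1#)))
  cube y = begin
    y ^ 3 + 1#
      ≈⟨ solve 1 (λ y → y :^ 3 :+ con true := (y :+ con true) :* (y :^ 2 :+ y :+ con true)) refl y ⟩
    (y + 1#) * (y ^ 2 + y + 1#)
      ≈⟨ *-congˡ (+-congˡ ω²+ω≈1) ⟨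
    (y + 1#) * (y ^ 2 + y + (ω ^ 2 + ω))
      ≈⟨ *-congˡ (solve 2 (λ y ω → y :^ 2 :+ y :+ (ω :^ 2 :+ ω) := (y :+ ω) :* (y :+ (ω :+ con true))) refl y ω) ⟩
    (y + 1#) * ((y + ω) * (y + (ω + 1#))) ∎

  unity? : Decidable (λ y → y ^ 3 ≈ 1#)
  unity? y = y ^ 3 ≟ 1#

  count-cube-roots : count finite unity? ≡ 3
  count-cube-roots = ≡.trans (count-split finite unity? (_≟ 1#)) (cong₂ ℕ._+_
    (count-unique finite (λ y → unity? y ×-dec (y ≟ 1#)) 1# proj₂ (λ y≈1 → 1-root y≈1 , y≈1))
    (≡.trans (count-split finite unity∖1? (_≟ ω)) (cong₂ ℕ._+_
      (count-unique finite (λ y → unity∖1? y ×-dec (y ≟ ω)) ω proj₂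
        (λ y≈ω → (ω-root y≈ω , λ y≈1 → 1≉ω (trans (sym y≈1) y≈ω)) , y≈ω))
      (count-unique finite (λ y → unity∖1? y ×-dec ¬? (y ≟ ω)) (ω + 1#)
        (λ ((y³≈1 , y≉1) , y≉ω) → third y³≈1 y≉1 y≉ω)
        (λ y≈ → (ω+1-root y≈ , λ y≈1 → ω≉0 (trans (x+y≈z⇒x≈y+z (trans (sym y≈) y≈1)) 1+1≈0))
          , λ y≈ω → 1≉0 (+-cancelˡ (trans (sym y≈) (trans y≈ω (sym (+-identityʳ ω))))))))))
    where
    unity∖1? : Decidable (λ y → y ^ 3 ≈ 1# × y ≉ 1#)
    unity∖1? y = unity? y ×-dec ¬? (y ≟ 1#)
    root : ∀ {y} → (y + 1#) * ((y + ω) * (y + (ω + 1#))) ≈ 0# → y ^ 3 ≈ 1#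
    root eq = x+y≈0⇒x≈y (trans (cube _) eq)
    1-root : ∀ {y} → y ≈ 1# → y ^ 3 ≈ 1#
    1-root y≈1 = root (trans (*-congʳ (x≈y⇒x+y≈0 y≈1)) (zeroˡ _))
    ω-root : ∀ {y} → y ≈ ω → y ^ 3 ≈ 1#
    ω-root y≈ω = root (trans (*-congˡ (trans (*-congʳ (x≈y⇒x+y≈0 y≈ω)) (zeroˡ _))) (zeroʳ _))
    ω+1-root : ∀ {y} → y ≈ ω + 1# → y ^ 3 ≈ 1#
    ω+1-root y≈ = root (trans (*-congˡ (trans (*-congˡ (x≈y⇒x+y≈0 y≈)) (zeroʳ _))) (zeroʳ _))
    third : ∀ {y} → y ^ 3 ≈ 1# → y ≉ 1# → y ≉ ω → y ≈ ω + 1#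
    third y³≈1 y≉1 y≉ω = x+y≈0⇒x≈y (x*y≈0⇒y≈0 (y≉ω ∘ x+y≈0⇒x≈y) (x*y≈0⇒y≈0 (y≉1 ∘ x+y≈0⇒x≈y)
      (trans (sym (cube _)) (x≈y⇒x+y≈0 y³≈1))))
    1≉ω : 1# ≉ ω
    1≉ω 1≈ω = 1≉0 (trans (sym ω²+ω≈1) (trans (+-cong (^-congˡ 2 (sym 1≈ω)) (sym 1≈ω))
      (solve 0 (con true :^ 2 :+ con true := con false) refl)))
    ω≉0 : ω ≉ 0#
    ω≉0 ω≈0 = 1≉0 (trans (sym ω²+ω≈1) (trans (+-cong (^-congˡ 2 ω≈0) ω≈0)
      (solve 0 (con false :^ 2 :+ con false := con false) refl)))

  infinite : Carrier × Carrier → Vector Carrier 4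
  infinite (y , z) = 0# Vector.∷ 1# Vector.∷ y Vector.∷ z Vector.∷ Vector.[]

  isInfinitePoint? : Decidable (λ ((y , z) : Carrier × Carrier) → y ^ 3 ≈ 1#)
  isInfinitePoint? (y , z) = unity? y

  count-infinite : count pairs isInfinitePoint? ≡ 3 ℕ.* q ℕ.^ 2
  count-infinite = ≡.trans
    (count-fibres finite finite unity? (λ y _ → unity? y) (q ℕ.* q) id (λ {y} y³≈1 → ≡.trans
      (count-cong finite (λ _ → unity? y) (λ _ → yes tt) _ (λ _ → y³≈1)) count-all-elements))
    (≡.trans (cong (q ℕ.* q ℕ.*_) count-cube-roots) (power q))
    where
    power : ∀ q → q ℕ.* q ℕ.* 3 ≡ 3 ℕ.* (q ℕ.* (q ℕ.* 1))
    power = solve-∀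

  module _ (a : Vector Carrier 4) where
    onInfinitePlane? : Decidable (λ ((y , z) : Carrier × Carrier) → y ^ 3 ≈ 1# × form a (infinite (y , z)) ≈ 0#)
    onInfinitePlane? (y , z) = unity? y ×-dec (form a (infinite (y , z)) ≟ 0#)

    form-infinite : ∀ y z → form a (infinite (y , z)) ≈ (a 1F + a 2F * y) + a 3F * z
    form-infinite y z = solve 6 (λ a₀ a₁ a₂ a₃ y z →
      a₀ :* con false :+ (a₁ :* con true :+ (a₂ :* y :+ (a₃ :* z :+ con false))) := (a₁ :+ a₂ :* y) :+ a₃ :* z)
      refl (a 0F) (a 1F) (a 2F) (a 3F) y z

    count-infinite-nonvertical : a 3F ≉ 0# → count pairs onInfinitePlane? ≡ 3
    count-infinite-nonvertical a₃≉0 = ≡.trans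
      (count-fibres finite finite unity? (λ y z → onInfinitePlane? (y , z)) 1 proj₁
        (λ {y} y³≈1 → ≡.trans (count-cong finite (λ z → onInfinitePlane? (y , z)) (λ z → (a 1F + a 2F * y) + a 3F * z ≟ 0#)
          (λ (_ , form≈0) → trans (sym (form-infinite y _)) form≈0)
          (λ eq → y³≈1 , trans (form-infinite y _) eq)) (count-linear _ a₃≉0)))
      (≡.trans (ℕ.*-identityˡ _) count-cube-roots)

    module _ (a₃≈0 : a 3F ≈ 0#) where
      form-infinite-vertical : ∀ y z → form a (infinite (y , z)) ≈ a 1F + a 2F * y
      form-infinite-vertical y z = trans (form-infinite y z)
        (trans (+-congˡ (trans (*-congʳ a₃≈0) (zeroˡ z))) (+-identityʳ _))

      direction? : Decidable (λ y → y ^ 3 ≈ 1# × a 1F + a 2F * y ≈ 0#)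
      direction? y = unity? y ×-dec (a 1F + a 2F * y ≟ 0#)

      -- A plane through the vertex, other than the plane at infinity, meets that plane in a single
      -- line through the vertex, which is one of the three lines of the hypersurface or none.
      count-direction : a 1F ≉ 0# ⊎ a 2F ≉ 0# → count finite direction? ≡ 0 ⊎ count finite direction? ≡ 1
      count-direction a₁₂≉0 = by-cases a₁₂≉0 (a 2F ≟ 0#)
        where
        module _ (a₂≉0 : a 2F ≉ 0#) where
          y₀ : Carrier
          y₀ = a 2F ⁻¹ * a 1F
          a₂y₀≈a₁ : a 2F * y₀ ≈ a 1F
          a₂y₀≈a₁ = trans (sym (*-assoc _ _ _)) (trans (*-congʳ (⁻¹-inverseʳ a₂≉0)) (*-identityˡ _))
          solution : ∀ {y} → a 1F + a 2F * y ≈ 0# → y ≈ y₀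
          solution eq = *-cancelˡ a₂≉0 (trans (sym (x+y≈0⇒x≈y eq)) (sym a₂y₀≈a₁))
          single : Dec (y₀ ^ 3 ≈ 1#) → count finite direction? ≡ 0 ⊎ count finite direction? ≡ 1
          single (no ¬root) = inj₁ (count-none finite direction? λ y (y³≈1 , eq) →
            ¬root (trans (^-congˡ 3 (sym (solution eq))) y³≈1))
          single (yes root) = inj₂ (count-unique finite direction? y₀ (solution ∘ proj₂)
            (λ y≈y₀ → trans (^-congˡ 3 y≈y₀) root , x≈y⇒x+y≈0 (sym (trans (*-congˡ y≈y₀) a₂y₀≈a₁))))
        by-cases : a 1F ≉ 0# ⊎ a 2F ≉ 0# → Dec (a 2F ≈ 0#) → count finite direction? ≡ 0 ⊎ count finite direction? ≡ 1
        by-cases _           (no a₂≉0)  = single a₂≉0 (unity? _)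
        -- In this case that line is X₁ = 0, which contains no point of the form `infinite (y , z)`.
        by-cases (inj₁ a₁≉0) (yes a₂≈0) = inj₁ (count-none finite direction? λ y (_ , eq) →
          a₁≉0 (trans (sym (trans (+-congˡ (trans (*-congʳ a₂≈0) (zeroˡ y))) (+-identityʳ _))) eq))
        by-cases (inj₂ a₂≉0) (yes a₂≈0) = contradiction a₂≈0 a₂≉0

      count-infinite-vertical : a 1F ≉ 0# ⊎ a 2F ≉ 0# →
        count pairs onInfinitePlane? ≡ 0 ⊎ count pairs onInfinitePlane? ≡ q ℕ.^ 2
      count-infinite-vertical a₁₂≉0 = [ inj₁ ∘ zero-directions , inj₂ ∘ one-direction ]′ (count-direction a₁₂≉0)
        where
        by-direction : count pairs onInfinitePlane? ≡ q ℕ.* q ℕ.* count finite direction?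
        by-direction = count-fibres finite finite direction? (λ y z → onInfinitePlane? (y , z)) (q ℕ.* q)
          (λ {y} {z} (y³≈1 , form≈0) → y³≈1 , trans (sym (form-infinite-vertical y z)) form≈0)
          (λ {y} (y³≈1 , eq) → ≡.trans
            (count-cong finite (λ z → onInfinitePlane? (y , z)) (λ _ → yes tt) _
              (λ {z} _ → y³≈1 , trans (form-infinite-vertical y z) eq)) count-all-elements)
        zero-directions : count finite direction? ≡ 0 → count pairs onInfinitePlane? ≡ 0
        zero-directions eq = ≡.trans by-direction (≡.trans (cong (q ℕ.* q ℕ.*_) eq) (ℕ.*-zeroʳ (q ℕ.* q)))
        one-direction : count finite direction? ≡ 1 → count pairs onInfinitePlane? ≡ q ℕ.^ 2
        one-direction eq = ≡.trans by-direction (≡.trans (cong (q ℕ.* q ℕ.*_) eq) (power q))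
          where
          power : ∀ q → q ℕ.* q ℕ.* 1 ≡ q ℕ.* (q ℕ.* 1)
          power = solve-∀

      count-infinite-infinity : a 1F ≈ 0# → a 2F ≈ 0# → count pairs onInfinitePlane? ≡ 3 ℕ.* q ℕ.^ 2
      count-infinite-infinity a₁≈0 a₂≈0 = ≡.trans
        (count-cong pairs onInfinitePlane? isInfinitePoint? proj₁
          (λ {(y , z)} y³≈1 → y³≈1 , trans (form-infinite-vertical y z)
            (trans (+-cong a₁≈0 (trans (*-congʳ a₂≈0) (zeroˡ y))) (+-identityʳ 0#))))
        count-infinite

  -- The equation of the hypersurface

  -- The degree (σ + 2) q, in the form produced by represents-^ and represents-*.
  D : ℕ
  D = (σ ℕ.+ 2) ℕ.* (q ℕ.* 1 ℕ.+ 0)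

  q*1+0≡q : q ℕ.* 1 ℕ.+ 0 ≡ q
  q*1+0≡q = ≡.trans (ℕ.+-identityʳ _) (ℕ.*-identityʳ q)

  1<q*1 : 1 ℕ.< q ℕ.* 1
  1<q*1 = ≡.subst (1 ℕ.<_) (≡.sym (ℕ.*-identityʳ q)) 1<q

  1<q*1+0 : 1 ℕ.< q ℕ.* 1 ℕ.+ 0
  1<q*1+0 = ≡.subst (1 ℕ.<_) (≡.sym q*1+0≡q) 1<q

  D≡σq+2q : D ≡ σ ℕ.* q ℕ.+ 2 ℕ.* q
  D≡σq+2q = ≡.trans (cong ((σ ℕ.+ 2) ℕ.*_) q*1+0≡q) (ℕ.*-distribʳ-+ q σ 2)

  σq<D : σ ℕ.* (q ℕ.* 1) ℕ.< D
  σq<D = ≡.subst₂ ℕ._<_ (cong (σ ℕ.*_) (≡.sym (ℕ.*-identityʳ q))) (≡.sym D≡σq+2q)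
    (ℕ.m<m+n (σ ℕ.* q) (ℕ.≤-trans q>0 (ℕ.m≤m+n q _)))

  2q<D : 2 ℕ.* q ℕ.< D
  2q<D = ≡.subst (2 ℕ.* q ℕ.<_) (≡.sym D≡σq+2q) (ℕ.m<n+m (2 ℕ.* q) (ℕ.*-mono-≤ σ>0 q>0))

  q+1<D : q ℕ.+ 1 ℕ.< D
  q+1<D = ℕ.≤-<-trans (ℕ.+-monoʳ-≤ q (ℕ.≤-trans q>0 (ℕ.≤-reflexive (≡.sym (ℕ.+-identityʳ q))))) 2q<D

  q<D : q ℕ.< D
  q<D = ℕ.≤-<-trans (ℕ.m≤m+n q 1) q+1<D

  module _ (X : Vector Carrier 4) where
    private
      ↑ : ℕ → ℕ → Carrier → Carrier
      ↑ = lift {x = X}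

    -- `Γ` homogenized in degree `D`: every `↑` supplies the power of X₀ that a summand lacks. The
    -- degrees are written as the `represents` lemmas compute them, so that no conversion of
    -- exponents is needed.
    G : Carrier → Carrier
    G x = (↑ 1 (q ℕ.* 1 ℕ.+ 0) x + (x ^ q + ↑ 1 (q ℕ.* 1) x) * ε) ^ (σ ℕ.+ 2)
      + ↑ (σ ℕ.* (q ℕ.* 1)) D ((x ^ q + ↑ 1 (q ℕ.* 1) x) ^ σ)
      + ↑ (2 ℕ.* q ℕ.* 1 ℕ.+ 0) D ((x ^ (2 ℕ.* q) + ↑ (2 ℕ.* 1) (2 ℕ.* q ℕ.* 1) (x ^ 2)) * ε)
      + ↑ ((q ℕ.+ 1) ℕ.* 1) D (x ^ (q ℕ.+ 1))
      + ↑ (2 ℕ.* 1) D (x ^ 2)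

    2q*1+0≡2q : 2 ℕ.* q ℕ.* 1 ℕ.+ 0 ≡ 2 ℕ.* q
    2q*1+0≡2q = ≡.trans (ℕ.+-identityʳ _) (ℕ.*-identityʳ (2 ℕ.* q))

    2q*1+0<D : 2 ℕ.* q ℕ.* 1 ℕ.+ 0 ℕ.< D
    2q*1+0<D = ≡.subst (ℕ._< D) (≡.sym 2q*1+0≡2q) 2q<D

    [q+1]*1<D : (q ℕ.+ 1) ℕ.* 1 ℕ.< D
    [q+1]*1<D = ≡.subst (ℕ._< D) (≡.sym (ℕ.*-identityʳ (q ℕ.+ 1))) q+1<D

    2<2q*1 : 2 ℕ.* 1 ℕ.< 2 ℕ.* q ℕ.* 1
    2<2q*1 = ≡.subst (2 ℕ.<_) (≡.sym (ℕ.*-identityʳ (2 ℕ.* q))) (ℕ.*-monoʳ-< 2 1<q)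

    2<D : 2 ℕ.* 1 ℕ.< D
    2<D = ℕ.≤-<-trans 1<q q<D

    1<D : 1 ℕ.< D
    1<D = ℕ.<-trans 1<q q<D

    q*1<D : q ℕ.* 1 ℕ.< D
    q*1<D = ≡.subst (ℕ._< D) (≡.sym (ℕ.*-identityʳ q)) q<D

    represents-Γ : ∀ {p : Poly 3} {x} → Represents X 1 p x → Represents X D (Γ ε p) (G x)
    represents-Γ r = represents-+ (represents-+ (represents-+ (represents-+
      (represents-^ (σ ℕ.+ 2) (represents-+ (represents-lift (ℕ.<⇒≤ 1<q*1+0) r) (represents-* L (represents-con ε))))
      (represents-lift (ℕ.<⇒≤ σq<D) (represents-^ σ L)))
      (represents-lift (ℕ.<⇒≤ 2q*1+0<D) (represents-*
        (represents-+ (represents-^ (2 ℕ.* q) r) (represents-lift (ℕ.<⇒≤ 2<2q*1) (represents-^ 2 r)))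
        (represents-con ε))))
      (represents-lift (ℕ.<⇒≤ [q+1]*1<D) (represents-^ (q ℕ.+ 1) r)))
      (represents-lift (ℕ.<⇒≤ 2<D) (represents-^ 2 r))
      where L = represents-+ (represents-^ q r) (represents-lift (ℕ.<⇒≤ 1<q*1) r)

    equation : Carrier
    equation = (↑ (q ℕ.* 1) D (X 3F ^ q) + ↑ 1 D (X 3F)) - (G (X 1F) + (G (X 2F) + 0#))

    represents-affinePoly : Represents X D (affinePoly ε 3) equation
    represents-affinePoly = represents--
      (represents-+ (represents-lift (ℕ.<⇒≤ q*1<D) (represents-^ q (represents-var 2F)))
                    (represents-lift (ℕ.<⇒≤ 1<D) (represents-var 2F)))
      (represents-+ (represents-Γ (represents-var 0F))
        (represents-+ (represents-Γ (represents-var 1F)) ([] , refl)))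

    module AtInfinity (X₀≈0 : X 0F ≈ 0#) where
      ↑≈0 : ∀ {d d′ v} → d ℕ.< d′ → ↑ d d′ v ≈ 0#
      ↑≈0 {d} {d′} d<d′ = trans (*-congʳ (trans (^-congˡ (d′ ℕ.∸ d) X₀≈0) (0^1+n≈0 (ℕ.m<n⇒0<n∸m d<d′)))) (zeroˡ _)

      -- Every lift raises the degree strictly and so carries a positive power of X₀. Only the part
      -- x^q ε of the base of the (σ + 2)-th power survives.
      G≈ : ∀ x → G x ≈ (x ^ q * ε) ^ (σ ℕ.+ 2)
      G≈ x = trans (+-cong (trans (+-cong (trans (+-cong (trans (+-cong
          (^-congˡ (σ ℕ.+ 2) (trans (+-cong (↑≈0 1<q*1+0) (*-congʳ (trans (+-congˡ (↑≈0 1<q*1)) (+-identityʳ _)))) (+-identityˡ _)))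
          (↑≈0 σq<D)) (+-identityʳ _)) (↑≈0 2q*1+0<D)) (+-identityʳ _)) (↑≈0 [q+1]*1<D)) (+-identityʳ _)) (↑≈0 2<D)) (+-identityʳ _)

      equation≈ : equation ≈ (X 1F ^ q * ε) ^ (σ ℕ.+ 2) + (X 2F ^ q * ε) ^ (σ ℕ.+ 2)
      equation≈ = trans (+-cong (trans (+-cong (↑≈0 q*1<D) (↑≈0 1<D)) (+-identityʳ _))
          (trans (-x≈x _) (+-cong (G≈ (X 1F)) (trans (+-identityʳ _) (G≈ (X 2F))))))
        (+-identityˡ _)

    module AtFinite (X₀≈1 : X 0F ≈ 1#) where
      ↑≈ : ∀ d d′ {v} → ↑ d d′ v ≈ v
      ↑≈ d d′ = trans (*-congʳ (trans (^-congˡ (d′ ℕ.∸ d) X₀≈1) (1^n≈1 (d′ ℕ.∸ d)))) (*-identityˡ _)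

      G≈γ : ∀ x → G x ≈ γ x
      G≈γ x = +-cong (+-cong (+-cong (+-cong
          (^-congˡ (σ ℕ.+ 2) (+-cong (↑≈ 1 (q ℕ.* 1 ℕ.+ 0)) (*-congʳ im≈)))
          (trans (↑≈ (σ ℕ.* (q ℕ.* 1)) D) (^-congˡ σ im≈)))
          (trans (↑≈ (2 ℕ.* q ℕ.* 1 ℕ.+ 0) D) (*-congʳ (+-congˡ (↑≈ (2 ℕ.* 1) (2 ℕ.* q ℕ.* 1))))))
          (↑≈ ((q ℕ.+ 1) ℕ.* 1) D)) (↑≈ (2 ℕ.* 1) D)
        where im≈ = +-congˡ (↑≈ 1 (q ℕ.* 1))

      equation≈ : equation ≈ im (X 3F) + (γ (X 1F) + γ (X 2F))
      equation≈ = +-cong (+-cong (↑≈ (q ℕ.* 1) D) (↑≈ 1 D))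
        (trans (-x≈x _) (+-cong (G≈γ (X 1F)) (trans (+-identityʳ _) (G≈γ (X 2F)))))

  ε≉0 : ε ≉ 0#
  ε≉0 ε≈0 = ε∉𝔽q (𝔽q-resp (sym ε≈0) 𝔽q-0)

  term≈0 : ∀ {x} → x ≈ 0# → (x ^ q * ε) ^ (σ ℕ.+ 2) ≈ 0#
  term≈0 x≈0 = trans (^-congˡ (σ ℕ.+ 2) (trans (*-congʳ (trans (^-congˡ q x≈0) 𝔽q-0)) (zeroˡ ε)))
                     (0^1+n≈0 (ℕ.≤-trans σ>0 (ℕ.m≤m+n σ 2)))

  term≈ : ∀ x → (x ^ q * ε) ^ (σ ℕ.+ 2) ≈ ε ^ (σ ℕ.+ 2) * (x ^ (σ ℕ.+ 2)) ^ q
  term≈ x = trans (^-distrib-* (x ^ q) ε (σ ℕ.+ 2)) (trans (*-comm _ _) (*-congˡ (^-comm x q (σ ℕ.+ 2))))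

  -- The coefficient of the `D`-th power of x₁ is ε^(σ+2), read off as the value at (0, 1, 0, 0),
  -- and ε is nonzero.
  deg-affinePoly : deg (affinePoly ε 3) ≡ D
  deg-affinePoly = deg-lead D (represents-affinePoly top) λ eq → ^-≉0 (σ ℕ.+ 2) ε≉0 (begin
    ε ^ (σ ℕ.+ 2)                          ≈⟨ ^-congˡ (σ ℕ.+ 2) (trans (*-congʳ (1^n≈1 q)) (*-identityˡ ε)) ⟨
    (1# ^ q * ε) ^ (σ ℕ.+ 2)               ≈⟨ trans (+-congˡ (term≈0 refl)) (+-identityʳ _) ⟨
    (1# ^ q * ε) ^ (σ ℕ.+ 2) + (0# ^ q * ε) ^ (σ ℕ.+ 2) ≈⟨ AtInfinity.equation≈ top refl ⟨
    equation top                           ≈⟨ eq ⟩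
    0#                                     ∎)

  eval≈equation : ∀ X → eval (homogenize (affinePoly ε 3)) X ≈ equation X
  eval≈equation X = trans (eval-homogenize (affinePoly ε 3) X)
    (trans (reflexive (cong (λ d → linear (homogeneous d X) (affinePoly ε 3)) deg-affinePoly))
           (Represents.value (represents-affinePoly X)))

  𝒱⇒equation : ∀ X → 𝒱 ε 3 X → equation X ≈ 0#
  𝒱⇒equation X X∈ = trans (sym (eval≈equation X)) X∈

  equation⇒𝒱 : ∀ X → equation X ≈ 0# → 𝒱 ε 3 X
  equation⇒𝒱 X eq = trans (eval≈equation X) eq

  𝒱-resp-∼ : ∀ {X Y} → X ∼ Y → 𝒱 ε 3 X → 𝒱 ε 3 Y
  𝒱-resp-∼ {X} {Y} (t , _ , Y≈tX) X∈ = equation⇒𝒱 Y (begin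
    equation Y                                       ≈⟨ Represents.value (represents-affinePoly Y) ⟨
    linear (homogeneous D Y) (affinePoly ε 3)        ≈⟨ homogeneous-scale X Y (Represents.bounded (represents-affinePoly X)) Y≈tX ⟩
    t ^ D * linear (homogeneous D X) (affinePoly ε 3) ≈⟨ *-congˡ (trans (Represents.value (represents-affinePoly X)) (𝒱⇒equation X X∈)) ⟩
    t ^ D * 0#                                       ≈⟨ zeroʳ _ ⟩
    0#                                               ∎)

  affine∈𝒱 : ∀ {p} → IsAffinePoint p → 𝒱 ε 3 (affine p)
  affine∈𝒱 {p} eq = equation⇒𝒱 (affine p) (trans (AtFinite.equation≈ (affine p) refl) (x≈y⇒x+y≈0 eq))

  𝒱-affine : ∀ {p} → 𝒱 ε 3 (affine p) → IsAffinePoint p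
  𝒱-affine {p} p∈ = x+y≈0⇒x≈y (trans (sym (AtFinite.equation≈ (affine p) refl)) (𝒱⇒equation (affine p) p∈))

  -- Additivity of the q-th power collects the two terms into one q-th power times a nonzero
  -- constant, so vanishing means y^(σ+2) = 1.
  infinite-equation : ∀ y z → equation (infinite (y , z)) ≈ ε ^ (σ ℕ.+ 2) * (1# + y ^ (σ ℕ.+ 2)) ^ q
  infinite-equation y z = begin
    equation (infinite (y , z))
      ≈⟨ AtInfinity.equation≈ (infinite (y , z)) refl ⟩
    (1# ^ q * ε) ^ (σ ℕ.+ 2) + (y ^ q * ε) ^ (σ ℕ.+ 2)
      ≈⟨ +-cong (term≈ 1#) (term≈ y) ⟩
    ε ^ (σ ℕ.+ 2) * (1# ^ (σ ℕ.+ 2)) ^ q + ε ^ (σ ℕ.+ 2) * (y ^ (σ ℕ.+ 2)) ^ q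
      ≈⟨ distribˡ _ _ _ ⟨
    ε ^ (σ ℕ.+ 2) * ((1# ^ (σ ℕ.+ 2)) ^ q + (y ^ (σ ℕ.+ 2)) ^ q)
      ≈⟨ *-congˡ (^q-+ _ _) ⟨
    ε ^ (σ ℕ.+ 2) * (1# ^ (σ ℕ.+ 2) + y ^ (σ ℕ.+ 2)) ^ q
      ≈⟨ *-congˡ (^-congˡ q (+-congʳ (1^n≈1 (σ ℕ.+ 2)))) ⟩
    ε ^ (σ ℕ.+ 2) * (1# + y ^ (σ ℕ.+ 2)) ^ q ∎

  infinite∈𝒱 : ∀ {y z} → y ^ 3 ≈ 1# → 𝒱 ε 3 (infinite (y , z))
  infinite∈𝒱 {y} {z} y³≈1 = equation⇒𝒱 (infinite (y , z)) (trans (infinite-equation y z) (trans (*-congˡ (trans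
    (^-congˡ q (x≈y⇒x+y≈0 (sym (y³≈1⇒y^[σ+2]≈1 y³≈1)))) 𝔽q-0)) (zeroʳ _)))

  𝒱-infinite : ∀ {y z} → 𝒱 ε 3 (infinite (y , z)) → y ^ 3 ≈ 1#
  𝒱-infinite {y} {z} p∈ = y^[σ+2]≈1⇒y³≈1 (sym (x+y≈0⇒x≈y (^-≈0 q (x*y≈0⇒y≈0 (^-≉0 (σ ℕ.+ 2) ε≉0)
    (trans (sym (infinite-equation y z)) (𝒱⇒equation (infinite (y , z)) p∈))))))

  -- Leaves the vertex as the only point of the third stratum.
  𝒱-X₀≈X₁≈0⇒X₂≈0 : ∀ X → 𝒱 ε 3 X → X 0F ≈ 0# → X 1F ≈ 0# → X 2F ≈ 0#
  𝒱-X₀≈X₁≈0⇒X₂≈0 X X∈ X₀≈0 X₁≈0 = ^-≈0 (σ ℕ.+ 2) (^-≈0 q (x*y≈0⇒y≈0 (^-≉0 (σ ℕ.+ 2) ε≉0) (begin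
    ε ^ (σ ℕ.+ 2) * (X 2F ^ (σ ℕ.+ 2)) ^ q  ≈⟨ term≈ (X 2F) ⟨
    (X 2F ^ q * ε) ^ (σ ℕ.+ 2)              ≈⟨ +-identityˡ _ ⟨
    0# + (X 2F ^ q * ε) ^ (σ ℕ.+ 2)         ≈⟨ +-congʳ (term≈0 X₁≈0) ⟨
    (X 1F ^ q * ε) ^ (σ ℕ.+ 2) + (X 2F ^ q * ε) ^ (σ ℕ.+ 2) ≈⟨ AtInfinity.equation≈ X X₀≈0 ⟨
    equation X                              ≈⟨ 𝒱⇒equation X X∈ ⟩
    0#                                      ∎)))

  vertex : Vector Carrier 4
  vertex = 0# Vector.∷ 0# Vector.∷ 0# Vector.∷ 1# Vector.∷ Vector.[]

  vertex∈𝒱 : 𝒱 ε 3 vertex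
  vertex∈𝒱 = equation⇒𝒱 vertex (trans (AtInfinity.equation≈ vertex refl)
    (trans (+-cong (term≈0 refl) (term≈0 refl)) (+-identityʳ 0#)))

  -- Columns of the point matrix

  -- Lets the vertex be counted by the same lemma as the two larger strata.
  ⊤-finite : Finite ⊤ _
  ⊤-finite = record { _≋_ = _≡_ ; _≋?_ = λ _ _ → yes ≡.refl ; elements = tt ∷ [] ; once = λ _ → ≡.refl }

  -- The strata represented by affine, infinite and vertex.
  S₁ S₂ S₃ : Vector Carrier 4 → Set ℓ₁
  S₁ X = X 0F ≉ 0#
  S₂ X = X 0F ≈ 0# × X 1F ≉ 0#
  S₃ X = X 0F ≈ 0# × X 1F ≈ 0#

  S₁? : Decidable S₁
  S₁? X = ¬? (X 0F ≟ 0#)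
  S₂? : Decidable S₂
  S₂? X = (X 0F ≟ 0#) ×-dec ¬? (X 1F ≟ 0#)
  S₃? : Decidable S₃
  S₃? X = (X 0F ≟ 0#) ×-dec (X 1F ≟ 0#)

  module _ {N : ℕ} (M : Vector (Vector Carrier N) 4) (isPointMatrix : IsPointMatrix (𝒱 ε 3) M) where
    open IsPointMatrix isPointMatrix

    columns : Finite (Fin N) _
    columns = Fin-finite N

    -- Each point of a stratum has one normalized representative `ν b`, whereas a column is some
    -- multiple of it. As `Z` is invariant under scaling, it may be tested on either; `distinct` and
    -- `complete` make the correspondence bijective.
    count-stratum : ∀ {b ℓ p r s} {B : Set b} (Y : Finite B ℓ)
      {S : Vector Carrier 4 → Set s} (S? : Decidable S) {Z : Vector Carrier 4 → Set p} (Z? : Decidable Z)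
      {Q : B → Set r} (Q? : Decidable Q) (ν : B → Vector Carrier 4) (norm : Vector Carrier 4 → B) →
      (∀ {X Y} → X ∼ Y → Z X → Z Y) →
      (∀ b → IsNonZero (ν b)) → (∀ {b} → Q b → 𝒱 ε 3 (ν b)) → (∀ {b} → 𝒱 ε 3 (ν b) → Q b) →
      (∀ X → IsNonZero X → 𝒱 ε 3 X → S X → ∀ {b} → Finite._≋_ Y b (norm X) → ν b ∼ X) →
      (∀ {X b} → ν b ∼ X → S X × Finite._≋_ Y b (norm X)) →
      count columns (λ j → S? (column j) ×-dec Z? (column j)) ≡ count Y (λ b → Q? b ×-dec Z? (ν b))
    count-stratum Y S? Z? Q? ν norm Z-resp ν≉0 Q⇒𝒱 𝒱⇒Q norm-sound norm-complete =
      count-bijection columns Y (λ j → S? (column j) ×-dec Z? (column j)) (λ b → Q? b ×-dec Z? (ν b)) (norm ∘ column)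
        (λ { P b≋ ≡.refl → P , b≋ })
        (λ {j} (Sj , Zj) b≋ → let X∼νb = ∼-sym (ν∼ j Sj b≋) in 𝒱⇒Q (𝒱-resp-∼ X∼νb (sound j)) , Z-resp X∼νb Zj)
        (λ {j} {j′} (Sj , _) (Sj′ , _) b≋ b≋′ → distinct j j′ (∼-trans (∼-sym (ν∼ j Sj b≋)) (ν∼ j′ Sj′ b≋′)))
        (λ {b} (Qb , Zb) → let j , νb∼X = complete (ν b) (ν≉0 b) (Q⇒𝒱 Qb)
                               Sj , b≋ = norm-complete νb∼X in
          j , (Sj , Z-resp νb∼X Zb) , b≋)
      where ν∼ = λ j → norm-sound (column j) (nonZero j) (sound j)

    module _ {p} {Z : Vector Carrier 4 → Set p} (Z? : Decidable Z) (Z-resp : ∀ {X Y} → X ∼ Y → Z X → Z Y) where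

      count-S₁ : count columns (λ j → S₁? (column j) ×-dec Z? (column j)) ≡
                 count triples (λ p → isAffinePoint? p ×-dec Z? (affine p))
      count-S₁ = count-stratum triples S₁? Z? isAffinePoint? affine
        (λ X → (X 1F * X 0F ⁻¹ , X 2F * X 0F ⁻¹) , X 3F * X 0F ⁻¹)
        Z-resp (λ _ → 0F , 1≉0) affine∈𝒱 𝒱-affine
        (λ X _ _ X₀≉0 ((x≈ , y≈) , z≈) → X 0F , X₀≉0 , λ where
          0F → sym (*-identityʳ _)
          1F → ≈*⁻¹⇒ X₀≉0 x≈
          2F → ≈*⁻¹⇒ X₀≉0 y≈
          3F → ≈*⁻¹⇒ X₀≉0 z≈)
        (λ (t , t≉0 , X≈) →
          let X₀≈t = trans (X≈ 0F) (*-identityʳ t)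
              X₀≉0 = λ X₀≈0 → t≉0 (trans (sym X₀≈t) X₀≈0)
              ratio = λ i → ⇒≈*⁻¹ X₀≉0 (trans (X≈ i) (*-congʳ (sym X₀≈t)))
          in X₀≉0 , (ratio 1F , ratio 2F) , ratio 3F)

      count-S₂ : count columns (λ j → S₂? (column j) ×-dec Z? (column j)) ≡
                 count pairs (λ p → isInfinitePoint? p ×-dec Z? (infinite p))
      count-S₂ = count-stratum pairs S₂? Z? isInfinitePoint? infinite
        (λ X → X 2F * X 1F ⁻¹ , X 3F * X 1F ⁻¹)
        Z-resp (λ _ → 1F , 1≉0) infinite∈𝒱 𝒱-infinite
        (λ X _ _ (X₀≈0 , X₁≉0) (y≈ , z≈) → X 1F , X₁≉0 , λ where
          0F → trans X₀≈0 (sym (zeroʳ _))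
          1F → sym (*-identityʳ _)
          2F → ≈*⁻¹⇒ X₁≉0 y≈
          3F → ≈*⁻¹⇒ X₁≉0 z≈)
        (λ (t , t≉0 , X≈) →
          let X₁≈t = trans (X≈ 1F) (*-identityʳ t)
              X₁≉0 = λ X₁≈0 → t≉0 (trans (sym X₁≈t) X₁≈0)
              ratio = λ i → ⇒≈*⁻¹ X₁≉0 (trans (X≈ i) (*-congʳ (sym X₁≈t)))
          in (trans (X≈ 0F) (zeroʳ t) , X₁≉0) , ratio 2F , ratio 3F)

      count-S₃ : count columns (λ j → S₃? (column j) ×-dec Z? (column j)) ≡
                 count ⊤-finite (λ _ → yes tt ×-dec Z? vertex)
      count-S₃ = count-stratum ⊤-finite S₃? Z? (λ _ → yes tt) (λ _ → vertex) _
        Z-resp (λ _ → 3F , 1≉0) (λ _ → vertex∈𝒱) _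
        (λ X X≉0 X∈𝒱 (X₀≈0 , X₁≈0) _ →
          let X₂≈0 = 𝒱-X₀≈X₁≈0⇒X₂≈0 X X∈𝒱 X₀≈0 X₁≈0 in
          X 3F , last-≉0 X X≉0 X₀≈0 X₁≈0 X₂≈0 , λ where
            0F → trans X₀≈0 (sym (zeroʳ _))
            1F → trans X₁≈0 (sym (zeroʳ _))
            2F → trans X₂≈0 (sym (zeroʳ _))
            3F → sym (*-identityʳ _))
        (λ (t , _ , X≈) → (trans (X≈ 0F) (zeroʳ t) , trans (X≈ 1F) (zeroʳ t)) , ≡.refl)
        where
        last-≉0 : ∀ (X : Vector Carrier 4) → IsNonZero X → X 0F ≈ 0# → X 1F ≈ 0# → X 2F ≈ 0# → X 3F ≉ 0#
        last-≉0 X (0F , X₀≉0) X₀≈0 _ _ = contradiction X₀≈0 X₀≉0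
        last-≉0 X (1F , X₁≉0) _ X₁≈0 _ = contradiction X₁≈0 X₁≉0
        last-≉0 X (2F , X₂≉0) _ _ X₂≈0 = contradiction X₂≈0 X₂≉0
        last-≉0 X (3F , X₃≉0) _ _ _ = X₃≉0

      count-columns : count columns (Z? ∘ column) ≡
        count triples (λ p → isAffinePoint? p ×-dec Z? (affine p)) ℕ.+
        (count pairs (λ p → isInfinitePoint? p ×-dec Z? (infinite p)) ℕ.+
         count ⊤-finite (λ _ → yes tt ×-dec Z? vertex))
      count-columns = ≡.trans (count-split columns (Z? ∘ column) (S₁? ∘ column)) (cong₂ ℕ._+_
        (≡.trans (count-cong columns (λ j → Z? (column j) ×-dec S₁? (column j)) (λ j → S₁? (column j) ×-dec Z? (column j))
          (λ (z , s) → s , z) (λ (s , z) → z , s)) count-S₁)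
        (≡.trans (count-split columns Z∖S₁? (λ j → ¬? (column j 1F ≟ 0#))) (cong₂ ℕ._+_
          (≡.trans (count-cong columns (λ j → Z∖S₁? j ×-dec ¬? (column j 1F ≟ 0#)) (λ j → S₂? (column j) ×-dec Z? (column j))
            (λ ((z , s) , s′) → (¬≉⇒≈ s , s′) , z) (λ ((s , s′) , z) → (z , λ ≉0 → ≉0 s) , s′)) count-S₂)
          (≡.trans (count-cong columns (λ j → Z∖S₁? j ×-dec ¬? (¬? (column j 1F ≟ 0#))) (λ j → S₃? (column j) ×-dec Z? (column j))
            (λ ((z , s) , s′) → (¬≉⇒≈ s , ¬≉⇒≈ s′) , z) (λ ((s , s′) , z) → (z , λ ≉0 → ≉0 s) , λ ≉0 → ≉0 s′)) count-S₃))))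
        where
        Z∖S₁? : Decidable (λ j → Z (column j) × ¬ S₁ (column j))
        Z∖S₁? j = Z? (column j) ×-dec ¬? (S₁? (column j))
        ¬≉⇒≈ : ∀ {x} → ¬ (x ≉ 0#) → x ≈ 0#
        ¬≉⇒≈ {x} = decidable-stable (x ≟ 0#)

    count-all-columns : count columns (λ _ → yes tt) ≡ q ℕ.^ 5 ℕ.+ (3 ℕ.* q ℕ.^ 2 ℕ.+ 1)
    count-all-columns = ≡.trans (count-columns (λ _ → yes tt) _) (cong₂ ℕ._+_
      (≡.trans (count-cong triples (λ p → isAffinePoint? p ×-dec yes tt) isAffinePoint? proj₁ (_, tt)) count-affine)
      (cong (ℕ._+ 1) (≡.trans (count-cong pairs (λ p → isInfinitePoint? p ×-dec yes tt) isInfinitePoint? proj₁ (_, tt)) count-infinite)))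

    -- Weights as complements of plane sections.

    module _ (a : Vector Carrier 4) where
      form-resp-∼ : ∀ {X Y} → X ∼ Y → form a X ≈ 0# → form a Y ≈ 0#
      form-resp-∼ {X} {Y} (t , _ , Y≈tX) formX≈0 = begin
        form a Y                 ≈⟨ +-cong (*-congˡ (Y≈tX 0F)) (+-cong (*-congˡ (Y≈tX 1F)) (+-cong (*-congˡ (Y≈tX 2F)) (+-congʳ (*-congˡ (Y≈tX 3F))))) ⟩
        form a (λ i → t * X i)   ≈⟨ solve 9 (λ t a₀ a₁ a₂ a₃ x₀ x₁ x₂ x₃ →
            a₀ :* (t :* x₀) :+ (a₁ :* (t :* x₁) :+ (a₂ :* (t :* x₂) :+ (a₃ :* (t :* x₃) :+ con false))) :=
            t :* (a₀ :* x₀ :+ (a₁ :* x₁ :+ (a₂ :* x₂ :+ (a₃ :* x₃ :+ con false)))))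
            refl t (a 0F) (a 1F) (a 2F) (a 3F) (X 0F) (X 1F) (X 2F) (X 3F) ⟩
        t * form a X             ≈⟨ *-congˡ formX≈0 ⟩
        t * 0#                   ≈⟨ zeroʳ t ⟩
        0#                       ∎

      form-vertex : form a vertex ≈ a 3F
      form-vertex = solve 4 (λ a₀ a₁ a₂ a₃ → a₀ :* con false :+ (a₁ :* con false :+ (a₂ :* con false :+ (a₃ :* con true :+ con false))) := a₃)
        refl (a 0F) (a 1F) (a 2F) (a 3F)

      vertexIndicator : ℕ
      vertexIndicator = count ⊤-finite (λ _ → yes tt ×-dec (form a vertex ≟ 0#))

      vertexIndicator≡0 : a 3F ≉ 0# → vertexIndicator ≡ 0
      vertexIndicator≡0 a₃≉0 = count-none ⊤-finite (λ _ → yes tt ×-dec (form a vertex ≟ 0#))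
        λ _ (_ , form≈0) → a₃≉0 (trans (sym form-vertex) form≈0)

      vertexIndicator≡1 : a 3F ≈ 0# → vertexIndicator ≡ 1
      vertexIndicator≡1 a₃≈0 = count-unique ⊤-finite (λ _ → yes tt ×-dec (form a vertex ≟ 0#)) tt
        (λ _ → ≡.refl) (λ _ → tt , trans form-vertex a₃≈0)

      -- The zero entries of the codeword are the columns lying on the plane with coefficients `a`,
      -- so zeros and nonzeros together give the number of points.
      weight-complement : ∀ {w} → (∀ j → w j ≈ form a (column j)) →
        weight w ℕ.+ (count triples (onAffinePlane? a) ℕ.+ (count pairs (onInfinitePlane? a) ℕ.+ vertexIndicator)) ≡
        q ℕ.^ 5 ℕ.+ (3 ℕ.* q ℕ.^ 2 ℕ.+ 1)
      weight-complement {w} w≈ = ≡.trans (cong₂ ℕ._+_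
          (≡.trans (Vec-count-tabulate (λ x → ¬? (x ≟ 0#)) w)
            (count-cong columns (λ j → ¬? (w j ≟ 0#)) (λ j → yes tt ×-dec ¬? (zero? j))
              (λ {j} w≉0 → tt , λ form≈0 → w≉0 (trans (w≈ j) form≈0))
              (λ {j} (_ , form≉0) w≈0 → form≉0 (trans (sym (w≈ j)) w≈0))))
          (≡.trans (≡.sym (count-columns (λ X → form a X ≟ 0#) form-resp-∼))
            (count-cong columns zero? (λ j → yes tt ×-dec zero? j) (tt ,_) proj₂)))
        (≡.trans (ℕ.+-comm (count columns (λ j → yes tt ×-dec ¬? (zero? j))) _)
        (≡.trans (≡.sym (count-split columns (λ _ → yes tt) zero?)) count-all-columns))
        where
        zero? : Decidable (λ j → form a (column j) ≈ 0#)
        zero? j = form a (column j) ≟ 0#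

      weights : List ℕ
      weights = q ℕ.^ 5
        ∷ q ℕ.^ 5 ℕ.∸ q ℕ.^ 3 ℕ.+ 3 ℕ.* q ℕ.^ 2
        ∷ q ℕ.^ 5 ℕ.∸ q ℕ.^ 3 ℕ.+ 2 ℕ.* q ℕ.^ 2
        ∷ q ℕ.^ 5 ℕ.∸ q ℕ.^ 3 ℕ.+ 3 ℕ.* q ℕ.^ 2 ℕ.+ q ℕ.∸ 2
        ∷ q ℕ.^ 5 ℕ.∸ q ℕ.^ 3 ℕ.+ 2 ℕ.* q ℕ.^ 2 ℕ.+ q ℕ.∸ 2
        ∷ []

      module _ {w : Vector Carrier N} (w≈ : ∀ j → w j ≈ form a (column j)) where
        q³+r≡q⁵ : q ℕ.^ 3 ℕ.+ (q ℕ.^ 5 ℕ.∸ q ℕ.^ 3) ≡ q ℕ.^ 5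
        q³+r≡q⁵ = ℕ.m+[n∸m]≡n (ℕ.^-monoʳ-≤ q {{ℕ.>-nonZero q>0}} {3} {5} (ℕ.s≤s (ℕ.s≤s (ℕ.s≤s ℕ.z≤n))))

        complement : ∀ {A I V} → count triples (onAffinePlane? a) ≡ A →
          count pairs (onInfinitePlane? a) ≡ I → vertexIndicator ≡ V →
          weight w ℕ.+ (A ℕ.+ (I ℕ.+ V)) ≡ q ℕ.^ 3 ℕ.+ (q ℕ.^ 5 ℕ.∸ q ℕ.^ 3) ℕ.+ (3 ℕ.* q ℕ.^ 2 ℕ.+ 1)
        complement ≡.refl ≡.refl ≡.refl = ≡.trans (weight-complement w≈)
          (cong (ℕ._+ (3 ℕ.* q ℕ.^ 2 ℕ.+ 1)) (≡.sym q³+r≡q⁵))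

        weight-nonvertical : a 3F ≉ 0# → weight w ∈ weights
        weight-nonvertical a₃≉0 =
          [ there ∘ there ∘ there ∘ here ∘ nonvertical-secant _ _ _ _ (q ℕ.^ 2) q eq
          , there ∘ there ∘ there ∘ there ∘ here ∘ nonvertical-tangent _ _ _ (q ℕ.^ 3) (q ℕ.^ 2) q eq
          ]′ (count-affine-nonvertical a a₃≉0)
          where eq = complement ≡.refl (count-infinite-nonvertical a a₃≉0) (vertexIndicator≡0 a₃≉0)

        weight-vertical : a 3F ≈ 0# → a 1F ≉ 0# ⊎ a 2F ≉ 0# → weight w ∈ weights
        weight-vertical a₃≈0 a₁₂≉0 =
          [ (λ I≡ → there (here (vertical-0 _ _ (q ℕ.^ 3) (q ℕ.^ 2) (complement A≡ I≡ V≡))))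
          , (λ I≡ → there (there (here (vertical-1 _ _ (q ℕ.^ 3) (q ℕ.^ 2) (complement A≡ I≡ V≡)))))
          ]′ (count-infinite-vertical a a₃≈0 a₁₂≉0)
          where
          A≡ = count-affine-vertical a a₃≈0 a₁₂≉0
          V≡ = vertexIndicator≡1 a₃≈0

        -- The plane is X₀ = 0; it misses all affine points and contains all others, leaving q⁵ as
        -- the weight.
        weight-infinity : a 3F ≈ 0# → a 1F ≈ 0# → a 2F ≈ 0# → a 0F ≉ 0# → weight w ∈ weights
        weight-infinity a₃≈0 a₁≈0 a₂≈0 a₀≉0 = here (≡.trans
          (ℕ.+-cancelʳ-≡ (3 ℕ.* q ℕ.^ 2 ℕ.+ 1) (weight w) _ (complement
            (count-affine-infinity a a₃≈0 a₁≈0 a₂≈0 a₀≉0)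
            (count-infinite-infinity a a₃≈0 a₁≈0 a₂≈0) (vertexIndicator≡1 a₃≈0)))
          q³+r≡q⁵)

        weight∈weights : IsNonZero w → weight w ∈ weights
        weight∈weights (j , wj≉0) = by-cases (a 3F ≟ 0#) (a 1F ≟ 0#) (a 2F ≟ 0#)
          where
          by-cases : Dec (a 3F ≈ 0#) → Dec (a 1F ≈ 0#) → Dec (a 2F ≈ 0#) → weight w ∈ weights
          by-cases (no a₃≉0)  _          _          = weight-nonvertical a₃≉0
          by-cases (yes a₃≈0) (no a₁≉0)  _          = weight-vertical a₃≈0 (inj₁ a₁≉0)
          by-cases (yes a₃≈0) (yes _)    (no a₂≉0)  = weight-vertical a₃≈0 (inj₂ a₂≉0)
          -- If `a 0F` vanished too, every entry of `w` would be zero, against `wj≉0`.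
          by-cases (yes a₃≈0) (yes a₁≈0) (yes a₂≈0) = weight-infinity a₃≈0 a₁≈0 a₂≈0 λ a₀≈0 →
            wj≉0 (begin
              w j                ≈⟨ w≈ j ⟩
              form a (column j)  ≈⟨ +-cong (absorb a₀≈0 _) (+-cong (absorb a₁≈0 _) (+-cong (absorb a₂≈0 _) (+-congʳ (absorb a₃≈0 _)))) ⟩
              0# + (0# + (0# + (0# + 0#))) ≈⟨ solve 0 (con false :+ (con false :+ (con false :+ (con false :+ con false))) := con false) refl ⟩
              0#                 ∎)
            where
            absorb : ∀ {b} → b ≈ 0# → ∀ x → b * x ≈ 0#
            absorb b≈0 x = trans (*-congʳ b≈0) (zeroˡ x)

open import Data.Nat.Base using (_+_; _*_; _∸_; _^_; _≤_)

theorem3p3 :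
  ∀ {c ℓ₁ ℓ₂ : Level} (e : ℕ) → 3 ≤ e → ¬ (2 ∣ e) → e % 4 ≡ 3 →
  (F : FiniteField c ℓ₁ ℓ₂ ((2 ^ e) ^ 2)) →
  let open FiniteField F using (Carrier)
      open Projective F
      open Hypersurface e F
  in
  (ε δ : Carrier) → Admissible ε δ →
  (N : ℕ) (G : Vector (Vector Carrier N) 4) → IsPointMatrix (𝒱 ε 3) G →
  (w : Vector Carrier N) → RowSpan G w → IsNonZero w →
  weight w ∈
    ( q ^ 5
    ∷ q ^ 5 ∸ q ^ 3 + 3 * q ^ 2
    ∷ q ^ 5 ∸ q ^ 3 + 2 * q ^ 2
    ∷ q ^ 5 ∸ q ^ 3 + 3 * q ^ 2 + q ∸ 2
    ∷ q ^ 5 ∸ q ^ 3 + 2 * q ^ 2 + q ∸ 2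
    ∷ [] )
theorem3p3 e _ _ e%4≡3 F ε δ admissible N G isPointMatrix w (a , w≈) w≉0 =
  TitsHypersurface.weight∈weights e e%4≡3 F ε δ admissible G isPointMatrix a w≈ w≉0
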